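{- Let $G$ be a unicyclic graph with $n\geq 6$ vertices and let $h:\mathbb{Z}^+\to\mathbb{R}$. (1) If $h$ is strictly increasing, then \[ n\,h(1)+\frac12 n(n-3)\,h(2)\leq W_h(G)\leq F_h(3,n)=n\,h(1)+\sum_{j=2}^{n-2}(n-j)\,h(j), \] with equality in the lower bound if and only if $G\cong J_n$, and equality in the upper bound if and only if $G\cong G_{3,n}$. (2) If $h$ is strictly decreasing, then \[ F_h(3,n)\leq W_h(G)\leq n\,h(1)+\frac12 n(n-3)\,h(2), \] with equality in the lower bound if and only if $G\cong G_{3,n}$, and equality in the upper bound if and only if $G\cong J_n$.
   Context: Graphs are finite, connected, simple. A unicyclic graph is a connected graph containing exactly one cycle. For a function $h:\mathbb{Z}^+\to\mathbb{R}$, the $h$-Wiener index is $W_h(G)=\sum_{\{u,v\}\subseteq V(G)} h(d(u,v))$, summed over unordered pairs of distinct vertices, $d$ the shortest-path distance. $J_n$ ($n\ge4$) is the graph obtained by identifying a vertex of a triangle $C_3$ with the center (vertex of degree $n-3$) of a star with $n-2$ vertices. $G_{3,n}$ is the graph obtained by identifying a vertex of a triangle $C_3$ with an endpoint of a path with $n-2$ vertices. -}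

module Defs where

open import Level using (Level; _⊔_) renaming (suc to lsuc)
open import Data.Nat as ℕ using (ℕ; zero; suc; _∸_; _≤ᵇ_; _≡ᵇ_)
open import Data.Bool using (Bool; true; false; _∧_; _∨_; not; if_then_else_)
open import Data.Fin using (Fin; toℕ; _≟_)
open import Data.List using (List; []; _∷_; foldr; map; concatMap; filter; allFin; upTo; length)
open import Data.Bool.ListAction using (any)
open import Data.Product using (_×_; ∃-syntax; Σ-syntax)
open import Data.Sum using (_⊎_)
open import Relation.Nullary.Decidable using (⌊_⌋)
open import Relation.Binary.PropositionalEquality using (_≡_)
open import Relation.Binary.Structures using (IsStrictTotalOrder)
open import Algebra.Structures using (IsAbelianGroup)
open import Function.Bundles using (_↔_; Inverse)

-- Codomain of h: a totally ordered abelian group (ℝ is one)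

record OrderedAbelianGroup (c ℓ : Level) : Set (lsuc (c ⊔ ℓ)) where
  field
    Carrier            : Set c
    _+_                : Carrier → Carrier → Carrier
    0#                 : Carrier
    -_                 : Carrier → Carrier
    _<_                : Carrier → Carrier → Set ℓ
    isAbelianGroup     : IsAbelianGroup _≡_ _+_ 0# -_
    isStrictTotalOrder : IsStrictTotalOrder _≡_ _<_
    +-mono-<           : ∀ {x y} z → x < y → (x + z) < (y + z)

  infixl 6 _+_

  _≤_ : Carrier → Carrier → Set (c ⊔ ℓ)
  x ≤ y = (x < y) ⊎ (x ≡ y)

  _·_ : ℕ → Carrier → Carrier
  zero  · x = 0#
  suc k · x = x + (k · x)

  infixr 7 _·_

  sumFromTo : ℕ → ℕ → (ℕ → Carrier) → Carrier
  sumFromTo a b f = foldr (λ j acc → f j + acc) 0# (map (λ i → a ℕ.+ i) (upTo (suc b ∸ a)))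

Adj : ℕ → Set
Adj n = Fin n → Fin n → Bool

record Graph (n : ℕ) : Set where
  field
    adj     : Adj n
    symm    : ∀ u v → adj u v ≡ adj v u
    irrefl  : ∀ u → adj u u ≡ false

module _ {n : ℕ} where

  _==_ : Fin n → Fin n → Bool
  u == v = ⌊ u ≟ v ⌋

  reach : Adj n → ℕ → Fin n → Fin n → Bool
  reach A zero    u v = u == v
  reach A (suc k) u v = reach A k u v ∨ any (λ w → reach A k u w ∧ A w v) (allFin n)

  -- least k ≤ fuel with p k true (returns fuel if none)
  firstTrue : ℕ → (ℕ → Bool) → ℕ
  firstTrue zero     p = zero
  firstTrue (suc f)  p = if p zero then zero else suc (firstTrue f (λ k → p (suc k)))

  -- shortest-path distance (walks of length < n suffice in a connected graph)
  dist : Graph n → Fin n → Fin n → ℕ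
  dist G u v = firstTrue n (λ k → reach (Graph.adj G) k u v)

  Connected : Graph n → Set
  Connected G = ∀ u v → ∃[ k ] (reach (Graph.adj G) k u v ≡ true)

  degIn : Adj n → Fin n → ℕ
  degIn S v = length (filter (λ w → S v w ≡? true) (allFin n))
    where
      open import Data.Bool.Properties using () renaming (_≟_ to _≡?_)

  IsCycle : Graph n → Adj n → Set
  IsCycle G S =
      (∀ u v → S u v ≡ S v u)
    × (∀ u v → S u v ≡ true → Graph.adj G u v ≡ true)
    × (∃[ u ] ∃[ v ] (S u v ≡ true))
    × (∀ v → (degIn S v ≡ 0) ⊎ (degIn S v ≡ 2))
    × (∀ u v → 0 ℕ.< degIn S u → 0 ℕ.< degIn S v → ∃[ k ] (reach S k u v ≡ true))

  Unicyclic : Graph n → Set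
  Unicyclic G =
    Connected G × (∃[ C ] (IsCycle G C × (∀ C′ → IsCycle G C′ → ∀ u v → C′ u v ≡ C u v)))

  _≅_ : Graph n → Adj n → Set
  G ≅ H = Σ[ σ ∈ (Fin n ↔ Fin n) ] (∀ u v → H (Inverse.to σ u) (Inverse.to σ v) ≡ Graph.adj G u v)

  pairs : List (Fin n × Fin n)
  pairs = concatMap (λ u → map (λ v → u , v) (filter (λ v → toℕ u ℕ.<? toℕ v) (allFin n))) (allFin n)
    where open import Data.Product using (_,_)

module _ {c ℓ} (A : OrderedAbelianGroup c ℓ) where
  open OrderedAbelianGroup A

  W : ∀ {n} → (ℕ → Carrier) → Graph n → Carrier
  W h G = foldr (λ p acc → h (dist G (proj₁ p) (proj₂ p)) + acc) 0# pairs
    where open import Data.Product using (proj₁; proj₂)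

  F3 : (ℕ → Carrier) → ℕ → Carrier
  F3 h n = n · h 1 + sumFromTo 2 (n ∸ 2) (λ j → (n ∸ j) · h j)

  -- n h(1) + ½ n(n-3) h(2)   (n(n-3) is always even)
  LowJ : (ℕ → Carrier) → ℕ → Carrier
  LowJ h n = n · h 1 + ((n ℕ.* (n ∸ 3)) ℕ./ 2) · h 2

  StrictlyIncreasing : (ℕ → Carrier) → Set ℓ
  StrictlyIncreasing h = ∀ i j → 1 ℕ.≤ i → i ℕ.< j → h i < h j

  StrictlyDecreasing : (ℕ → Carrier) → Set ℓ
  StrictlyDecreasing h = ∀ i j → 1 ℕ.≤ i → i ℕ.< j → h j < h i

-- J_n: triangle 0,1,2; vertex 0 is also the centre of a star, adjacent to 3,...,n-1
-- (so 0 is adjacent to every other vertex, plus the edge 12)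
edgeJ : ℕ → ℕ → Bool
edgeJ a b = ((a ≡ᵇ 0) ∧ (1 ≤ᵇ b)) ∨ ((a ≡ᵇ 1) ∧ (b ≡ᵇ 2))

Jn : (n : ℕ) → Adj n
Jn n u v = edgeJ (toℕ u) (toℕ v) ∨ edgeJ (toℕ v) (toℕ u)

-- G_{3,n}: triangle 0,1,2 and path 0,3,4,...,n-1 (n-2 vertices) attached at 0
edgeG3 : ℕ → ℕ → Bool
edgeG3 a b = ((a ≡ᵇ 0) ∧ ((b ≡ᵇ 1) ∨ (b ≡ᵇ 2) ∨ (b ≡ᵇ 3)))
           ∨ ((a ≡ᵇ 1) ∧ (b ≡ᵇ 2))
           ∨ ((3 ≤ᵇ a) ∧ (b ≡ᵇ suc a))

G3n : (n : ℕ) → Adj n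
G3n n u v = edgeG3 (toℕ u) (toℕ v) ∨ edgeG3 (toℕ v) (toℕ u)

{-# OPTIONS --safe #-}
-- Write S t for the number of unordered pairs at distance at most t. By summation by parts, for strictly increasing h
-- a pointwise comparison of two such counting functions gives the comparison of the sums of h, with equality only if
-- the counting functions agree; decreasing h is the increasing case in the opposite order.
--
-- Lower bound: two edges outside a breadth-first tree would have distinct fundamental cycles, so S 1 ≤ n. Equality
-- means diameter 2, and then a vertex of eccentricity 2 has degree at most 2, as two of its neighbours off a shortest
-- path of length 2 would force two extra edges; for n ≥ 6 some vertex is therefore adjacent to all others.
--
-- Upper bound: list the vertices so that each is adjacent to an earlier one. The distances from the i-th vertex to the
-- earlier ones have no gaps, so at least min t (i - 1) of them are at most t. The cycle improves one of these bounds by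
-- one: at the last cycle vertex if t is small, and otherwise at the vertex preceded by exactly t + 1 others, since the
-- cycle forces two of those to have equal distance from it. Summing gives the counting function of G_{3,n}. In the
-- case of equality exactly two pairs have the maximal distance n - 2; they share a vertex, and the levels around it
-- exhibit G_{3,n}.

module Submission where

open import Defs
open import Level using (Level)
open import Data.Nat as ℕ using (ℕ; zero; suc; _+_; _*_; _∸_; _⊓_; _<_; z≤n; s≤s; pred)
import Data.Nat.Properties as ℕₚ
import Data.Nat.DivMod as DivMod
import Relation.Binary.Construct.Flip.EqAndOrd as Flip
open import Data.Nat.Solver using (module +-*-Solver)
open import Data.Bool using (Bool; true; false; _∧_; _∨_)
import Data.Bool.Properties as Boolₚ
open import Data.Bool.ListAction using (any)
open import Data.Empty using (⊥-elim)
open import Data.Fin as Fin using (Fin; toℕ; fromℕ<)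
import Data.Fin.Properties as Finₚ
import Data.Fin.Permutation as Perm
open import Data.List using (List; []; _∷_; _++_; map; foldr; concatMap; filter; allFin; upTo; length; replicate)
import Data.List.Properties as Listₚ
open import Data.List.Membership.Propositional using (_∈_; _∉_; find; lose)
import Data.List.Membership.Propositional.Properties as ∈ₚ
open import Data.List.Relation.Unary.All as All using (All; []; _∷_)
open import Data.List.Relation.Unary.All.Properties using (¬All⇒Any¬)
open import Data.List.Relation.Unary.Any using (here; there)
open import Data.List.Relation.Unary.Unique.Propositional using (Unique; []; _∷_)
import Data.List.Relation.Unary.Unique.Propositional.Properties as Uniqueₚ
open import Data.Product using (∃; _×_; _,_; proj₁; proj₂)
open import Data.Sum using (_⊎_; inj₁; inj₂; [_,_]′)
open import Function.Base using (_∘_; id; case_of_)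
open import Function.Bundles using (_⇔_; _↔_; Inverse; mk⇔)
open import Function.Definitions using (Injective)
open import Relation.Binary.Structures using (IsStrictTotalOrder)
open import Algebra.Structures using (IsAbelianGroup)
open import Relation.Binary.Definitions using (tri<; tri≈; tri>)
open import Relation.Binary.PropositionalEquality
open import Relation.Nullary using (¬_; Dec; yes; no; does; contradiction)
open import Relation.Nullary.Decidable using (_×-dec_; _⊎-dec_; ¬?; decidable-stable)

-- The statement opens the _≤_ of the group, so the one on ℕ must not be visible there.
module _ where

  open import Data.Nat using (_≤_)

  -- The list `pairs` depends on the numbering of the vertices, whereas sums over ordered pairs
  -- survive any relabelling. All counts of close or far pairs are therefore taken over ordered
  -- pairs, which is where the factors 2 come from. Each extremal value is the sum of `h` over an
  -- explicit list of distances. Both bounds, and the implications from isomorphism to equality,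
  -- thus become instances of one comparison of lists, `compare`, applied in either direction. Small
  -- graphs explain the constants. The pentagon has the same multiset of distances as J_5, and in
  -- the four-cycle the two pairs at the maximal distance n - 2 are disjoint; the two equality cases
  -- have to exclude these configurations. A cycle is given as an edge relation with degrees 0 or 2,
  -- not as a cyclic sequence of vertices. Its existence is exploited locally, through a vertex with
  -- two earlier neighbours; its uniqueness is exploited by exhibiting fundamental cycles as
  -- relations of this kind.

  -- Indicators and finite sums of natural numbers.

  ⟦_⟧ : ∀ {p} {P : Set p} → Dec P → ℕ
  ⟦ yes _ ⟧ = 1
  ⟦ no  _ ⟧ = 0

  module _ {p : Level} {P : Set p} where

    ⟦⟧-yes : (d : Dec P) → P → ⟦ d ⟧ ≡ 1
    ⟦⟧-yes (yes _) _ = refl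
    ⟦⟧-yes (no ¬p) p = contradiction p ¬p

    ⟦⟧-no : (d : Dec P) → ¬ P → ⟦ d ⟧ ≡ 0
    ⟦⟧-no (yes p) ¬p = contradiction p ¬p
    ⟦⟧-no (no _)  _  = refl

    ⟦⟧≤1 : (d : Dec P) → ⟦ d ⟧ ≤ 1
    ⟦⟧≤1 (yes _) = ℕₚ.≤-refl
    ⟦⟧≤1 (no _)  = z≤n

    ⟦⟧-≤ : (d : Dec P) {m : ℕ} → (P → 1 ≤ m) → ⟦ d ⟧ ≤ m
    ⟦⟧-≤ (yes p) f = f p
    ⟦⟧-≤ (no _)  f = z≤n

  ⟦⟧-mono : ∀ {p q} {P : Set p} {Q : Set q} (d : Dec P) (e : Dec Q) → (P → Q) → ⟦ d ⟧ ≤ ⟦ e ⟧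
  ⟦⟧-mono d e f = ⟦⟧-≤ d (λ p → ℕₚ.≤-reflexive (sym (⟦⟧-yes e (f p))))

  ⟦⟧-cong : ∀ {p q} {P : Set p} {Q : Set q} (d : Dec P) (e : Dec Q) → (P → Q) → (Q → P) → ⟦ d ⟧ ≡ ⟦ e ⟧
  ⟦⟧-cong d e f g = ℕₚ.≤-antisym (⟦⟧-mono d e f) (⟦⟧-mono e d g)

  ⟦⟧+⟦¬⟧ : ∀ {p} {P : Set p} (d : Dec P) → ⟦ d ⟧ + ⟦ ¬? d ⟧ ≡ 1
  ⟦⟧+⟦¬⟧ (yes _) = refl
  ⟦⟧+⟦¬⟧ (no _)  = refl

  ≤-suc-split : ∀ d s → ⟦ d ℕ.≤? suc s ⟧ ≡ ⟦ d ℕ.≤? s ⟧ + ⟦ d ℕ.≟ suc s ⟧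
  ≤-suc-split d s with d ℕ.≤? s | d ℕ.≟ suc s
  ... | yes d≤s | yes d≡ = contradiction (subst (_≤ s) d≡ d≤s) ℕₚ.1+n≰n
  ... | yes d≤s | no _   = ⟦⟧-yes (d ℕ.≤? suc s) (ℕₚ.m≤n⇒m≤1+n d≤s)
  ... | no d≰s  | yes d≡ = ⟦⟧-yes (d ℕ.≤? suc s) (ℕₚ.≤-reflexive d≡)
  ... | no d≰s  | no d≢  = ⟦⟧-no (d ℕ.≤? suc s) (λ d≤ → d≢ (ℕₚ.≤-antisym d≤ (ℕₚ.≰⇒> d≰s)))

  variable
    ℓx ℓy : Level
    X : Set ℓx
    Y : Set ℓy

  ∑ : List X → (X → ℕ) → ℕ
  ∑ []       f = 0
  ∑ (x ∷ xs) f = f x + ∑ xs f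

  ∑-mono : (xs : List X) {f g : X → ℕ} → (∀ x → x ∈ xs → f x ≤ g x) → ∑ xs f ≤ ∑ xs g
  ∑-mono []       h = z≤n
  ∑-mono (x ∷ xs) h = ℕₚ.+-mono-≤ (h x (here refl)) (∑-mono xs (λ y y∈ → h y (there y∈)))

  ∑-cong : (xs : List X) {f g : X → ℕ} → (∀ x → x ∈ xs → f x ≡ g x) → ∑ xs f ≡ ∑ xs g
  ∑-cong xs h = ℕₚ.≤-antisym (∑-mono xs (λ x x∈ → ℕₚ.≤-reflexive (h x x∈)))
                             (∑-mono xs (λ x x∈ → ℕₚ.≤-reflexive (sym (h x x∈))))

  +-interchange : ∀ a b c d → (a + b) + (c + d) ≡ (a + c) + (b + d)
  +-interchange = solve 4 (λ a b c d → (a :+ b) :+ (c :+ d) := (a :+ c) :+ (b :+ d)) refl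
    where open +-*-Solver

  ∑-+ : (xs : List X) (f g : X → ℕ) → ∑ xs (λ x → f x + g x) ≡ ∑ xs f + ∑ xs g
  ∑-+ []       f g = refl
  ∑-+ (x ∷ xs) f g = trans (cong (f x + g x +_) (∑-+ xs f g)) (+-interchange (f x) (g x) (∑ xs f) (∑ xs g))

  ∑-const : (xs : List X) (k : ℕ) → ∑ xs (λ _ → k) ≡ length xs * k
  ∑-const []       k = refl
  ∑-const (x ∷ xs) k = cong (k +_) (∑-const xs k)

  ∑-*ˡ : (xs : List X) (k : ℕ) (f : X → ℕ) → ∑ xs (λ x → k * f x) ≡ k * ∑ xs f
  ∑-*ˡ []       k f = sym (ℕₚ.*-zeroʳ k)
  ∑-*ˡ (x ∷ xs) k f = trans (cong (k * f x +_) (∑-*ˡ xs k f)) (sym (ℕₚ.*-distribˡ-+ k (f x) (∑ xs f)))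

  ∑-one : (xs : List X) → ∑ xs (λ _ → 1) ≡ length xs
  ∑-one xs = trans (∑-const xs 1) (ℕₚ.*-identityʳ _)

  ∑-zero : (xs : List X) {f : X → ℕ} → (∀ x → x ∈ xs → f x ≡ 0) → ∑ xs f ≡ 0
  ∑-zero xs h = trans (∑-cong xs h) (trans (∑-const xs 0) (ℕₚ.*-zeroʳ (length xs)))

  ∑-swap : (xs : List X) (ys : List Y) (f : X → Y → ℕ) →
           ∑ xs (λ x → ∑ ys (f x)) ≡ ∑ ys (λ y → ∑ xs (λ x → f x y))
  ∑-swap []       ys f = sym (∑-zero ys (λ _ _ → refl))
  ∑-swap (x ∷ xs) ys f = trans (cong (∑ ys (f x) +_) (∑-swap xs ys f)) (sym (∑-+ ys (f x) _))

  ∑-++ : (xs ys : List X) (f : X → ℕ) → ∑ (xs ++ ys) f ≡ ∑ xs f + ∑ ys f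
  ∑-++ []       ys f = refl
  ∑-++ (x ∷ xs) ys f = trans (cong (f x +_) (∑-++ xs ys f)) (sym (ℕₚ.+-assoc (f x) _ _))

  ∑-map : (g : Y → X) (ys : List Y) (f : X → ℕ) → ∑ (map g ys) f ≡ ∑ ys (f ∘ g)
  ∑-map g []       f = refl
  ∑-map g (y ∷ ys) f = cong (f (g y) +_) (∑-map g ys f)

  ∑-concatMap : (g : Y → List X) (ys : List Y) (f : X → ℕ) → ∑ (concatMap g ys) f ≡ ∑ ys (λ y → ∑ (g y) f)
  ∑-concatMap g []       f = refl
  ∑-concatMap g (y ∷ ys) f = trans (∑-++ (g y) _ f) (cong (∑ (g y) f +_) (∑-concatMap g ys f))

  ∑-filter : {p : Level} {P : X → Set p} (P? : ∀ x → Dec (P x)) (xs : List X) (f : X → ℕ) →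
             ∑ (filter P? xs) f ≡ ∑ xs (λ x → ⟦ P? x ⟧ * f x)
  ∑-filter P? []       f = refl
  ∑-filter P? (x ∷ xs) f with P? x
  ... | yes _ = cong₂ _+_ (sym (ℕₚ.+-identityʳ (f x))) (∑-filter P? xs f)
  ... | no _  = ∑-filter P? xs f

  ∑-∈ : {xs : List X} (f : X → ℕ) {x : X} → x ∈ xs → f x ≤ ∑ xs f
  ∑-∈ f (here refl) = ℕₚ.m≤m+n _ _
  ∑-∈ f (there x∈)  = ℕₚ.≤-trans (∑-∈ f x∈) (ℕₚ.m≤n+m _ _)

  ∑-∈₂ : {xs : List X} (f : X → ℕ) {x y : X} → x ≢ y → x ∈ xs → y ∈ xs → f x + f y ≤ ∑ xs f
  ∑-∈₂ f x≢y (here refl) (here refl) = contradiction refl x≢y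
  ∑-∈₂ f x≢y (here refl) (there y∈)  = ℕₚ.+-monoʳ-≤ _ (∑-∈ f y∈)
  ∑-∈₂ f {x} {y} x≢y (there x∈) (here refl) =
    ℕₚ.≤-trans (ℕₚ.≤-reflexive (ℕₚ.+-comm (f x) (f y))) (ℕₚ.+-monoʳ-≤ _ (∑-∈ f x∈))
  ∑-∈₂ f x≢y (there x∈) (there y∈)   = ℕₚ.≤-trans (∑-∈₂ f x≢y x∈ y∈) (ℕₚ.m≤n+m _ _)

  ∑-witness : {p : Level} {P : X → Set p} (P? : ∀ x → Dec (P x)) (xs : List X) →
              1 ≤ ∑ xs (λ x → ⟦ P? x ⟧) → ∃ λ x → x ∈ xs × P x
  ∑-witness P? (x ∷ xs) h with P? x
  ... | yes p = x , here refl , p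
  ... | no _  = let (y , y∈ , p) = ∑-witness P? xs h in y , there y∈ , p

  -- The indicators of `P?` and of its negation add up to the length, so a single failure would
  -- already cost one.
  ∑-full : {p : Level} {P : X → Set p} (P? : ∀ x → Dec (P x)) (xs : List X) →
           length xs ≤ ∑ xs (λ x → ⟦ P? x ⟧) → ∀ {x} → x ∈ xs → P x
  ∑-full P? xs h {x} x∈ with P? x
  ... | yes p = p
  ... | no ¬p = contradiction h (ℕₚ.<⇒≱ lt)
    where
    one : 1 ≤ ∑ xs (λ y → ⟦ ¬? (P? y) ⟧)
    one = ℕₚ.≤-trans (ℕₚ.≤-reflexive (sym (⟦⟧-yes (¬? (P? x)) ¬p))) (∑-∈ (λ y → ⟦ ¬? (P? y) ⟧) x∈)
    tot : ∑ xs (λ y → ⟦ P? y ⟧) + ∑ xs (λ y → ⟦ ¬? (P? y) ⟧) ≡ length xs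
    tot = trans (sym (∑-+ xs _ _)) (trans (∑-cong xs (λ y _ → ⟦⟧+⟦¬⟧ (P? y))) (∑-one xs))
    lt : ∑ xs (λ y → ⟦ P? y ⟧) < length xs
    lt = subst (∑ xs (λ y → ⟦ P? y ⟧) <_) tot (ℕₚ.m<m+n _ one)

  ∑-≤length : {p : Level} {P : X → Set p} (P? : ∀ x → Dec (P x)) (xs : List X) →
              ∑ xs (λ x → ⟦ P? x ⟧) ≤ length xs
  ∑-≤length P? xs = ℕₚ.≤-trans (∑-mono xs (λ x _ → ⟦⟧≤1 (P? x))) (ℕₚ.≤-reflexive (∑-one xs))

  -- Sums over vertices and over pairs of vertices.

  module _ {n : ℕ} where

    ∑ᶠ : (Fin n → ℕ) → ℕ
    ∑ᶠ = ∑ (allFin n)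

    ∈-all : (v : Fin n) → v ∈ allFin n
    ∈-all = ∈ₚ.∈-allFin

    length-all : length (allFin n) ≡ n
    length-all = Listₚ.length-tabulate id

    ∑ᶠ-mono : {f g : Fin n → ℕ} → (∀ x → f x ≤ g x) → ∑ᶠ f ≤ ∑ᶠ g
    ∑ᶠ-mono h = ∑-mono (allFin n) (λ x _ → h x)

    ∑ᶠ-cong : {f g : Fin n → ℕ} → (∀ x → f x ≡ g x) → ∑ᶠ f ≡ ∑ᶠ g
    ∑ᶠ-cong h = ∑-cong (allFin n) (λ x _ → h x)

    ∑ᶠ-one : ∑ᶠ (λ _ → 1) ≡ n
    ∑ᶠ-one = trans (∑-one (allFin n)) length-all

    -- Instead of deleting `y` from `xs`, the induction replaces `f` by `off`, which vanishes at
    -- `y`. Thus `xs` stays fixed and may contain repetitions.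
    ∑-unique-≤ : (ys xs : List (Fin n)) (f : Fin n → ℕ) → Unique ys → (∀ {y} → y ∈ ys → y ∈ xs) →
                 ∑ ys f ≤ ∑ xs f
    ∑-unique-≤ []       xs f _          _  = z≤n
    ∑-unique-≤ (y ∷ ys) xs f (y∉ ∷ uys) ⊆xs =
      subst (f y + ∑ ys f ≤_) (sym split) (ℕₚ.+-mono-≤ atY elsewhere)
      where
      on off : Fin n → ℕ
      on  x = ⟦ x Fin.≟ y ⟧ * f x
      off x = ⟦ ¬? (x Fin.≟ y) ⟧ * f x
      split : ∑ xs f ≡ ∑ xs on + ∑ xs off
      split = trans (∑-cong xs (λ x _ →
                trans (sym (ℕₚ.*-identityˡ (f x)))
                (trans (cong (_* f x) (sym (⟦⟧+⟦¬⟧ (x Fin.≟ y))))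
                       (ℕₚ.*-distribʳ-+ (f x) ⟦ x Fin.≟ y ⟧ _))))
              (∑-+ xs on off)
      atY : f y ≤ ∑ xs on
      atY = ℕₚ.≤-trans (ℕₚ.≤-reflexive (sym (trans (cong (_* f y) (⟦⟧-yes (y Fin.≟ y) refl)) (ℕₚ.*-identityˡ (f y)))))
                       (∑-∈ on (⊆xs (here refl)))
      elsewhere : ∑ ys f ≤ ∑ xs off
      elsewhere = ℕₚ.≤-trans
        (ℕₚ.≤-reflexive (∑-cong ys (λ x x∈ → sym (trans
          (cong (_* f x) (⟦⟧-yes (¬? (x Fin.≟ y)) (λ x≡y → All.lookup y∉ x∈ (sym x≡y))))
          (ℕₚ.*-identityˡ (f x))))))
        (∑-unique-≤ ys xs off uys (λ x∈ → ⊆xs (there x∈)))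

    ∑-unique-≤ᶠ : {ys : List (Fin n)} (f : Fin n → ℕ) → Unique ys → ∑ ys f ≤ ∑ᶠ f
    ∑-unique-≤ᶠ {ys} f u = ∑-unique-≤ ys (allFin n) f u (λ {y} _ → ∈-all y)

    allFin-unique : Unique (allFin n)
    allFin-unique = Uniqueₚ.allFin⁺ n

    cover-length : (xs : List (Fin n)) → (∀ v → v ∈ xs) → n ≤ length xs
    cover-length xs all∈ = subst₂ _≤_ ∑ᶠ-one (∑-one xs)
      (∑-unique-≤ (allFin n) xs (λ _ → 1) allFin-unique (λ {v} _ → all∈ v))

    ∑ᶠ-∘-≤ : (σ : Fin n → Fin n) → Injective _≡_ _≡_ σ → (f : Fin n → ℕ) → ∑ᶠ (f ∘ σ) ≤ ∑ᶠ f
    ∑ᶠ-∘-≤ σ inj f = subst (_≤ ∑ᶠ f) (∑-map σ (allFin n) f)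
      (∑-unique-≤ᶠ f (Uniqueₚ.map⁺ inj allFin-unique))

    ∑ᶠ-point : (v : Fin n) → ∑ᶠ (λ u → ⟦ u Fin.≟ v ⟧) ≡ 1
    ∑ᶠ-point v = ℕₚ.≤-antisym (atMost (allFin n) allFin-unique)
        (ℕₚ.≤-trans (ℕₚ.≤-reflexive (sym (⟦⟧-yes (v Fin.≟ v) refl))) (∑-∈ (λ u → ⟦ u Fin.≟ v ⟧) (∈-all v)))
      where
      atMost : (xs : List (Fin n)) → Unique xs → ∑ xs (λ u → ⟦ u Fin.≟ v ⟧) ≤ 1
      atMost []       _        = z≤n
      atMost (x ∷ xs) (x∉ ∷ u) with x Fin.≟ v
      ... | yes refl = s≤s (ℕₚ.≤-reflexive (∑-zero xs (λ y y∈ → ⟦⟧-no (y Fin.≟ v) (λ y≡ → All.lookup x∉ y∈ (sym y≡)))))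
      ... | no _     = atMost xs u

    ∑ᶠ-point₂ : (v : Fin n) → ∑ᶠ (λ u → ⟦ v Fin.≟ u ⟧) ≡ 1
    ∑ᶠ-point₂ v = trans (∑ᶠ-cong (λ u → ⟦⟧-cong (v Fin.≟ u) (u Fin.≟ v) sym sym)) (∑ᶠ-point v)

    ∑ᶠ-∈ : (f : Fin n → ℕ) (v : Fin n) → f v ≤ ∑ᶠ f
    ∑ᶠ-∈ f v = ∑-∈ f (∈-all v)

    ∑ᶠ-∈₂ : (f : Fin n → ℕ) {u v : Fin n} → u ≢ v → f u + f v ≤ ∑ᶠ f
    ∑ᶠ-∈₂ f {u} {v} u≢v = ∑-∈₂ f u≢v (∈-all u) (∈-all v)

    ∑∑ : (Fin n → Fin n → ℕ) → ℕ
    ∑∑ f = ∑ᶠ (λ u → ∑ᶠ (f u))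

    ∑∑-mono : {f g : Fin n → Fin n → ℕ} → (∀ u v → f u v ≤ g u v) → ∑∑ f ≤ ∑∑ g
    ∑∑-mono h = ∑ᶠ-mono (λ u → ∑ᶠ-mono (h u))

    ∑∑-cong : {f g : Fin n → Fin n → ℕ} → (∀ u v → f u v ≡ g u v) → ∑∑ f ≡ ∑∑ g
    ∑∑-cong h = ∑ᶠ-cong (λ u → ∑ᶠ-cong (h u))

    ∑∑-+ : (f g : Fin n → Fin n → ℕ) → ∑∑ (λ u v → f u v + g u v) ≡ ∑∑ f + ∑∑ g
    ∑∑-+ f g = trans (∑ᶠ-cong (λ u → ∑-+ (allFin n) (f u) (g u))) (∑-+ (allFin n) _ _)

    ∑∑-≤2 : {p : Level} {P : Fin n → Fin n → Set p} (P? : ∀ u v → Dec (P u v)) (a b : Fin n) →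
            (∀ u v → P u v → (u ≡ a × v ≡ b) ⊎ (u ≡ b × v ≡ a)) → ∑∑ (λ u v → ⟦ P? u v ⟧) ≤ 2
    ∑∑-≤2 P? a b only = ℕₚ.≤-trans (∑∑-mono point)
      (ℕₚ.≤-reflexive (trans (∑∑-+ (λ u v → ⟦ u Fin.≟ a ⟧ * ⟦ v Fin.≟ b ⟧) _) (cong₂ _+_ (single a b) (single b a))))
      where
      single : ∀ a b → ∑∑ (λ u v → ⟦ u Fin.≟ a ⟧ * ⟦ v Fin.≟ b ⟧) ≡ 1
      single a b = trans (∑ᶠ-cong (λ u → trans (∑-*ˡ (allFin n) ⟦ u Fin.≟ a ⟧ _)
        (trans (cong (⟦ u Fin.≟ a ⟧ *_) (∑ᶠ-point b)) (ℕₚ.*-identityʳ _)))) (∑ᶠ-point a)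
      hit : ∀ {u v a b} → u ≡ a → v ≡ b → 1 ≤ ⟦ u Fin.≟ a ⟧ * ⟦ v Fin.≟ b ⟧
      hit {u} {v} {a} {b} p q = ℕₚ.≤-reflexive (sym (cong₂ _*_ (⟦⟧-yes (u Fin.≟ a) p) (⟦⟧-yes (v Fin.≟ b) q)))
      point : ∀ u v → ⟦ P? u v ⟧ ≤ ⟦ u Fin.≟ a ⟧ * ⟦ v Fin.≟ b ⟧ + ⟦ u Fin.≟ b ⟧ * ⟦ v Fin.≟ a ⟧
      point u v = ⟦⟧-≤ (P? u v) λ x → case only u v x of λ
        { (inj₁ (p , q)) → ℕₚ.≤-trans (hit p q) (ℕₚ.m≤m+n _ _)
        ; (inj₂ (p , q)) → ℕₚ.≤-trans (hit p q) (ℕₚ.m≤n+m _ _) }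

    ∑-pairs : (f : Fin n → Fin n → ℕ) →
              ∑ pairs (λ p → f (proj₁ p) (proj₂ p)) ≡ ∑∑ (λ u v → ⟦ toℕ u ℕ.<? toℕ v ⟧ * f u v)
    ∑-pairs f = trans (∑-concatMap _ (allFin n) _)
      (∑ᶠ-cong (λ u → trans (∑-map _ (filter (λ v → toℕ u ℕ.<? toℕ v) (allFin n)) _) (∑-filter _ (allFin n) (f u))))

    -- The passage from the pairs `u < v` of the Wiener sum to ordered pairs, where permutations of
    -- the vertices and exchanges of summation apply.
    2*∑-pairs : (f : Fin n → Fin n → ℕ) → (∀ u v → f u v ≡ f v u) → (∀ u → f u u ≡ 0) →
                2 * ∑ pairs (λ p → f (proj₁ p) (proj₂ p)) ≡ ∑∑ f
    2*∑-pairs f fsym f0 = begin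
      2 * ∑ pairs (λ p → f (proj₁ p) (proj₂ p))
        ≡⟨ cong (2 *_) (∑-pairs f) ⟩
      2 * ∑∑ up
        ≡⟨ cong (∑∑ up +_) (ℕₚ.+-identityʳ _) ⟩
      ∑∑ up + ∑∑ up
        ≡⟨ cong (∑∑ up +_) (∑-swap (allFin n) (allFin n) up) ⟩
      ∑∑ up + ∑∑ (λ u v → up v u)
        ≡⟨ sym (∑∑-+ up (λ u v → up v u)) ⟩
      ∑∑ (λ u v → up u v + up v u)
        ≡⟨ ∑∑-cong combine ⟩
      ∑∑ f ∎
      where
      open ≡-Reasoning
      up : Fin n → Fin n → ℕ
      up u v = ⟦ toℕ u ℕ.<? toℕ v ⟧ * f u v
      combine : ∀ u v → up u v + up v u ≡ f u v
      combine u v with ℕₚ.<-cmp (toℕ u) (toℕ v)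
      ... | tri< lt _ gt = trans (cong₂ (λ i j → i * f u v + j * f v u) (⟦⟧-yes (toℕ u ℕ.<? toℕ v) lt) (⟦⟧-no (toℕ v ℕ.<? toℕ u) gt))
                                 (trans (ℕₚ.+-identityʳ _) (ℕₚ.*-identityˡ (f u v)))
      ... | tri> nlt _ gt = trans (cong₂ (λ i j → i * f u v + j * f v u) (⟦⟧-no (toℕ u ℕ.<? toℕ v) nlt) (⟦⟧-yes (toℕ v ℕ.<? toℕ u) gt))
                                  (trans (ℕₚ.*-identityˡ (f v u)) (fsym v u))
      ... | tri≈ nlt eq ngt = trans (cong₂ (λ i j → i * f u v + j * f v u) (⟦⟧-no (toℕ u ℕ.<? toℕ v) nlt) (⟦⟧-no (toℕ v ℕ.<? toℕ u) ngt))
                                    (sym (subst (λ w → f u w ≡ 0) (Finₚ.toℕ-injective eq) (f0 u)))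

    pairs-< : ∀ {u v : Fin n} → (u , v) ∈ pairs → toℕ u < toℕ v
    pairs-< {u} {v} p∈ with ∈ₚ.∈-concatMap⁻ _ {xs = allFin n} p∈
    ... | p∈′ with find p∈′
    ... | w , _ , q with ∈ₚ.∈-map⁻ _ q
    ... | x , x∈ , refl = proj₂ (∈ₚ.∈-filter⁻ (λ v → toℕ w ℕ.<? toℕ v) {xs = allFin n} x∈)

    pairs-∈ : ∀ {u v : Fin n} → toℕ u < toℕ v → (u , v) ∈ pairs
    pairs-∈ {u} {v} lt = ∈ₚ.∈-concatMap⁺ _ {xs = allFin n}
      (lose (∈-all u) (∈ₚ.∈-map⁺ (u ,_) (∈ₚ.∈-filter⁺ (λ v → toℕ u ℕ.<? toℕ v) (∈-all v) lt)))

  -- Reachability and the computed distance.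

  module _ {n : ℕ} where

    ==⇒≡ : {u v : Fin n} → (u == v) ≡ true → u ≡ v
    ==⇒≡ {u} {v} h with u Fin.≟ v
    ... | yes p = p
    ==⇒≡ () | no _

    ≡⇒== : {u v : Fin n} → u ≡ v → (u == v) ≡ true
    ≡⇒== {u} {v} h with u Fin.≟ v
    ... | yes _ = refl
    ... | no ¬p = contradiction h ¬p

  any-true⁺ : (f : X → Bool) {xs : List X} {x : X} → x ∈ xs → f x ≡ true → any f xs ≡ true
  any-true⁺ f {x ∷ xs} (here refl) fx rewrite fx = refl
  any-true⁺ f {y ∷ xs} (there x∈)  fx with f y
  ... | true  = refl
  ... | false = any-true⁺ f x∈ fx

  any-true⁻ : (f : X → Bool) (xs : List X) → any f xs ≡ true → ∃ λ x → f x ≡ true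
  any-true⁻ f (x ∷ xs) h with f x in eq
  ... | true  = x , eq
  ... | false = any-true⁻ f xs h

  ∧-true : {x y : Bool} → x ∧ y ≡ true → x ≡ true × y ≡ true
  ∧-true {true} {true} _ = refl , refl

  ∨-true : {x y : Bool} → x ∨ y ≡ true → x ≡ true ⊎ y ≡ true
  ∨-true {true}         _ = inj₁ refl
  ∨-true {false} {true} _ = inj₂ refl

  ∨-trueˡ : {x y : Bool} → x ≡ true → x ∨ y ≡ true
  ∨-trueˡ refl = refl

  ∨-trueʳ : {x y : Bool} → y ≡ true → x ∨ y ≡ true
  ∨-trueʳ {x} refl = Boolₚ.∨-zeroʳ x

  module _ {n : ℕ} (A : Adj n) where

    reach-refl : ∀ u → reach A 0 u u ≡ true
    reach-refl u = ≡⇒== refl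

    reach-suc : ∀ k {u v} → reach A k u v ≡ true → reach A (suc k) u v ≡ true
    reach-suc k h = ∨-trueˡ h

    reach-step : ∀ k {u w v} → reach A k u w ≡ true → A w v ≡ true → reach A (suc k) u v ≡ true
    reach-step k {u} {w} {v} h e =
      ∨-trueʳ {reach A k u v} (any-true⁺ (λ w → reach A k u w ∧ A w v) (∈-all w) (cong₂ _∧_ h e))

    reach-suc⁻ : ∀ k {u v} → reach A (suc k) u v ≡ true →
                 reach A k u v ≡ true ⊎ ∃ λ w → reach A k u w ≡ true × A w v ≡ true
    reach-suc⁻ k {u} {v} h with ∨-true {reach A k u v} h
    ... | inj₁ r = inj₁ r
    ... | inj₂ r = let (w , e) = any-true⁻ _ (allFin n) r in inj₂ (w , ∧-true e)

    reach-trans : ∀ j k {u v w} → reach A j u v ≡ true → reach A k v w ≡ true → reach A (k + j) u w ≡ true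
    reach-trans j zero    {u} r s = subst (λ w → reach A j u w ≡ true) (==⇒≡ s) r
    reach-trans j (suc k) r s with reach-suc⁻ k s
    ... | inj₁ s′           = reach-suc (k + j) (reach-trans j k r s′)
    ... | inj₂ (x , s′ , e) = reach-step (k + j) (reach-trans j k r s′) e

    reach-sym : (∀ u v → A u v ≡ A v u) → ∀ k {u v} → reach A k u v ≡ true → reach A k v u ≡ true
    reach-sym A-sym zero    h = ≡⇒== (sym (==⇒≡ h))
    reach-sym A-sym (suc k) {u} {v} h with reach-suc⁻ k h
    ... | inj₁ r           = reach-suc k (reach-sym A-sym k r)
    ... | inj₂ (w , r , e) = subst (λ m → reach A m v u ≡ true) (ℕₚ.+-comm k 1)
      (reach-trans 1 k (reach-step 0 (reach-refl v) (trans (A-sym v w) e)) (reach-sym A-sym k r))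

    firstTrue-≤ : ∀ f {p : ℕ → Bool} {k} → p k ≡ true → firstTrue {n} f p ≤ k
    firstTrue-≤ zero    h = z≤n
    firstTrue-≤ (suc f) {p} {k} h with p zero in eq
    ... | true = z≤n
    firstTrue-≤ (suc f) {p} {zero}  h | false = contradiction (trans (sym h) eq) λ ()
    firstTrue-≤ (suc f) {p} {suc k} h | false = s≤s (firstTrue-≤ f h)

    -- When the fuel runs out, `firstTrue` returns a default index without testing it; `k ≤ f`
    -- guarantees that this index is then the known true one.
    firstTrue-true : ∀ f {p : ℕ → Bool} {k} → k ≤ f → p k ≡ true → p (firstTrue {n} f p) ≡ true
    firstTrue-true zero    z≤n h = h
    firstTrue-true (suc f) {p} k≤ h with p zero in eq
    ... | true = eq
    firstTrue-true (suc f) {p} {zero}  k≤       h | false = contradiction (trans (sym h) eq) λ ()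
    firstTrue-true (suc f) {p} {suc k} (s≤s k≤) h | false = firstTrue-true f k≤ h

  -- The specification is kept apart from `dist` because `dist` searches only up to `n`. That this
  -- is far enough follows from `δ<n`, proved first for the search whose fuel is the walk length
  -- supplied by `Connected`.
  record IsDist {n : ℕ} (A : Adj n) (δ : Fin n → Fin n → ℕ) : Set where
    field
      reached : ∀ u v → reach A (δ u v) u v ≡ true
      minimal : ∀ k {u v} → reach A k u v ≡ true → δ u v ≤ k

    δ-refl : ∀ u → δ u u ≡ 0
    δ-refl u = ℕₚ.n≤0⇒n≡0 (minimal 0 (reach-refl A u))

    δ-zero : ∀ {u v} → δ u v ≡ 0 → u ≡ v
    δ-zero {u} {v} h = ==⇒≡ (subst (λ k → reach A k u v ≡ true) h (reached u v))

    δ-step : ∀ u {v w} → A v w ≡ true → δ u w ≤ suc (δ u v)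
    δ-step u {v} e = minimal _ (reach-step A (δ u v) (reached u v) e)

    δ-pred : ∀ {u v k} → δ u v ≡ suc k → ∃ λ w → δ u w ≡ k × A w v ≡ true
    δ-pred {u} {v} {k} h with reach-suc⁻ A k (subst (λ m → reach A m u v ≡ true) h (reached u v))
    ... | inj₁ r = contradiction (subst (_≤ k) h (minimal k r)) ℕₚ.1+n≰n
    ... | inj₂ (w , r , e) = w ,
      ℕₚ.≤-antisym (minimal k r) (ℕₚ.≤-pred (subst (_≤ suc (δ u w)) h (δ-step u e))) , e

    δ-level : ∀ {u} k d {v} → δ u v ≡ d → k ≤ d → ∃ λ w → δ u w ≡ k
    δ-level k d {v} h k≤d with ℕₚ.m≤n⇒m<n∨m≡n k≤d
    ... | inj₂ refl = v , h
    δ-level k (suc d) h k≤d | inj₁ (s≤s k≤) = let (w , hw , _) = δ-pred h in δ-level k d hw k≤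

    -- Every level from 0 to `δ u v` around `u` is occupied, and vertices on different levels are
    -- different, so `suc (δ u v)` vertices exist.
    δ<n : ∀ u v → δ u v < n
    δ<n u v = Finₚ.injective⇒≤ {f = λ i → proj₁ (at i)} λ {i} {j} eq →
        Finₚ.toℕ-injective (trans (sym (proj₂ (at i))) (trans (cong (δ u) eq) (proj₂ (at j))))
      where
      at : (i : Fin (suc (δ u v))) → ∃ λ w → δ u w ≡ toℕ i
      at i = δ-level (toℕ i) (δ u v) refl (ℕₚ.≤-pred (Finₚ.toℕ<n i))

  module _ {n : ℕ} (G : Graph n) (conn : Connected G) where

    private
      A = Graph.adj G
      δ′ : Fin n → Fin n → ℕ
      δ′ u v = firstTrue {n} (proj₁ (conn u v)) (λ k → reach A k u v)
      δ′-isDist : IsDist A δ′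
      δ′-isDist = record
        { reached = λ u v → firstTrue-true A (proj₁ (conn u v)) {λ k → reach A k u v} ℕₚ.≤-refl (proj₂ (conn u v))
        ; minimal = λ k {u} {v} → firstTrue-≤ A (proj₁ (conn u v)) }

    dist-isDist : IsDist A (dist G)
    dist-isDist = record
      { reached = λ u v → firstTrue-true A n {λ k → reach A k u v} (ℕₚ.<⇒≤ (IsDist.δ<n δ′-isDist u v)) (IsDist.reached δ′-isDist u v)
      ; minimal = λ k → firstTrue-≤ A n }

  -- The metric of a connected graph, and ancestors along shortest paths.

  module Metric {n : ℕ} (G : Graph n) (δ : Fin n → Fin n → ℕ) (isDist : IsDist (Graph.adj G) δ) where

    open Graph G public
    open IsDist isDist public

    infix 4 _~_
    _~_ : Fin n → Fin n → Set
    u ~ v = adj u v ≡ true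

    ~-sym : ∀ {u v} → u ~ v → v ~ u
    ~-sym {u} {v} e = trans (symm v u) e

    ~⇒≢ : ∀ {u v} → u ~ v → u ≢ v
    ~⇒≢ {u} e refl = case trans (sym e) (irrefl u) of λ ()

    δ-sym : ∀ u v → δ u v ≡ δ v u
    δ-sym u v = ℕₚ.≤-antisym (half u v) (half v u)
      where
      half : ∀ u v → δ u v ≤ δ v u
      half u v = minimal (δ v u) (reach-sym adj symm (δ v u) (reached v u))

    δ-triangle : ∀ u v w → δ u w ≤ δ u v + δ v w
    δ-triangle u v w = subst (δ u w ≤_) (ℕₚ.+-comm (δ v w) (δ u v))
      (minimal _ (reach-trans adj (δ u v) (δ v w) (reached u v) (reached v w)))

    ~⇒δ≡1 : ∀ {u v} → u ~ v → δ u v ≡ 1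
    ~⇒δ≡1 {u} {v} e = ℕₚ.≤-antisym (subst (λ k → δ u v ≤ suc k) (δ-refl u) (δ-step u e))
      (ℕₚ.n≢0⇒n>0 (λ z → ~⇒≢ e (δ-zero z)))

    δ≡1⇒~ : ∀ {u v} → δ u v ≡ 1 → u ~ v
    δ≡1⇒~ {u} {v} h = let (w , z , e) = δ-pred h in subst (_~ v) (sym (δ-zero z)) e

    δ-pos : ∀ {u v} → u ≢ v → 1 ≤ δ u v
    δ-pos u≢v = ℕₚ.n≢0⇒n>0 (λ z → u≢v (δ-zero z))

    Lipschitz : (Fin n → ℕ) → Set
    Lipschitz f = ∀ {u v} → u ~ v → f v ≤ suc (f u)

    δ-lipschitz : ∀ u → Lipschitz (δ u)
    δ-lipschitz u e = δ-step u e

    lipschitz-δ : ∀ {f} → Lipschitz f → ∀ u v → f v ≤ f u + δ u v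
    lipschitz-δ {f} lip u v = go (δ u v) v refl
      where
      go : ∀ k v → δ u v ≡ k → f v ≤ f u + k
      go zero    v h = ℕₚ.≤-reflexive (trans (cong f (sym (δ-zero h))) (sym (ℕₚ.+-identityʳ _)))
      go (suc k) v h = let (w , hw , e) = δ-pred h in
        ℕₚ.≤-trans (lip e) (ℕₚ.≤-trans (s≤s (go k w hw)) (ℕₚ.≤-reflexive (sym (ℕₚ.+-suc (f u) k))))

    private
      parentOf : ∀ r v d → δ r v ≡ d → ∃ λ w → δ r w ≡ pred d × (1 ≤ d → w ~ v)
      parentOf r v zero    h = v , h , λ ()
      parentOf r v (suc d) h = let (w , hw , e) = δ-pred h in w , hw , λ _ → e

    -- The root is its own parent.
    parent : Fin n → Fin n → Fin n
    parent r v = proj₁ (parentOf r v (δ r v) refl)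

    parent-δ : ∀ r v → δ r (parent r v) ≡ pred (δ r v)
    parent-δ r v = proj₁ (proj₂ (parentOf r v (δ r v) refl))

    parent-~ : ∀ r v → 1 ≤ δ r v → parent r v ~ v
    parent-~ r v = proj₂ (proj₂ (parentOf r v (δ r v) refl))

    ancestor : Fin n → ℕ → Fin n → Fin n
    ancestor r zero    v = v
    ancestor r (suc k) v = parent r (ancestor r k v)

    ancestor-δ : ∀ r k v → δ r (ancestor r k v) ≡ δ r v ∸ k
    ancestor-δ r zero    v = refl
    ancestor-δ r (suc k) v = trans (parent-δ r (ancestor r k v))
      (trans (cong pred (ancestor-δ r k v)) (ℕₚ.pred[m∸n]≡m∸[1+n] (δ r v) k))

    ancestor-~ : ∀ r k v → k < δ r v → ancestor r (suc k) v ~ ancestor r k v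
    ancestor-~ r k v k< = parent-~ r (ancestor r k v)
      (subst (1 ≤_) (sym (ancestor-δ r k v)) (ℕₚ.m<n⇒0<n∸m k<))

  -- tri t m is the number of pairs at distance at most t on a path with m vertices.
  tri : ℕ → ℕ → ℕ
  tri t zero    = 0
  tri t (suc m) = tri t m + t ⊓ m

  -- Connected enumerations and the count of close pairs.

  module ConnectedOrders {n : ℕ} (G : Graph n) (δ : Fin n → Fin n → ℕ) (isDist : IsDist (Graph.adj G) δ) where

    open Metric G δ isDist
    open import Data.List.Membership.DecPropositional (Fin._≟_ {n}) using (_∈?_)

    -- Every tail of such a list induces a connected subgraph.
    data Order : List (Fin n) → Set where
      [_]  : ∀ v → Order (v ∷ [])
      cons : ∀ {v p xs} → v ∉ xs → p ∈ xs → v ~ p → Order xs → Order (v ∷ xs)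

    data Cyclic : List (Fin n) → Set where
      here  : ∀ {v p q xs} → v ∉ xs → p ∈ xs → q ∈ xs → p ≢ q → v ~ p → v ~ q → Order xs → Cyclic (v ∷ xs)
      there : ∀ {v p xs} → v ∉ xs → p ∈ xs → v ~ p → Order xs → Cyclic xs → Cyclic (v ∷ xs)

    Order-unique : ∀ {xs} → Order xs → Unique xs
    Order-unique [ v ]                = [] ∷ []
    Order-unique (cons v∉ p∈ v~p ord) =
      All.tabulate (λ x∈ v≡x → v∉ (subst (_∈ _) (sym v≡x) x∈)) ∷ Order-unique ord

    -- On the way back from `w` to `r` along a shortest path, some edge enters `xs`.
    boundary : ∀ {xs r} → r ∈ xs → ∀ k {w} → δ r w ≡ k → w ∉ xs → ∃ λ u → ∃ λ p → u ∉ xs × p ∈ xs × u ~ p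
    boundary {xs} r∈ zero    h w∉ = contradiction (subst (_∈ xs) (δ-zero h) r∈) w∉
    boundary {xs} r∈ (suc k) {w} h w∉ with δ-pred h
    ... | p , hp , e with p ∈? xs
    ... | yes p∈ = w , p , w∉ , p∈ , ~-sym e
    ... | no p∉  = boundary r∈ k hp p∉

    Order-head : ∀ {xs} → Order xs → ∃ λ r → r ∈ xs
    Order-head [ v ]          = v , here refl
    Order-head (cons _ _ _ _) = _ , here refl

    Order-extend : ∀ {xs} → Order xs → length xs < n → ∃ λ v → Order (v ∷ xs)
    Order-extend {xs} ord l<n with Finₚ.any? (λ v → ¬? (v ∈? xs))
    ... | yes (w , w∉) = let (r , r∈) = Order-head ord
                             (u , p , u∉ , p∈ , e) = boundary r∈ _ refl w∉
                         in u , cons u∉ p∈ e ord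
    ... | no ¬∃ = contradiction l<n (ℕₚ.≤⇒≯ (cover-length xs λ v → decidable-stable (v ∈? xs) (λ v∉ → ¬∃ (v , v∉))))

    Order-full : Fin n → ∃ λ xs → Order xs × length xs ≡ n
    Order-full r = let (xs , ord , len) = go (n ∸ 1) (ℕₚ.≤-reflexive eq) in xs , ord , trans len eq
      where
      eq : suc (n ∸ 1) ≡ n
      eq = ℕₚ.suc-pred n {{Finₚ.nonZeroIndex r}}
      go : ∀ k → suc k ≤ n → ∃ λ xs → Order xs × length xs ≡ suc k
      go zero    _ = (r ∷ []) , [ r ] , refl
      go (suc k) k< with go k (ℕₚ.≤-trans (ℕₚ.n≤1+n _) k<)
      ... | xs , ord , len = let (v , ord′) = Order-extend ord (subst (_< n) (sym len) k<) in
        v ∷ xs , ord′ , cong suc len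

    -- Discrete intermediate values on a connected set. If an end point is the newest vertex, it is
    -- replaced by the neighbour through which that vertex was attached: the value moves by at most
    -- one, so it cannot jump over `k`.
    ivt : ∀ {xs} → Order xs → ∀ {f} → Lipschitz f → ∀ {x y k} → x ∈ xs → y ∈ xs → f x ≤ k → k ≤ f y →
          ∃ λ z → z ∈ xs × f z ≡ k
    ivt [ v ] lip (here refl) (here refl) lo hi = v , here refl , ℕₚ.≤-antisym lo hi
    ivt (cons v∉ p∈ e ord) lip (here refl) (here refl) lo hi = _ , here refl , ℕₚ.≤-antisym lo hi
    ivt (cons v∉ p∈ e ord) lip (there x∈)  (there y∈)  lo hi =
      let (z , z∈ , h) = ivt ord lip x∈ y∈ lo hi in z , there z∈ , h
    ivt (cons v∉ p∈ e ord) lip (here refl) (there y∈) lo hi with ℕₚ.m≤n⇒m<n∨m≡n lo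
    ... | inj₂ eq = _ , here refl , eq
    ... | inj₁ lt = let (z , z∈ , h) = ivt ord lip p∈ y∈ (ℕₚ.≤-trans (lip e) lt) hi in z , there z∈ , h
    ivt (cons v∉ p∈ e ord) lip (there x∈) (here refl) lo hi with ℕₚ.m≤n⇒m<n∨m≡n hi
    ... | inj₂ eq = _ , here refl , sym eq
    ... | inj₁ lt = let (z , z∈ , h) = ivt ord lip x∈ p∈ lo (ℕₚ.≤-pred (ℕₚ.≤-trans lt (lip (~-sym e)))) in
      z , there z∈ , h

    lipschitz-cases : ∀ {f} → Lipschitz f → ∀ {u v} → u ~ v → f u ≡ f v ⊎ f u ≡ suc (f v) ⊎ f v ≡ suc (f u)
    lipschitz-cases {f} lip {u} {v} e with ℕₚ.<-cmp (f u) (f v)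
    ... | tri≈ _ eq _ = inj₁ eq
    ... | tri< lt _ _ = inj₂ (inj₂ (ℕₚ.≤-antisym (lip e) lt))
    ... | tri> _ _ gt = inj₂ (inj₁ (ℕₚ.≤-antisym (lip (~-sym e)) gt))

    Duplicate : (Fin n → ℕ) → List (Fin n) → Set
    Duplicate f xs = ∃ λ x → ∃ λ y → x ≢ y × x ∈ xs × y ∈ xs × f x ≡ f y

    -- A vertex with neighbours one level below and one level above is bypassed by the earlier, connected vertices.
    Cyclic-duplicate : ∀ {xs} → Cyclic xs → ∀ {f} → Lipschitz f → Duplicate f xs
    Cyclic-duplicate (there _ _ _ _ cyc) lip =
      let (x , y , x≢y , x∈ , y∈ , eq) = Cyclic-duplicate cyc lip in x , y , x≢y , there x∈ , there y∈ , eq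
    Cyclic-duplicate (here {v} {p} {q} {xs} v∉ p∈ q∈ p≢q ep eq ord) {f} lip
      with lipschitz-cases lip ep | lipschitz-cases lip eq
    ... | inj₁ h | _ = v , p , ~⇒≢ ep , here refl , there p∈ , h
    ... | inj₂ _ | inj₁ h = v , q , ~⇒≢ eq , here refl , there q∈ , h
    ... | inj₂ (inj₁ h) | inj₂ (inj₁ h′) =
      p , q , p≢q , there p∈ , there q∈ , ℕₚ.suc-injective (trans (sym h) h′)
    ... | inj₂ (inj₂ h) | inj₂ (inj₂ h′) = p , q , p≢q , there p∈ , there q∈ , trans h (sym h′)
    ... | inj₂ (inj₁ h) | inj₂ (inj₂ h′) =
      let (z , z∈ , hz) = ivt ord lip {k = f v} p∈ q∈ (ℕₚ.≤-trans (ℕₚ.n≤1+n _) (ℕₚ.≤-reflexive (sym h)))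
                                      (ℕₚ.≤-trans (ℕₚ.n≤1+n _) (ℕₚ.≤-reflexive (sym h′)))
      in v , z , (λ v≡z → v∉ (subst (_∈ xs) (sym v≡z) z∈)) , here refl , there z∈ , sym hz
    ... | inj₂ (inj₂ h) | inj₂ (inj₁ h′) =
      let (z , z∈ , hz) = ivt ord lip {k = f v} q∈ p∈ (ℕₚ.≤-trans (ℕₚ.n≤1+n _) (ℕₚ.≤-reflexive (sym h′)))
                                      (ℕₚ.≤-trans (ℕₚ.n≤1+n _) (ℕₚ.≤-reflexive (sym h)))
      in v , z , (λ v≡z → v∉ (subst (_∈ xs) (sym v≡z) z∈)) , here refl , there z∈ , sym hz

    within : ℕ → Fin n → List (Fin n) → ℕ
    within t v xs = ∑ xs (λ x → ⟦ δ v x ℕ.≤? t ⟧)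

    exactly : ℕ → Fin n → List (Fin n) → ℕ
    exactly t v xs = ∑ xs (λ x → ⟦ δ v x ℕ.≟ t ⟧)

    within-suc : ∀ s v xs → within (suc s) v xs ≡ within s v xs + exactly (suc s) v xs
    within-suc s v xs = trans (∑-cong xs (λ x _ → ≤-suc-split (δ v x) s)) (∑-+ xs _ _)

    exactly-∈ : ∀ {t v xs x} → x ∈ xs → δ v x ≡ t → 1 ≤ exactly t v xs
    exactly-∈ {t} {v} {xs} {x} x∈ h =
      ℕₚ.≤-trans (ℕₚ.≤-reflexive (sym (⟦⟧-yes (δ v x ℕ.≟ t) h))) (∑-∈ (λ x → ⟦ δ v x ℕ.≟ t ⟧) x∈)

    exactly-∈₂ : ∀ {t v xs x y} → x ≢ y → x ∈ xs → y ∈ xs → δ v x ≡ t → δ v y ≡ t → 2 ≤ exactly t v xs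
    exactly-∈₂ {t} {v} {xs} {x} {y} x≢y x∈ y∈ hx hy = ℕₚ.≤-trans
      (ℕₚ.≤-reflexive (sym (cong₂ _+_ (⟦⟧-yes (δ v x ℕ.≟ t) hx) (⟦⟧-yes (δ v y ℕ.≟ t) hy))))
      (∑-∈₂ (λ x → ⟦ δ v x ℕ.≟ t ⟧) x≢y x∈ y∈)

    module _ {v p : Fin n} {xs : List (Fin n)} (ord : Order xs) (p∈ : p ∈ xs) (e : v ~ p) where

      level-occupied : ∀ {s t x} → x ∈ xs → t ≤ δ v x → s < t → 1 ≤ exactly (suc s) v xs
      level-occupied {s} x∈ t≤ s<t =
        let (z , z∈ , h) = ivt ord (δ-lipschitz v) {k = suc s} p∈ x∈
                               (subst (_≤ suc s) (sym (~⇒δ≡1 e)) (s≤s z≤n)) (ℕₚ.≤-trans s<t t≤)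
        in exactly-∈ z∈ h

      -- A vertex at distance at least `t` forces all levels up to `t` to be occupied, so each of
      -- the `k` levels after `s` adds at least one to an initial bound `a`. Every later estimate
      -- chooses only `s` and `a`.
      within-grows : ∀ {t x} → x ∈ xs → t ≤ δ v x → ∀ a {s} k → k + s ≡ t → a ≤ within s v xs → k + a ≤ within t v xs
      within-grows x∈ t≤ a         zero    refl h = h
      within-grows {t} x∈ t≤ a {s} (suc k) eq h = subst (_≤ within t v xs) (ℕₚ.+-suc k a)
        (within-grows x∈ t≤ (suc a) k (trans (ℕₚ.+-suc k s) eq) (subst (suc a ≤_) (sym (within-suc s v xs))
          (ℕₚ.≤-trans (ℕₚ.≤-reflexive (ℕₚ.+-comm 1 a))
            (ℕₚ.+-mono-≤ h (level-occupied x∈ t≤ (subst (suc s ≤_) eq (s≤s (ℕₚ.m≤n+m s k))))))))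

      within-all : ∀ {t} → (∀ x → x ∈ xs → δ v x ≤ t) → within t v xs ≡ length xs
      within-all {t} h = trans (∑-cong xs (λ x x∈ → ⟦⟧-yes (δ v x ℕ.≤? t) (h x x∈))) (∑-one xs)

      within-dichotomy : ∀ t → within t v xs ≡ length xs ⊎ ∃ λ x → x ∈ xs × t < δ v x
      within-dichotomy t with All.all? (λ x → δ v x ℕ.≤? t) xs
      ... | yes all≤ = inj₁ (within-all (λ x x∈ → All.lookup all≤ x∈))
      ... | no ¬all  = let (x , x∈ , h) = find (¬All⇒Any¬ (λ x → δ v x ℕ.≤? t) xs ¬all) in
                       inj₂ (x , x∈ , ℕₚ.≰⇒> h)

      -- Either all of `xs` lies within `t`, or a farther vertex makes the levels 1 to `t`
      -- contribute one each.
      within-≥ : ∀ t → t ⊓ length xs ≤ within t v xs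
      within-≥ t with within-dichotomy t
      ... | inj₁ eq = ℕₚ.≤-trans (ℕₚ.m⊓n≤n t _) (ℕₚ.≤-reflexive (sym eq))
      ... | inj₂ (x , x∈ , lt) = ℕₚ.≤-trans (ℕₚ.m⊓n≤m t _)
        (subst (_≤ within t v xs) (ℕₚ.+-identityʳ t) (within-grows x∈ (ℕₚ.<⇒≤ lt) 0 t (ℕₚ.+-identityʳ t) z≤n))

      -- Both `p` and `q` are on level 1, so the growth can start there with two instead of one.
      within-≥-two : ∀ {q} → q ∈ xs → p ≢ q → v ~ q → ∀ t → 1 ≤ t → suc t ≤ length xs → suc t ≤ within t v xs
      within-≥-two q∈ p≢q e′ (suc t) _ t< with within-dichotomy (suc t)
      ... | inj₁ eq = subst (suc (suc t) ≤_) (sym eq) t<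
      ... | inj₂ (x , x∈ , lt) = subst (_≤ within (suc t) v xs) (ℕₚ.+-comm t 2)
        (within-grows x∈ (ℕₚ.<⇒≤ lt) 2 {1} t (ℕₚ.+-comm t 1)
          (subst (2 ≤_) (sym (within-suc 0 v xs)) (ℕₚ.≤-trans (exactly-∈₂ p≢q p∈ q∈ (~⇒δ≡1 e) (~⇒δ≡1 e′)) (ℕₚ.m≤n+m _ _))))

      within-0 : v ∉ xs → ∀ {x} → x ∈ xs → 1 ≤ δ v x
      within-0 v∉ x∈ = δ-pos λ v≡x → v∉ (subst (_∈ xs) (sym v≡x) x∈)

      -- Otherwise the |xs| levels 1, …, |xs| are all occupied, one of them twice.
      within-cyclic : v ∉ xs → Cyclic xs → ∀ t → length xs ≡ suc t → within t v xs ≡ length xs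
      within-cyclic v∉ cyc t len with within-dichotomy t
      ... | inj₁ eq = eq
      ... | inj₂ (x , x∈ , t<) = ⊥-elim (clash (Cyclic-duplicate cyc (δ-lipschitz v)))
        where
        L = suc t
        within-≤ : ∀ s → within s v xs ≤ L
        within-≤ s = subst (within s v xs ≤_) len (∑-≤length (λ x → δ v x ℕ.≤? s) xs)
        filled : L ≤ within L v xs
        filled = subst (_≤ within L v xs) (ℕₚ.+-identityʳ L) (within-grows x∈ t< 0 L (ℕₚ.+-identityʳ L) z≤n)
        clash : ¬ Duplicate (δ v) xs
        clash (y , z , y≢z , y∈ , z∈ , eq) with δ v z in hz
        ... | zero = contradiction (subst (1 ≤_) hz (within-0 v∉ z∈)) λ ()
        ... | suc k with k ℕ.<? L
        -- By `filled`, all of `xs` lies within `L`, so the repeated level `suc k` is one of the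
        -- levels up to `L`.
        ... | no k≮L = contradiction (subst (_≤ L) hz (∑-full (λ x → δ v x ℕ.≤? L) xs (subst (_≤ within L v xs) (sym len) filled) z∈)) k≮L
        ... | yes k<L = contradiction (within-≤ L) (ℕₚ.<⇒≱ (ℕₚ.≤-trans (ℕₚ.≤-reflexive count) (within-grows x∈ t< (k + 2) (L ∸ suc k) (ℕₚ.m∸n+n≡m k<L) upto)))
          where
          upto : k + 2 ≤ within (suc k) v xs
          upto = subst (k + 2 ≤_) (sym (within-suc k v xs))
            (ℕₚ.+-mono-≤ (subst (_≤ within k v xs) (ℕₚ.+-identityʳ k)
                            (within-grows x∈ (ℕₚ.≤-trans (ℕₚ.<⇒≤ k<L) t<) 0 k (ℕₚ.+-identityʳ k) z≤n))
                         (exactly-∈₂ y≢z y∈ z∈ eq hz))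
          count : suc L ≡ (L ∸ suc k) + (k + 2)
          count = trans (cong suc (sym (ℕₚ.m∸n+n≡m k<L)))
            (trans (sym (ℕₚ.+-suc (L ∸ suc k) (suc k))) (cong (L ∸ suc k +_) (ℕₚ.+-comm 2 k)))

    -- Counts each unordered pair of the list once, at the vertex that was added later.
    tails : ℕ → List (Fin n) → ℕ
    tails t []       = 0
    tails t (v ∷ xs) = tails t xs + within t v xs

    tails-≥ : ∀ {xs} → Order xs → ∀ t → tri t (length xs) ≤ tails t xs
    tails-≥ [ v ] t = ℕₚ.≤-reflexive (ℕₚ.⊓-zeroʳ t)
    tails-≥ (cons _ p∈ e ord) t = ℕₚ.+-mono-≤ (tails-≥ ord t) (within-≥ ord p∈ e t)

    private
      combine : ∀ {a b c d} → a ≤ b → suc c ≤ d → a + c < b + d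
      combine {a} {b} {c} {d} p q = subst (_≤ b + d) (ℕₚ.+-suc a c) (ℕₚ.+-mono-≤ p q)

    -- On the descent to the last cycle vertex, `2 + t ≤ length xs` is lost exactly when the tail
    -- has `suc t` vertices. The gain is then taken at the vertex in front of that tail, by
    -- `within-cyclic`, and not by recursion.
    tails-cyclic : ∀ {xs} → Cyclic xs → ∀ t → 1 ≤ t → 2 + t ≤ length xs → tri t (length xs) < tails t xs
    tails-cyclic (here {xs = xs} _ p∈ q∈ p≢q ep eq ord) t 1≤t (s≤s t<) =
      combine (tails-≥ ord t) (subst (λ m → suc m ≤ within t _ xs) (sym (ℕₚ.m≤n⇒m⊓n≡m (ℕₚ.<⇒≤ t<)))
        (within-≥-two ord p∈ ep q∈ p≢q eq t 1≤t t<))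
    tails-cyclic (there {xs = xs} v∉ p∈ e ord cyc) t 1≤t (s≤s t<) with ℕₚ.m≤n⇒m<n∨m≡n t<
    ... | inj₁ lt = ℕₚ.+-mono-≤ (tails-cyclic cyc t 1≤t lt) (within-≥ ord p∈ e t)
    ... | inj₂ len = combine (tails-≥ ord t)
      (subst (λ m → suc m ≤ within t _ xs) (sym (ℕₚ.m≤n⇒m⊓n≡m (ℕₚ.<⇒≤ t<)))
        (ℕₚ.≤-reflexive (trans len (sym (within-cyclic ord p∈ e v∉ cyc t (sym len))))))

    close : ℕ → Fin n → Fin n → ℕ
    close t u v = ⟦ ¬? (u Fin.≟ v) ×-dec δ u v ℕ.≤? t ⟧

    close-sym : ∀ t u v → close t u v ≡ close t v u
    close-sym t u v = ⟦⟧-cong (¬? (u Fin.≟ v) ×-dec δ u v ℕ.≤? t) (¬? (v Fin.≟ u) ×-dec δ v u ℕ.≤? t) (flip u v) (flip v u)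
      where
      flip : ∀ u v → u ≢ v × δ u v ≤ t → v ≢ u × δ v u ≤ t
      flip u v (u≢v , h) = (λ eq → u≢v (sym eq)) , subst (_≤ t) (δ-sym u v) h

    close-diag : ∀ t u → close t u u ≡ 0
    close-diag t u = ⟦⟧-no (¬? (u Fin.≟ u) ×-dec δ u u ℕ.≤? t) (λ (u≢u , _) → u≢u refl)

    2*tails : ∀ t {xs} → Unique xs → 2 * tails t xs ≡ ∑ xs (λ u → ∑ xs (close t u))
    2*tails t {[]}     _        = refl
    2*tails t {v ∷ xs} (v∉ ∷ u) = begin
      2 * (tails t xs + within t v xs)
        ≡⟨ ℕₚ.*-distribˡ-+ 2 (tails t xs) _ ⟩
      2 * tails t xs + 2 * within t v xs
        ≡⟨ cong₂ (λ a b → a + 2 * b) (2*tails t u) row ⟩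
      ∑ xs (λ u → ∑ xs (close t u)) + 2 * ∑ xs (close t v)
        ≡⟨ rearrange _ (∑ xs (close t v)) ⟩
      (0 + ∑ xs (close t v)) + (∑ xs (close t v) + ∑ xs (λ u → ∑ xs (close t u)))
        ≡⟨ cong₂ _+_ (cong (_+ ∑ xs (close t v)) (sym (close-diag t v)))
             (trans (cong (_+ ∑ xs (λ u → ∑ xs (close t u))) (∑-cong xs (λ x _ → close-sym t v x)))
                    (sym (∑-+ xs (λ u → close t u v) (λ u → ∑ xs (close t u))))) ⟩
      ∑ (v ∷ xs) (λ u → ∑ (v ∷ xs) (close t u)) ∎
      where
      open ≡-Reasoning
      rearrange : ∀ a b → a + 2 * b ≡ (0 + b) + (b + a)
      rearrange = solve 2 (λ a b → a :+ con 2 :* b := (con 0 :+ b) :+ (b :+ a)) refl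
        where open +-*-Solver
      row : within t v xs ≡ ∑ xs (close t v)
      row = ∑-cong xs (λ x x∈ → ⟦⟧-cong (δ v x ℕ.≤? t) (¬? (v Fin.≟ x) ×-dec δ v x ℕ.≤? t)
        (λ h → All.lookup v∉ x∈ , h) proj₂)

    2*tails-≤ : ∀ t {xs} → Unique xs → 2 * tails t xs ≤ ∑∑ (close t)
    2*tails-≤ t {xs} u = subst (_≤ ∑∑ (close t)) (sym (2*tails t u)) (ℕₚ.≤-trans
      (∑-mono xs (λ x _ → ∑-unique-≤ᶠ (close t x) u)) (∑-unique-≤ᶠ _ u))

  -- Cycles as edge relations, and their trace in an enumeration.

  module _ {p : Level} {P : Set p} where

    does-true⁻ : (d : Dec P) → does d ≡ true → P
    does-true⁻ (yes p) _ = p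

    does-true⁺ : (d : Dec P) → P → does d ≡ true
    does-true⁺ (yes _) _ = refl
    does-true⁺ (no ¬p) p = contradiction p ¬p

  true-≡ : {x y : Bool} → (x ≡ true → y ≡ true) → (y ≡ true → x ≡ true) → x ≡ y
  true-≡ {true}          f g = sym (f refl)
  true-≡ {false} {false} f g = refl
  true-≡ {false} {true}  f g = g refl

  module _ {n : ℕ} where

    degIn-∑ : (S : Adj n) (v : Fin n) → degIn S v ≡ ∑ᶠ (λ w → ⟦ S v w Boolₚ.≟ true ⟧)
    degIn-∑ S v = trans (sym (∑-one (filter (λ w → S v w Boolₚ.≟ true) (allFin n))))
      (trans (∑-filter (λ w → S v w Boolₚ.≟ true) (allFin n) (λ _ → 1)) (∑ᶠ-cong (λ w → ℕₚ.*-identityʳ ⟦ S v w Boolₚ.≟ true ⟧)))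

    degIn-pos : (S : Adj n) {v w : Fin n} → S v w ≡ true → 0 < degIn S v
    degIn-pos S {v} {w} e = subst (0 <_) (sym (degIn-∑ S v))
      (ℕₚ.≤-trans (ℕₚ.≤-reflexive (sym (⟦⟧-yes (S v w Boolₚ.≟ true) e))) (∑ᶠ-∈ (λ w → ⟦ S v w Boolₚ.≟ true ⟧) w))

    degIn-zero : (S : Adj n) {v : Fin n} → (∀ w → S v w ≢ true) → degIn S v ≡ 0
    degIn-zero S {v} h = trans (degIn-∑ S v) (∑-zero (allFin n) (λ w _ → ⟦⟧-no (S v w Boolₚ.≟ true) (h w)))

    ∑ᶠ-two : {p : Level} {P : Fin n → Set p} (P? : ∀ w → Dec (P w)) → 2 ≤ ∑ᶠ (λ w → ⟦ P? w ⟧) →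
             ∃ λ x → ∃ λ y → x ≢ y × P x × P y
    ∑ᶠ-two P? h with ∑-witness P? (allFin n) (ℕₚ.≤-trans (s≤s z≤n) h)
    ... | x , _ , px with Finₚ.any? (λ y → ¬? (x Fin.≟ y) ×-dec P? y)
    ... | yes (y , x≢y , py) = x , y , x≢y , px , py
    ... | no ¬∃ = contradiction (subst (2 ≤_) (∑ᶠ-point x) (ℕₚ.≤-trans h (∑ᶠ-mono (λ w → ⟦⟧-mono (P? w) (w Fin.≟ x)
                    (λ pw → decidable-stable (w Fin.≟ x) (λ w≢x → ¬∃ (w , (λ eq → w≢x (sym eq)) , pw)))))))
                    (ℕₚ.<⇒≱ (s≤s (s≤s z≤n)))

    degIn-two : (S : Adj n) {v p q : Fin n} → p ≢ q → (∀ w → S v w ≡ true → w ≡ p ⊎ w ≡ q) →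
                S v p ≡ true → S v q ≡ true → degIn S v ≡ 2
    degIn-two S {v} {p} {q} p≢q only sp sq = trans (degIn-∑ S v) (ℕₚ.≤-antisym
      (ℕₚ.≤-trans (∑ᶠ-mono upper) (ℕₚ.≤-reflexive (trans (∑-+ (allFin n) _ _) (cong₂ _+_ (∑ᶠ-point p) (∑ᶠ-point q)))))
      (ℕₚ.≤-trans (ℕₚ.≤-reflexive (sym (cong₂ _+_ (⟦⟧-yes (S v p Boolₚ.≟ true) sp) (⟦⟧-yes (S v q Boolₚ.≟ true) sq))))
        (∑ᶠ-∈₂ (λ w → ⟦ S v w Boolₚ.≟ true ⟧) p≢q)))
      where
      upper : ∀ w → ⟦ S v w Boolₚ.≟ true ⟧ ≤ ⟦ w Fin.≟ p ⟧ + ⟦ w Fin.≟ q ⟧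
      upper w = ⟦⟧-≤ (S v w Boolₚ.≟ true) λ e → case only w e of λ
        { (inj₁ eq) → ℕₚ.≤-trans (ℕₚ.≤-reflexive (sym (⟦⟧-yes (w Fin.≟ p) eq))) (ℕₚ.m≤m+n _ _)
        ; (inj₂ eq) → ℕₚ.≤-trans (ℕₚ.≤-reflexive (sym (⟦⟧-yes (w Fin.≟ q) eq))) (ℕₚ.m≤n+m _ _) }

  module CycleNeighbours {n : ℕ} (G : Graph n) (S : Adj n) (isCycle : IsCycle G S) where

    cycle-sym : ∀ {u v} → S u v ≡ true → S v u ≡ true
    cycle-sym {u} {v} e = trans (proj₁ isCycle v u) e

    cycle-adj : ∀ {u v} → S u v ≡ true → Graph.adj G u v ≡ true
    cycle-adj {u} {v} = proj₁ (proj₂ isCycle) u v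

    cycle-edge : ∃ λ u → ∃ λ v → S u v ≡ true
    cycle-edge = proj₁ (proj₂ (proj₂ isCycle))

    cycle-neighbours : ∀ {u v} → S u v ≡ true → ∃ λ p → ∃ λ q → p ≢ q × S u p ≡ true × S u q ≡ true
    cycle-neighbours {u} e with proj₁ (proj₂ (proj₂ (proj₂ isCycle))) u
    ... | inj₁ z = contradiction (subst (0 <_) z (degIn-pos S e)) λ ()
    ... | inj₂ t = ∑ᶠ-two (λ w → S u w Boolₚ.≟ true) (ℕₚ.≤-reflexive (trans (sym t) (degIn-∑ S u)))

  module CycleOrder {n : ℕ} (G : Graph n) (δ : Fin n → Fin n → ℕ) (isDist : IsDist (Graph.adj G) δ)
                    (S : Adj n) (isCycle : IsCycle G S) where

    open Metric G δ isDist
    open ConnectedOrders G δ isDist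
    open CycleNeighbours G S isCycle

    -- The last cycle vertex in the order is attached to both of its neighbours on the cycle.
    Order-cyclic : ∀ {xs} → Order xs → (∀ {u v} → S u v ≡ true → u ∈ xs) → Cyclic xs
    Order-cyclic [ r ] supp with cycle-edge
    ... | u , v , e with supp e | supp (cycle-sym e)
    ... | here refl | here refl = contradiction refl (~⇒≢ (cycle-adj e))
    Order-cyclic (cons {v} {xs = xs} v∉ p∈ e ord) supp with Finₚ.any? (λ w → S v w Boolₚ.≟ true)
    ... | yes (w , s) = let (x , y , x≢y , sx , sy) = cycle-neighbours s in
      here v∉ (earlier sx) (earlier sy) x≢y (cycle-adj sx) (cycle-adj sy) ord
      where
      earlier : ∀ {x} → S v x ≡ true → x ∈ xs
      earlier s with supp (cycle-sym s)
      ... | here refl = contradiction refl (~⇒≢ (cycle-adj s))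
      ... | there x∈  = x∈
    ... | no ¬∃ = there v∉ p∈ e ord (Order-cyclic ord λ {u} {w} s → case supp s of λ
      { (here refl) → contradiction (w , s) ¬∃
      ; (there u∈)  → u∈ })

    -- An order through all `n` vertices contains every vertex of the cycle, hence is `Cyclic`.
    close-≥ : ∀ t → 1 ≤ t → 2 + t ≤ n → 2 * suc (tri t n) ≤ ∑∑ (close t)
    close-≥ t 1≤t t< with Order-full (proj₁ cycle-edge)
    ... | xs , ord , len = ℕₚ.≤-trans
      (ℕₚ.*-monoʳ-≤ 2 (subst (λ m → tri t m < tails t xs) len
        (tails-cyclic (Order-cyclic ord (λ {u} _ → every u)) t 1≤t (subst (2 + t ≤_) (sym len) t<))))
      (2*tails-≤ t (Order-unique ord))
      where
      every : ∀ u → u ∈ xs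
      every u = decidable-stable (u ∈? xs) λ u∉ → contradiction
        (ℕₚ.≤-trans (∑-unique-≤ᶠ (λ _ → 1) (All.tabulate (λ x∈ u≡x → u∉ (subst (_∈ xs) (sym u≡x) x∈)) ∷ Order-unique ord))
          (ℕₚ.≤-reflexive ∑ᶠ-one))
        (ℕₚ.<⇒≱ (ℕₚ.≤-reflexive (cong suc (sym (trans (∑-one xs) len)))))
        where open import Data.List.Membership.DecPropositional (Fin._≟_ {n}) using (_∈?_)

  -- The fundamental cycle of a non-tree edge.

  module FundamentalCycle {n : ℕ} (G T : Graph n) (δ : Fin n → Fin n → ℕ) (isDist : IsDist (Graph.adj T) δ)
    (T⊆G : ∀ {u v} → Graph.adj T u v ≡ true → Graph.adj G u v ≡ true)
    (a b : Fin n) (ab : Graph.adj G a b ≡ true) (¬ab : Graph.adj T a b ≢ true) where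

    open Metric T δ isDist

    private
      m : ℕ
      m = δ a b

      -- Keeps the two cycle neighbours of each end point distinct: positions 1 and `m` next to
      -- position 0, and positions `m - 1` and 0 next to position `m`.
      2≤m : 2 ≤ m
      2≤m with δ a b in eq
      ... | 0           = contradiction (trans (sym ab) (subst (λ w → Graph.adj G a w ≡ false) (δ-zero eq) (Graph.irrefl G a))) λ ()
      ... | 1           = contradiction (δ≡1⇒~ eq) ¬ab
      ... | suc (suc _) = s≤s (s≤s z≤n)

      at : ℕ → Fin n
      at i = ancestor a (m ∸ i) b

      at-δ : ∀ {i} → i ≤ m → δ a (at i) ≡ i
      at-δ {i} i≤m = trans (ancestor-δ a (m ∸ i) b) (ℕₚ.m∸[m∸n]≡n i≤m)

      at-m : at m ≡ b
      at-m = cong (λ k → ancestor a k b) (ℕₚ.n∸n≡0 m)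

      at-0 : at 0 ≡ a
      at-0 = sym (δ-zero (at-δ z≤n))

      at-~ : ∀ {i} → i < m → at i ~ at (suc i)
      at-~ {i} i<m = subst (λ k → ancestor a k b ~ at (suc i)) (sym (ℕₚ.+-∸-assoc 1 i<m))
        (ancestor-~ a (m ∸ suc i) b (ℕₚ.∸-monoʳ-< {m} (s≤s z≤n) i<m))

      -- A vertex of the tree path is determined by its distance from `a`. Membership is thus
      -- decidable by comparing `u` with the path vertex on its own level, and adjacency on the
      -- cycle can be expressed by levels alone.
      On : Fin n → Set
      On u = at (δ a u) ≡ u

      On-at : ∀ {i} → i ≤ m → On (at i)
      On-at i≤m = cong at (at-δ i≤m)

      On-≤ : ∀ {u} → On u → δ a u ≤ m
      On-≤ {u} h = subst (_≤ m) (trans (sym (ancestor-δ a (m ∸ δ a u) b)) (cong (δ a) h)) (ℕₚ.m∸n≤m m (m ∸ δ a u))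

      -- Adjacency of positions on a closed walk through 0 to `m`; the last two alternatives are the
      -- edge `a b` in its two directions.
      Link : ℕ → ℕ → Set
      Link i j = (suc i ≡ j ⊎ suc j ≡ i) ⊎ ((i ≡ 0 × j ≡ m) ⊎ (i ≡ m × j ≡ 0))

      Link? : ∀ i j → Dec (Link i j)
      Link? i j = (suc i ℕ.≟ j ⊎-dec suc j ℕ.≟ i) ⊎-dec ((i ℕ.≟ 0 ×-dec j ℕ.≟ m) ⊎-dec (i ℕ.≟ m ×-dec j ℕ.≟ 0))

      Link-sym : ∀ {i j} → Link i j → Link j i
      Link-sym (inj₁ (inj₁ h))       = inj₁ (inj₂ h)
      Link-sym (inj₁ (inj₂ h))       = inj₁ (inj₁ h)
      Link-sym (inj₂ (inj₁ (h , k))) = inj₂ (inj₂ (k , h))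
      Link-sym (inj₂ (inj₂ (h , k))) = inj₂ (inj₁ (k , h))

      Edge : Fin n → Fin n → Set
      Edge u v = On u × On v × Link (δ a u) (δ a v)

      Edge? : ∀ u v → Dec (Edge u v)
      Edge? u v = (at (δ a u) Fin.≟ u) ×-dec (at (δ a v) Fin.≟ v) ×-dec Link? (δ a u) (δ a v)

      Edge-sym : ∀ {u v} → Edge u v → Edge v u
      Edge-sym (hu , hv , l) = hv , hu , Link-sym l

      Edge-at : ∀ {i j} → i ≤ m → j ≤ m → Link i j → Edge (at i) (at j)
      Edge-at i≤ j≤ l = On-at i≤ , On-at j≤ , subst₂ Link (sym (at-δ i≤)) (sym (at-δ j≤)) l

      forward : ∀ {u v} → On u → On v → suc (δ a u) ≡ δ a v → u ~ v
      forward {u} {v} hu hv eq = subst₂ _~_ hu (trans (cong at eq) hv) (at-~ (subst (_≤ m) (sym eq) (On-≤ hv)))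

      closing : ∀ {u v} → On u → On v → δ a u ≡ 0 → δ a v ≡ m → u ≡ a × v ≡ b
      closing hu hv h k = trans (sym hu) (trans (cong at h) at-0) , trans (sym hv) (trans (cong at k) at-m)

    cycle : Adj n
    cycle u v = does (Edge? u v)

    cycle-ab : cycle a b ≡ true
    cycle-ab = does-true⁺ (Edge? a b) (subst₂ Edge at-0 at-m (Edge-at z≤n ℕₚ.≤-refl (inj₂ (inj₁ (refl , refl)))))

    -- The edge `a b` can be recovered from its cycle as the only edge outside the tree. This is
    -- what turns equality of two fundamental cycles into equality of the edges that generate them.
    cycle-⊆ : ∀ {u v} → cycle u v ≡ true → u ~ v ⊎ (u ≡ a × v ≡ b) ⊎ (u ≡ b × v ≡ a)
    cycle-⊆ {u} {v} e with does-true⁻ (Edge? u v) e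
    ... | hu , hv , inj₁ (inj₁ l)       = inj₁ (forward hu hv l)
    ... | hu , hv , inj₁ (inj₂ l)       = inj₁ (~-sym (forward hv hu l))
    ... | hu , hv , inj₂ (inj₁ (h , k)) = inj₂ (inj₁ (closing hu hv h k))
    ... | hu , hv , inj₂ (inj₂ (h , k)) = let (p , q) = closing hv hu k h in inj₂ (inj₂ (q , p))

    private
      degree-on : ∀ {v p q} → On v → p ≤ m → q ≤ m → p ≢ q → (∀ {j} → j ≤ m → Link (δ a v) j → j ≡ p ⊎ j ≡ q) →
                  Link (δ a v) p → Link (δ a v) q → degIn cycle v ≡ 2
      degree-on {v} {p} {q} hv p≤ q≤ p≢q only lp lq = degIn-two cycle
        (λ eq → p≢q (trans (sym (at-δ p≤)) (trans (cong (δ a) eq) (at-δ q≤))))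
        (λ w e → let (_ , hw , l) = does-true⁻ (Edge? v w) e in case only (On-≤ hw) l of λ
          { (inj₁ h) → inj₁ (trans (sym hw) (cong at h)) ; (inj₂ h) → inj₂ (trans (sym hw) (cong at h)) })
        (nbr p≤ lp) (nbr q≤ lq)
        where
        nbr : ∀ {j} → j ≤ m → Link (δ a v) j → cycle v (at j) ≡ true
        nbr {j} j≤ l = does-true⁺ (Edge? v (at j)) (hv , On-at j≤ , subst (Link (δ a v)) (sym (at-δ j≤)) l)

      degree : ∀ v → degIn cycle v ≡ 0 ⊎ degIn cycle v ≡ 2
      degree v = case at (δ a v) Fin.≟ v of λ
        { (no ¬on) → inj₁ (degIn-zero cycle (λ w e → ¬on (proj₁ (does-true⁻ (Edge? v w) e))))
        ; (yes hv) → inj₂ (split hv (δ a v) refl) }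
        where
        split : On v → ∀ i → δ a v ≡ i → degIn cycle v ≡ 2
        split hv zero eq = degree-on {v} {1} {m} hv (ℕₚ.<⇒≤ 2≤m) ℕₚ.≤-refl (λ 1≡m → ℕₚ.<-irrefl 1≡m 2≤m)
          (λ {j} _ l → only (subst (λ i → Link i j) eq l))
          (subst (λ i → Link i 1) (sym eq) (inj₁ (inj₁ refl))) (inj₂ (inj₁ (eq , refl)))
          where
          only : ∀ {j} → Link 0 j → j ≡ 1 ⊎ j ≡ m
          only (inj₁ (inj₁ h))       = inj₁ (sym h)
          only (inj₂ (inj₁ (_ , h))) = inj₂ h
          only (inj₂ (inj₂ (h , _))) = contradiction (subst (2 ≤_) (sym h) 2≤m) λ ()
        split hv (suc k) eq with ℕₚ.m≤n⇒m<n∨m≡n (subst (_≤ m) eq (On-≤ hv))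
        ... | inj₁ k<m = degree-on {v} {k} {suc (suc k)} hv (ℕₚ.≤-trans (ℕₚ.n≤1+n k) (ℕₚ.<⇒≤ k<m)) k<m
          (λ h → ℕₚ.<-irrefl h (ℕₚ.m<n⇒m<1+n (ℕₚ.n<1+n k)))
          (λ {j} _ l → only (subst (λ i → Link i j) eq l))
          (inj₁ (inj₂ (sym eq))) (inj₁ (inj₁ (cong suc eq)))
          where
          only : ∀ {j} → Link (suc k) j → j ≡ k ⊎ j ≡ suc (suc k)
          only (inj₁ (inj₁ h))       = inj₂ (sym h)
          only (inj₁ (inj₂ h))       = inj₁ (ℕₚ.suc-injective h)
          only (inj₂ (inj₂ (h , _))) = contradiction k<m (ℕₚ.<-irrefl h)
        ... | inj₂ k≡m = degree-on {v} {k} {0} hv (ℕₚ.≤-trans (ℕₚ.n≤1+n k) (ℕₚ.≤-reflexive k≡m)) z≤n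
          (λ k≡0 → contradiction (subst (2 ≤_) (trans (sym k≡m) (cong suc k≡0)) 2≤m) (λ { (s≤s ()) }))
          (λ {j} j≤ l → only j≤ (subst (λ i → Link i j) eq l))
          (inj₁ (inj₂ (sym eq))) (inj₂ (inj₂ (trans eq k≡m , refl)))
          where
          only : ∀ {j} → j ≤ m → Link (suc k) j → j ≡ k ⊎ j ≡ 0
          only j≤ (inj₁ (inj₁ h))       = contradiction (subst (_≤ m) (trans (sym h) (cong suc k≡m)) j≤) ℕₚ.1+n≰n
          only j≤ (inj₁ (inj₂ h))       = inj₁ (ℕₚ.suc-injective h)
          only j≤ (inj₂ (inj₂ (_ , h))) = inj₂ h

      along : ∀ i → i ≤ m → reach cycle i a (at i) ≡ true
      along zero    _   = ≡⇒== (sym at-0)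
      along (suc i) i<m = reach-step cycle i (along i (ℕₚ.<⇒≤ i<m))
        (does-true⁺ (Edge? (at i) (at (suc i))) (Edge-at (ℕₚ.<⇒≤ i<m) i<m (inj₁ (inj₁ refl))))

      cycle-symm : ∀ u v → cycle u v ≡ cycle v u
      cycle-symm u v = true-≡ (flip u v) (flip v u)
        where
        flip : ∀ u v → cycle u v ≡ true → cycle v u ≡ true
        flip u v e = does-true⁺ (Edge? v u) (Edge-sym (does-true⁻ (Edge? u v) e))

      on-support : ∀ {u} → 0 < degIn cycle u → On u
      on-support {u} h = decidable-stable (at (δ a u) Fin.≟ u) λ ¬on → contradiction (subst (0 <_)
        (degIn-zero cycle (λ w e → ¬on (proj₁ (does-true⁻ (Edge? u w) e)))) h) λ ()

      from-a : ∀ {u} → 0 < degIn cycle u → reach cycle (δ a u) a u ≡ true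
      from-a {u} h = subst (λ w → reach cycle (δ a u) a w ≡ true) (on-support h) (along (δ a u) (On-≤ (on-support h)))

    cycle-isCycle : IsCycle G cycle
    cycle-isCycle = cycle-symm
      , (λ u v e → [ T⊆G , [ (λ { (refl , refl) → ab }) , (λ { (refl , refl) → trans (Graph.symm G b a) ab }) ]′ ]′ (cycle-⊆ e))
      , (a , b , cycle-ab)
      , degree
      , λ u v hu hv → δ a v + δ a u , reach-trans cycle (δ a u) (δ a v) (reach-sym cycle cycle-symm (δ a u) (from-a hu)) (from-a hv)

  -- Breadth-first trees and the number of edges of a unicyclic graph.

  module BreadthFirstTree {n : ℕ} (G : Graph n) (δ : Fin n → Fin n → ℕ) (isDist : IsDist (Graph.adj G) δ) (r : Fin n) where

    open Metric G δ isDist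

    -- The first component excludes the root, whose `parent` is itself and would give a loop.
    IsParent : Fin n → Fin n → Set
    IsParent u v = 1 ≤ δ r u × parent r u ≡ v

    IsParent? : ∀ u v → Dec (IsParent u v)
    IsParent? u v = 1 ℕ.≤? δ r u ×-dec parent r u Fin.≟ v

    IsParent-level : ∀ {u v} → IsParent u v → δ r u ≡ suc (δ r v)
    IsParent-level {u} {v} (h , refl) =
      trans (sym (ℕₚ.suc-pred (δ r u) {{ℕ.>-nonZero h}})) (cong suc (sym (parent-δ r u)))

    IsParent-~ : ∀ {u v} → IsParent u v → u ~ v
    IsParent-~ {u} (h , refl) = ~-sym (parent-~ r u h)

    TreeEdge : Fin n → Fin n → Set
    TreeEdge u v = IsParent u v ⊎ IsParent v u

    TreeEdge? : ∀ u v → Dec (TreeEdge u v)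
    TreeEdge? u v = IsParent? u v ⊎-dec IsParent? v u

    TreeEdge-swap : ∀ {u v} → TreeEdge u v → TreeEdge v u
    TreeEdge-swap (inj₁ h) = inj₂ h
    TreeEdge-swap (inj₂ h) = inj₁ h

    tree : Graph n
    tree = record
      { adj    = λ u v → does (TreeEdge? u v)
      ; symm   = λ u v → true-≡ (flip u v) (flip v u)
      ; irrefl = λ u → Boolₚ.¬-not (λ e → loop (does-true⁻ (TreeEdge? u u) e))
      }
      where
      flip : ∀ u v → does (TreeEdge? u v) ≡ true → does (TreeEdge? v u) ≡ true
      flip u v e = does-true⁺ (TreeEdge? v u) (TreeEdge-swap (does-true⁻ (TreeEdge? u v) e))
      loop : ∀ {u} → ¬ TreeEdge u u
      loop (inj₁ h) = ℕₚ.1+n≢n (sym (IsParent-level h))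
      loop (inj₂ h) = ℕₚ.1+n≢n (sym (IsParent-level h))

    tree-⊆ : ∀ {u v} → Graph.adj tree u v ≡ true → u ~ v
    tree-⊆ {u} {v} e with does-true⁻ (TreeEdge? u v) e
    ... | inj₁ h = IsParent-~ h
    ... | inj₂ h = ~-sym (IsParent-~ h)

    tree-connected : Connected tree
    tree-connected u v = δ r v + δ r u , reach-trans T (δ r u) (δ r v)
      (reach-sym T (Graph.symm tree) (δ r u) (from-root (δ r u) u refl)) (from-root (δ r v) v refl)
      where
      T = Graph.adj tree
      from-root : ∀ k u → δ r u ≡ k → reach T k r u ≡ true
      from-root zero    u h = ≡⇒== (δ-zero h)
      from-root (suc k) u h = reach-step T k (from-root k (parent r u) (trans (parent-δ r u) (cong pred h)))
        (does-true⁺ (TreeEdge? (parent r u) u) (inj₂ (subst (1 ≤_) (sym h) (s≤s z≤n) , refl)))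

    -- Each row has at most one entry, and the row of the root has none.
    ∑∑-IsParent : suc (∑∑ (λ u v → ⟦ IsParent? u v ⟧)) ≤ n
    ∑∑-IsParent = ℕₚ.≤-trans (s≤s (∑ᶠ-mono row)) (ℕₚ.≤-reflexive total)
      where
      row : ∀ u → ∑ᶠ (λ v → ⟦ IsParent? u v ⟧) ≤ ⟦ ¬? (u Fin.≟ r) ⟧
      row u = case u Fin.≟ r of λ
        { (yes u≡r) → ℕₚ.≤-trans (ℕₚ.≤-reflexive (∑-zero (allFin n) (λ v _ → ⟦⟧-no (IsParent? u v)
            (λ (h , _) → contradiction (subst (1 ≤_) (trans (cong (δ r) u≡r) (δ-refl r)) h) λ ())))) z≤n
        ; (no u≢r)  → ℕₚ.≤-trans (∑ᶠ-mono (λ v → ⟦⟧-mono (IsParent? u v) (parent r u Fin.≟ v) proj₂))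
            (ℕₚ.≤-reflexive (trans (∑ᶠ-point₂ (parent r u)) (sym (⟦⟧-yes (¬? (u Fin.≟ r)) u≢r)))) }
      total : suc (∑ᶠ (λ u → ⟦ ¬? (u Fin.≟ r) ⟧)) ≡ n
      total = trans (cong (_+ ∑ᶠ (λ u → ⟦ ¬? (u Fin.≟ r) ⟧)) (sym (∑ᶠ-point r)))
        (trans (sym (∑-+ (allFin n) (λ u → ⟦ u Fin.≟ r ⟧) _))
          (trans (∑ᶠ-cong (λ u → ⟦⟧+⟦¬⟧ (u Fin.≟ r))) ∑ᶠ-one))

    ∑∑-TreeEdge : 2 + ∑∑ (λ u v → ⟦ TreeEdge? u v ⟧) ≤ 2 * n
    ∑∑-TreeEdge = begin
      2 + ∑∑ (λ u v → ⟦ TreeEdge? u v ⟧)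
        ≤⟨ ℕₚ.+-monoʳ-≤ 2 (∑∑-mono split) ⟩
      2 + ∑∑ (λ u v → P u v + P v u)
        ≡⟨ cong (2 +_) (trans (∑∑-+ P (λ u v → P v u)) (cong (∑∑ P +_) (∑-swap (allFin n) (allFin n) (λ u v → P v u)))) ⟩
      2 + (∑∑ P + ∑∑ P)
        ≡⟨ rearrange (∑∑ P) ⟩
      2 * suc (∑∑ P)
        ≤⟨ ℕₚ.*-monoʳ-≤ 2 ∑∑-IsParent ⟩
      2 * n ∎
      where
      open ℕₚ.≤-Reasoning
      P : Fin n → Fin n → ℕ
      P u v = ⟦ IsParent? u v ⟧
      rearrange : ∀ a → 2 + (a + a) ≡ 2 * suc a
      rearrange = solve 1 (λ a → con 2 :+ (a :+ a) := con 2 :* (con 1 :+ a)) refl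
        where open +-*-Solver
      split : ∀ u v → ⟦ TreeEdge? u v ⟧ ≤ P u v + P v u
      split u v = ⟦⟧-≤ (TreeEdge? u v) λ
        { (inj₁ h) → ℕₚ.≤-trans (ℕₚ.≤-reflexive (sym (⟦⟧-yes (IsParent? u v) h))) (ℕₚ.m≤m+n _ _)
        ; (inj₂ h) → ℕₚ.≤-trans (ℕₚ.≤-reflexive (sym (⟦⟧-yes (IsParent? v u) h))) (ℕₚ.m≤n+m _ _) }

  module UnicyclicGraph {n : ℕ} (G : Graph n) (δ : Fin n → Fin n → ℕ) (isDist : IsDist (Graph.adj G) δ)
                        (unicyclic : Unicyclic G) where

    open Metric G δ isDist
    open ConnectedOrders G δ isDist using (close)

    C : Adj n
    C = proj₁ (proj₂ unicyclic)

    C-isCycle : IsCycle G C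
    C-isCycle = proj₁ (proj₂ (proj₂ unicyclic))

    C-unique : ∀ S → IsCycle G S → ∀ u v → S u v ≡ C u v
    C-unique = proj₂ (proj₂ (proj₂ unicyclic))

    module Rooted (r : Fin n) where

      open BreadthFirstTree G δ isDist r public

      ExtraEdge : Fin n → Fin n → Set
      ExtraEdge u v = u ~ v × ¬ TreeEdge u v

      -- Both fundamental cycles are the unique cycle.
      ExtraEdge-unique : ∀ {a b c d} → ExtraEdge a b → ExtraEdge c d → (c ≡ a × d ≡ b) ⊎ (c ≡ b × d ≡ a)
      ExtraEdge-unique {a} {b} {c} {d} (ab , ¬ab) (cd , ¬cd) = [ (λ t → contradiction (does-true⁻ (TreeEdge? c d) t) ¬cd) , id ]′
        (AB.cycle-⊆ (trans (trans (C-unique AB.cycle AB.cycle-isCycle c d) (sym (C-unique CD.cycle CD.cycle-isCycle c d))) CD.cycle-ab))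
        where
        module AB = FundamentalCycle G tree (dist tree) (dist-isDist tree tree-connected) tree-⊆ a b ab (λ t → ¬ab (does-true⁻ (TreeEdge? a b) t))
        module CD = FundamentalCycle G tree (dist tree) (dist-isDist tree tree-connected) tree-⊆ c d cd (λ t → ¬cd (does-true⁻ (TreeEdge? c d) t))

      ExtraEdge? : ∀ u v → Dec (ExtraEdge u v)
      ExtraEdge? u v = adj u v Boolₚ.≟ true ×-dec ¬? (TreeEdge? u v)

      -- The tree accounts for at most 2(n - 1) ordered pairs; the extra edge adds at most its two
      -- orientations.
      ∑∑-adj : ∑∑ (λ u v → ⟦ adj u v Boolₚ.≟ true ⟧) ≤ 2 * n
      ∑∑-adj = ℕₚ.≤-trans (∑∑-mono split) (ℕₚ.≤-trans (ℕₚ.≤-reflexive (∑∑-+ extraIndicator _))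
        (ℕₚ.≤-trans (ℕₚ.+-monoˡ-≤ _ extra) ∑∑-TreeEdge))
        where
        extraIndicator : Fin n → Fin n → ℕ
        extraIndicator u v = ⟦ ExtraEdge? u v ⟧
        split : ∀ u v → ⟦ adj u v Boolₚ.≟ true ⟧ ≤ extraIndicator u v + ⟦ TreeEdge? u v ⟧
        split u v = ⟦⟧-≤ (adj u v Boolₚ.≟ true) λ e → case TreeEdge? u v of λ
          { (yes t) → ℕₚ.≤-trans (ℕₚ.≤-reflexive (sym (⟦⟧-yes (TreeEdge? u v) t))) (ℕₚ.m≤n+m _ _)
          ; (no ¬t) → ℕₚ.≤-trans (ℕₚ.≤-reflexive (sym (⟦⟧-yes (ExtraEdge? u v) (e , ¬t)))) (ℕₚ.m≤m+n _ _) }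
        extra : ∑∑ extraIndicator ≤ 2
        extra with Finₚ.any? (λ a → Finₚ.any? (λ b → ExtraEdge? a b))
        ... | no ¬∃ = ℕₚ.≤-trans (ℕₚ.≤-reflexive (∑-zero (allFin n) (λ u _ → ∑-zero (allFin n)
                        (λ v _ → ⟦⟧-no (ExtraEdge? u v) (λ x → ¬∃ (u , v , x)))))) z≤n
        ... | yes (a , b , ab) = ∑∑-≤2 ExtraEdge? a b (λ _ _ → ExtraEdge-unique ab)

    close-1-≤ : ∑∑ (close 1) ≤ 2 * n
    close-1-≤ = ℕₚ.≤-trans (∑∑-mono (λ u v → ⟦⟧-mono (¬? (u Fin.≟ v) ×-dec δ u v ℕ.≤? 1) (adj u v Boolₚ.≟ true)
        λ (u≢v , h) → δ≡1⇒~ (ℕₚ.≤-antisym h (δ-pos u≢v))))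
      (Rooted.∑∑-adj (proj₁ (CycleNeighbours.cycle-edge G C C-isCycle)))

  -- Diameter two: the equality case J_n.

  module _ {n : ℕ} where

    transpose-left : (i j : Fin n) → Inverse.to (Perm.transpose i j) i ≡ j
    transpose-left i j with i Fin.≟ i
    ... | yes _  = refl
    ... | no i≢i = contradiction refl i≢i

    transpose-other : (i j : Fin n) {k : Fin n} → k ≢ i → k ≢ j → Inverse.to (Perm.transpose i j) k ≡ k
    transpose-other i j {k} k≢i k≢j with k Fin.≟ i
    ... | yes k≡i = contradiction k≡i k≢i
    ... | no _ with k Fin.≟ j
    ... | yes k≡j = contradiction k≡j k≢j
    ... | no _    = refl

    to-injective : (σ : Fin n ↔ Fin n) → Injective _≡_ _≡_ (Inverse.to σ)
    to-injective σ {u} {v} eq = trans (sym (Inverse.strictlyInverseʳ σ u))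
      (trans (cong (Inverse.from σ) eq) (Inverse.strictlyInverseʳ σ v))

    -- Three transpositions, each carrying the current image of a point to its target. Targets
    -- reached before stay fixed, since they differ from both points that are exchanged.
    three-transitive : {x y z i j k : Fin n} → x ≢ y → x ≢ z → y ≢ z → i ≢ j → i ≢ k → j ≢ k →
                       ∃ λ (σ : Fin n ↔ Fin n) → Inverse.to σ x ≡ i × Inverse.to σ y ≡ j × Inverse.to σ z ≡ k
    three-transitive {x} {y} {z} {i} {j} {k} x≢y x≢z y≢z i≢j i≢k j≢k =
      π₁ Perm.∘ₚ (π₂ Perm.∘ₚ π₃) , eqx , eqy , transpose-left z₂ k
      where
      π₁ = Perm.transpose x i
      y₁ = Inverse.to π₁ y
      π₂ = Perm.transpose y₁ j
      z₂ = Inverse.to π₂ (Inverse.to π₁ z)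
      π₃ = Perm.transpose z₂ k
      i≢y₁ : i ≢ y₁
      i≢y₁ eq = x≢y (to-injective π₁ (trans (transpose-left x i) eq))
      x₂ : Inverse.to π₂ (Inverse.to π₁ x) ≡ i
      x₂ = trans (cong (Inverse.to π₂) (transpose-left x i)) (transpose-other y₁ j i≢y₁ i≢j)
      i≢z₂ : i ≢ z₂
      i≢z₂ eq = x≢z (to-injective π₁ (to-injective π₂ (trans x₂ eq)))
      j≢z₂ : j ≢ z₂
      j≢z₂ eq = y≢z (to-injective π₁ (to-injective π₂ (trans (transpose-left y₁ j) eq)))
      eqx = trans (cong (Inverse.to π₃) x₂) (transpose-other z₂ k i≢z₂ i≢k)
      eqy = trans (cong (Inverse.to π₃) (transpose-left y₁ j)) (transpose-other z₂ k j≢z₂ j≢k)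

  module DiameterTwo {n : ℕ} (G : Graph n) (δ : Fin n → Fin n → ℕ) (isDist : IsDist (Graph.adj G) δ)
                     (unicyclic : Unicyclic G) (6≤n : 6 ≤ n) where

    open Metric G δ isDist
    open UnicyclicGraph G δ isDist unicyclic

    EdgeJ : ℕ → ℕ → Set
    EdgeJ a b = (a ≡ 0 × 1 ≤ b) ⊎ (a ≡ 1 × b ≡ 2)

    -- Composed so that its `does` computes to `edgeJ a b`; this is why `Jn⁺` and `Jn⁻` are plain
    -- instances of `does-true⁺` and `does-true⁻`.
    EdgeJ? : ∀ a b → Dec (EdgeJ a b)
    EdgeJ? a b = (a ℕ.≟ 0 ×-dec 1 ℕ.≤? b) ⊎-dec (a ℕ.≟ 1 ×-dec b ℕ.≟ 2)

    Jn⁺ : ∀ {u v : Fin n} → EdgeJ (toℕ u) (toℕ v) ⊎ EdgeJ (toℕ v) (toℕ u) → Jn n u v ≡ true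
    Jn⁺ {u} {v} = does-true⁺ (EdgeJ? (toℕ u) (toℕ v) ⊎-dec EdgeJ? (toℕ v) (toℕ u))

    Jn⁻ : ∀ {u v : Fin n} → Jn n u v ≡ true → EdgeJ (toℕ u) (toℕ v) ⊎ EdgeJ (toℕ v) (toℕ u)
    Jn⁻ {u} {v} = does-true⁻ (EdgeJ? (toℕ u) (toℕ v) ⊎-dec EdgeJ? (toℕ v) (toℕ u))

    private
      zeroᶠ oneᶠ twoᶠ : Fin n
      zeroᶠ = fromℕ< (ℕₚ.≤-trans (s≤s z≤n) 6≤n)
      oneᶠ  = fromℕ< (ℕₚ.≤-trans (s≤s (s≤s z≤n)) 6≤n)
      twoᶠ  = fromℕ< (ℕₚ.≤-trans (s≤s (s≤s (s≤s z≤n))) 6≤n)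

      zero-toℕ : toℕ zeroᶠ ≡ 0
      zero-toℕ = Finₚ.toℕ-fromℕ< _

      one-toℕ : toℕ oneᶠ ≡ 1
      one-toℕ = Finₚ.toℕ-fromℕ< _

      two-toℕ : toℕ twoᶠ ≡ 2
      two-toℕ = Finₚ.toℕ-fromℕ< _

      by-toℕ : ∀ {i j : Fin n} {a b} → toℕ i ≡ a → toℕ j ≡ b → a ≢ b → i ≢ j
      by-toℕ p q a≢b eq = a≢b (trans (sym p) (trans (cong toℕ eq) q))

    Jn-diameter : G ≅ Jn n → ∀ u v → δ u v ≤ 2
    Jn-diameter (σ , iso) u v = ℕₚ.≤-trans (δ-triangle u c v)
      (ℕₚ.+-mono-≤ (subst (_≤ 1) (δ-sym c u) (near u)) (near v))
      where
      c = Inverse.from σ zeroᶠ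
      σc : Inverse.to σ c ≡ zeroᶠ
      σc = Inverse.strictlyInverseˡ σ zeroᶠ
      near : ∀ v → δ c v ≤ 1
      near v = case c Fin.≟ v of λ
        { (yes refl) → subst (_≤ 1) (sym (δ-refl c)) z≤n
        ; (no c≢v) → ℕₚ.≤-reflexive (~⇒δ≡1 (trans (sym (iso c v)) (Jn⁺ (inj₁ (inj₁
            (trans (cong toℕ σc) zero-toℕ ,
             ℕₚ.n≢0⇒n>0 (λ h → c≢v (to-injective σ (trans σc (Finₚ.toℕ-injective (trans zero-toℕ (sym h))))))))))) ) }

    module _ (diam : ∀ u v → δ u v ≤ 2) where

      module _ {r w : Fin n} (rw : δ r w ≡ 2) where

        open Rooted r

        private
          p = parent r w

          rp : δ r p ≡ 1
          rp = trans (parent-δ r w) (cong pred rw)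

          levels : ∀ {u v i j} → δ r u ≡ i → δ r v ≡ j → i ≢ j → u ≢ v
          levels hu hv i≢j refl = i≢j (trans (sym hu) hv)

          no-parent : ∀ {u v i j} → δ r u ≡ i → δ r v ≡ j → i ≢ suc j → ¬ IsParent u v
          no-parent hu hv i≢ h = i≢ (trans (sym hu) (trans (IsParent-level h) (cong suc hv)))

        -- The extra edge by which w avoids p on a shortest path to q.
        data Detour (q : Fin n) : Set where
          direct  : ExtraEdge w q → Detour q
          sibling : ExtraEdge p q → Detour q
          via     : ∀ {x} → δ r x ≡ 2 → parent r x ≡ q → ExtraEdge w x → Detour q

        -- In the tree, `w` and `q` are three steps apart, through `p` and `r`. A path of length at
        -- most 2 must therefore use an extra edge, and since there is only one, its other edge is a
        -- tree edge.
        detour : ∀ {q} → r ~ q → q ≢ p → Detour q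
        detour {q} r~q q≢p = go (δ w q) refl (diam w q)
          where
          rq : δ r q ≡ 1
          rq = ~⇒δ≡1 r~q
          go : ∀ d → δ w q ≡ d → d ≤ 2 → Detour q
          go 0 h _ = contradiction (δ-zero h) (levels rw rq λ ())
          go 1 h _ = direct (δ≡1⇒~ h , [ (λ (_ , eq) → q≢p (sym eq)) , no-parent rq rw (λ ()) ]′)
          go (suc (suc (suc _))) h (s≤s (s≤s ()))
          go 2 h _ with δ-pred h
          ... | x , wx , x~q with x Fin.≟ p
          ... | yes refl = sibling (x~q , [ no-parent rp rq (λ ()) , no-parent rq rp (λ ()) ]′)
          ... | no x≢p = onward (IsParent? x q)
            where
            w~x : w ~ x
            w~x = δ≡1⇒~ wx
            xw : ¬ IsParent x w
            xw h = contradiction (subst (_≤ 2) (trans (IsParent-level h) (cong suc rw)) (diam r x)) (ℕₚ.<⇒≱ ℕₚ.≤-refl)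
            extra : ExtraEdge w x
            extra = w~x , [ (λ (_ , eq) → x≢p (sym eq)) , xw ]′
            qx : ¬ IsParent q x
            qx h = contradiction (trans (sym rw) (~⇒δ≡1 (subst (_~ w) (sym r≡x) (~-sym w~x)))) λ ()
              where
              r≡x : r ≡ x
              r≡x = δ-zero (ℕₚ.suc-injective (trans (sym (IsParent-level h)) rq))
            onward : Dec (IsParent x q) → Detour q
            onward (yes h) = via (trans (IsParent-level h) (cong suc rq)) (proj₂ h) extra
            onward (no ¬h) = case ExtraEdge-unique extra (x~q , [ ¬h , qx ]′) of λ
              { (inj₁ (x≡w , _)) → contradiction (sym x≡w) (~⇒≢ w~x)
              ; (inj₂ (_ , q≡w)) → contradiction q≡w (levels rq rw λ ()) }

        -- Both detours use the same extra edge. The levels of its ends, 2 and 1, twice 1, or twice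
        -- 2, tell which kind of detour it is, and the edge then determines `q`.
        detour-unique : ∀ {q q′} → r ~ q → r ~ q′ → q ≢ p → q′ ≢ p → q ≡ q′
        detour-unique {q} {q′} e e′ q≢p q′≢p = go (detour e q≢p) (detour e′ q′≢p)
          where
          rq = ~⇒δ≡1 e
          rq′ = ~⇒δ≡1 e′
          go : Detour q → Detour q′ → q ≡ q′
          go (direct a) (direct b) = case ExtraEdge-unique a b of λ
            { (inj₁ (_ , h)) → sym h ; (inj₂ (h , _)) → contradiction h (levels rw rq λ ()) }
          go (direct a) (sibling b) = case ExtraEdge-unique a b of λ
            { (inj₁ (h , _)) → contradiction h (levels rp rw λ ()) ; (inj₂ (_ , h)) → contradiction h (levels rq′ rw λ ()) }
          go (direct a) (via rx _ b) = case ExtraEdge-unique a b of λ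
            { (inj₁ (_ , h)) → contradiction h (levels rx rq λ ()) ; (inj₂ (h , _)) → contradiction h (levels rw rq λ ()) }
          go (sibling a) (direct b) = case ExtraEdge-unique a b of λ
            { (inj₁ (h , _)) → contradiction h (levels rw rp λ ()) ; (inj₂ (h , _)) → contradiction h (levels rw rq λ ()) }
          go (sibling a) (sibling b) = case ExtraEdge-unique a b of λ
            { (inj₁ (_ , h)) → sym h ; (inj₂ (h , _)) → contradiction (sym h) q≢p }
          go (sibling a) (via rx _ b) = case ExtraEdge-unique a b of λ
            { (inj₁ (h , _)) → contradiction h (levels rw rp λ ()) ; (inj₂ (h , _)) → contradiction h (levels rw rq λ ()) }
          go (via rx _ a) (direct b) = case ExtraEdge-unique a b of λ
            { (inj₁ (_ , h)) → contradiction h (levels rq′ rx λ ()) ; (inj₂ (_ , h)) → contradiction h (levels rq′ rw λ ()) }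
          go (via rx _ a) (sibling b) = case ExtraEdge-unique a b of λ
            { (inj₁ (h , _)) → contradiction h (levels rp rw λ ()) ; (inj₂ (_ , h)) → contradiction h (levels rq′ rw λ ()) }
          go (via _ xq a) (via _ yq b) = case ExtraEdge-unique a b of λ
            { (inj₁ (_ , h)) → trans (sym xq) (trans (cong (parent r) (sym h)) yq)
            ; (inj₂ (_ , h)) → contradiction (sym h) (~⇒≢ (proj₁ b)) }

      degree : Fin n → ℕ
      degree r = ∑ᶠ (λ v → ⟦ adj r v Boolₚ.≟ true ⟧)

      degree-≤2 : ∀ {r w} → δ r w ≡ 2 → degree r ≤ 2
      degree-≤2 {r} {w} rw = ℕₚ.≮⇒≥ λ 3≤ → three (∑ᶠ-two (λ v → (adj r v Boolₚ.≟ true) ×-dec ¬? (v Fin.≟ p)) (two 3≤))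
        where
        p = parent r w
        two : 3 ≤ degree r → 2 ≤ ∑ᶠ (λ v → ⟦ (adj r v Boolₚ.≟ true) ×-dec ¬? (v Fin.≟ p) ⟧)
        two h = ℕₚ.≤-pred (ℕₚ.≤-trans h (ℕₚ.≤-trans (∑ᶠ-mono split)
          (ℕₚ.≤-reflexive (trans (∑-+ (allFin n) (λ v → ⟦ v Fin.≟ p ⟧) _) (cong₂ _+_ (∑ᶠ-point p) refl)))))
          where
          split : ∀ v → ⟦ adj r v Boolₚ.≟ true ⟧ ≤ ⟦ v Fin.≟ p ⟧ + ⟦ (adj r v Boolₚ.≟ true) ×-dec ¬? (v Fin.≟ p) ⟧
          split v = ⟦⟧-≤ (adj r v Boolₚ.≟ true) λ e → case v Fin.≟ p of λ
            { (yes v≡p) → ℕₚ.≤-trans (ℕₚ.≤-reflexive (sym (⟦⟧-yes (v Fin.≟ p) v≡p))) (ℕₚ.m≤m+n _ _)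
            ; (no v≢p)  → ℕₚ.≤-trans (ℕₚ.≤-reflexive (sym (⟦⟧-yes ((adj r v Boolₚ.≟ true) ×-dec ¬? (v Fin.≟ p)) (e , v≢p)))) (ℕₚ.m≤n+m _ _) }
        three : ¬ (∃ λ x → ∃ λ y → x ≢ y × (r ~ x × x ≢ p) × (r ~ y × y ≢ p))
        three (x , y , x≢y , (ex , xp) , (ey , yp)) = x≢y (detour-unique rw ex ey xp yp)

      -- Otherwise every vertex has another one at distance 2, so all degrees are at most 2. A fixed
      -- `r` then has at most two neighbours, each with at most one neighbour besides `r`, and
      -- diameter 2 leaves 1 + 2 + 2 = 5 vertices.
      universal : ∃ λ r → ∀ v → δ r v ≤ 1
      universal with Finₚ.any? (λ r → Finₚ.all? (λ v → δ r v ℕ.≤? 1))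
      ... | yes found = found
      ... | no ¬found = contradiction small (ℕₚ.<⇒≱ 6≤n)
        where
        degrees : ∀ r → degree r ≤ 2
        degrees r with Finₚ.any? (λ v → ¬? (δ r v ℕ.≤? 1))
        ... | yes (w , far) = degree-≤2 (ℕₚ.≤-antisym (diam r w) (ℕₚ.≰⇒> far))
        ... | no ¬far       = contradiction (r , λ v → decidable-stable (δ r v ℕ.≤? 1) (λ h → ¬far (v , h))) ¬found
        r = zeroᶠ
        R : Fin n → ℕ
        R a = ⟦ adj r a Boolₚ.≟ true ⟧
        S : Fin n → Fin n → ℕ
        S a v = ⟦ (adj a v Boolₚ.≟ true) ×-dec ¬? (v Fin.≟ r) ⟧
        covered : ∀ v → 1 ≤ (⟦ v Fin.≟ r ⟧ + R v) + ∑ᶠ (λ a → R a * S a v)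
        covered v = go (δ r v) refl (diam r v)
          where
          go : ∀ d → δ r v ≡ d → d ≤ 2 → 1 ≤ (⟦ v Fin.≟ r ⟧ + R v) + ∑ᶠ (λ a → R a * S a v)
          go 0 h _ = ℕₚ.≤-trans (ℕₚ.≤-reflexive (sym (⟦⟧-yes (v Fin.≟ r) (sym (δ-zero h)))))
                       (ℕₚ.≤-trans (ℕₚ.m≤m+n _ _) (ℕₚ.m≤m+n _ _))
          go 1 h _ = ℕₚ.≤-trans (ℕₚ.≤-reflexive (sym (⟦⟧-yes (adj r v Boolₚ.≟ true) (δ≡1⇒~ h))))
                       (ℕₚ.≤-trans (ℕₚ.m≤n+m (R v) ⟦ v Fin.≟ r ⟧) (ℕₚ.m≤m+n _ _))
          go 2 h _ = let (a , ra , av) = δ-pred h in ℕₚ.≤-trans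
            (ℕₚ.≤-reflexive (sym (cong₂ _*_ (⟦⟧-yes (adj r a Boolₚ.≟ true) (δ≡1⇒~ ra))
              (⟦⟧-yes ((adj a v Boolₚ.≟ true) ×-dec ¬? (v Fin.≟ r))
                (av , λ v≡r → contradiction (trans (sym h) (trans (cong (δ r) v≡r) (δ-refl r))) λ ())))))
            (ℕₚ.≤-trans (∑ᶠ-∈ (λ a → R a * S a v) a) (ℕₚ.m≤n+m _ _))
          go (suc (suc (suc _))) h (s≤s (s≤s ()))
        row : ∀ a → R a * ∑ᶠ (S a) ≤ R a
        row a with adj r a Boolₚ.≟ true
        ... | no _  = z≤n
        ... | yes e = subst (_≤ 1) (sym (ℕₚ.+-identityʳ _)) (ℕₚ.≤-pred (ℕₚ.≤-trans
          (ℕₚ.≤-trans (ℕₚ.≤-reflexive (trans (cong (_+ ∑ᶠ (S a)) (sym (∑ᶠ-point r))) (sym (∑-+ (allFin n) _ (S a)))))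
            (∑ᶠ-mono join)) (degrees a)))
          where
          join : ∀ v → ⟦ v Fin.≟ r ⟧ + S a v ≤ ⟦ adj a v Boolₚ.≟ true ⟧
          join v = case v Fin.≟ r of λ
            { (yes v≡r) → ℕₚ.≤-reflexive (trans (cong₂ _+_ (⟦⟧-yes (v Fin.≟ r) v≡r)
                  (⟦⟧-no ((adj a v Boolₚ.≟ true) ×-dec ¬? (v Fin.≟ r)) (λ (_ , h) → h v≡r)))
                (sym (⟦⟧-yes (adj a v Boolₚ.≟ true) (~-sym (subst (_~ a) (sym v≡r) e)))))
            ; (no v≢r) → ℕₚ.≤-trans (ℕₚ.≤-reflexive (cong (_+ S a v) (⟦⟧-no (v Fin.≟ r) v≢r)))
                (⟦⟧-mono ((adj a v Boolₚ.≟ true) ×-dec ¬? (v Fin.≟ r)) (adj a v Boolₚ.≟ true) proj₁) }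
        small : n ≤ 5
        small = begin
          n
            ≡⟨ sym ∑ᶠ-one ⟩
          ∑ᶠ {n} (λ _ → 1)
            ≤⟨ ∑ᶠ-mono covered ⟩
          ∑ᶠ (λ v → (⟦ v Fin.≟ r ⟧ + R v) + ∑ᶠ (λ a → R a * S a v))
            ≡⟨ trans (∑-+ (allFin n) _ _) (cong₂ _+_ (trans (∑-+ (allFin n) _ R) (cong (_+ ∑ᶠ R) (∑ᶠ-point r))) refl) ⟩
          (1 + ∑ᶠ R) + ∑ᶠ (λ v → ∑ᶠ (λ a → R a * S a v))
            ≡⟨ cong ((1 + ∑ᶠ R) +_) (trans (∑-swap (allFin n) (allFin n) (λ v a → R a * S a v))
                 (∑ᶠ-cong (λ a → ∑-*ˡ (allFin n) (R a) (S a)))) ⟩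
          (1 + ∑ᶠ R) + ∑ᶠ (λ a → R a * ∑ᶠ (S a))
            ≤⟨ ℕₚ.+-mono-≤ (s≤s (degrees r)) (ℕₚ.≤-trans (∑ᶠ-mono row) (degrees r)) ⟩
          5 ∎
          where open ℕₚ.≤-Reasoning

      -- The breadth-first tree at a universal vertex `r` is a star, so every edge avoiding `r` is
      -- extra. The cycle supplies one such edge `a b`: it has a vertex other than `r`, one of whose
      -- two cycle neighbours is again not `r`. Uniqueness of the extra edge leaves no other.
      diameter-two⇒Jn : G ≅ Jn n
      diameter-two⇒Jn = σ , λ u v → true-≡ (backward u v) (forward u v)
        where
        open CycleNeighbours G C C-isCycle
        r = proj₁ universal
        open Rooted r

        adj-r : ∀ {v} → r ≢ v → r ~ v
        adj-r {v} r≢v = δ≡1⇒~ (ℕₚ.≤-antisym (proj₂ universal v) (δ-pos r≢v))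

        off-root : ∃ λ a → ∃ λ w → a ≢ r × C a w ≡ true
        off-root with cycle-edge
        ... | u , v , e with u Fin.≟ r
        ... | no u≢r   = u , v , u≢r , e
        ... | yes refl = v , u , (λ v≡u → ~⇒≢ (cycle-adj e) (sym v≡u)) , cycle-sym e

        a = proj₁ off-root

        a≢r : a ≢ r
        a≢r = proj₁ (proj₂ (proj₂ off-root))

        chord : ∃ λ b → b ≢ r × a ~ b
        chord with cycle-neighbours (proj₂ (proj₂ (proj₂ off-root)))
        ... | p , q , p≢q , ap , aq with p Fin.≟ r
        ... | no p≢r   = p , p≢r , cycle-adj ap
        ... | yes refl = q , (λ q≡p → p≢q (sym q≡p)) , cycle-adj aq

        b = proj₁ chord

        b≢r : b ≢ r
        b≢r = proj₁ (proj₂ chord)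

        a~b : a ~ b
        a~b = proj₂ (proj₂ chord)

        not-tree : ∀ {u v} → u ≢ r → v ≢ r → ¬ TreeEdge u v
        not-tree u≢r v≢r = [ absurd u≢r v≢r , absurd v≢r u≢r ]′
          where
          absurd : ∀ {u v} → u ≢ r → v ≢ r → ¬ IsParent u v
          absurd {u} {v} u≢r v≢r h = contradiction
            (subst (_≤ 1) (trans (IsParent-level h) (cong suc (~⇒δ≡1 (adj-r (λ eq → v≢r (sym eq)))))) (proj₂ universal u))
            (ℕₚ.<⇒≱ ℕₚ.≤-refl)

        perm = three-transitive {x = r} {a} {b} {zeroᶠ} {oneᶠ} {twoᶠ}
                 (λ eq → a≢r (sym eq)) (λ eq → b≢r (sym eq)) (~⇒≢ a~b)
                 (by-toℕ zero-toℕ one-toℕ λ ()) (by-toℕ zero-toℕ two-toℕ λ ()) (by-toℕ one-toℕ two-toℕ λ ())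

        σ = proj₁ perm

        label : Fin n → ℕ
        label u = toℕ (Inverse.to σ u)

        label-r : label r ≡ 0
        label-r = trans (cong toℕ (proj₁ (proj₂ perm))) zero-toℕ

        label-a : label a ≡ 1
        label-a = trans (cong toℕ (proj₁ (proj₂ (proj₂ perm)))) one-toℕ

        label-b : label b ≡ 2
        label-b = trans (cong toℕ (proj₂ (proj₂ (proj₂ perm)))) two-toℕ

        label-injective : ∀ {u v} → label u ≡ label v → u ≡ v
        label-injective eq = to-injective σ (Finₚ.toℕ-injective eq)

        half : ∀ {u v} → EdgeJ (label u) (label v) → u ~ v
        half {u} {v} (inj₁ (h , k)) = subst (_~ v) (sym u≡r) (adj-r λ r≡v →
            contradiction (subst (1 ≤_) (trans (cong label (sym r≡v)) label-r) k) λ ())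
          where
          u≡r : u ≡ r
          u≡r = label-injective (trans h (sym label-r))
        half (inj₂ (h , k)) = subst₂ _~_ (label-injective (trans label-a (sym h))) (label-injective (trans label-b (sym k))) a~b

        backward : ∀ u v → Jn n (Inverse.to σ u) (Inverse.to σ v) ≡ true → u ~ v
        backward u v e = [ half , (λ h → ~-sym (half h)) ]′ (Jn⁻ e)

        root-edge : ∀ {v} → v ≢ r → EdgeJ (label r) (label v)
        root-edge v≢r = inj₁ (label-r , ℕₚ.n≢0⇒n>0 (λ h → v≢r (label-injective (trans h (sym label-r)))))

        forward : ∀ u v → u ~ v → Jn n (Inverse.to σ u) (Inverse.to σ v) ≡ true
        forward u v e = Jn⁺ (go (u Fin.≟ r) (v Fin.≟ r))
          where
          go : Dec (u ≡ r) → Dec (v ≡ r) → EdgeJ (label u) (label v) ⊎ EdgeJ (label v) (label u)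
          go (yes refl) _ = inj₁ (root-edge (λ v≡u → ~⇒≢ e (sym v≡u)))
          go (no _) (yes refl) = inj₂ (root-edge (~⇒≢ e))
          go (no u≢r) (no v≢r) = case ExtraEdge-unique (a~b , not-tree a≢r b≢r) (e , not-tree u≢r v≢r) of λ
            { (inj₁ (u≡a , v≡b)) → inj₁ (inj₂ (trans (cong label u≡a) label-a , trans (cong label v≡b) label-b))
            ; (inj₂ (u≡b , v≡a)) → inj₂ (inj₂ (trans (cong label v≡a) label-a , trans (cong label u≡b) label-b)) }

  -- The distances in G_{3,n}.

  ∑ᴺ : ℕ → (ℕ → ℕ) → ℕ
  ∑ᴺ n = ∑ (upTo n)

  ∑ᴺ-suc : ∀ n f → ∑ᴺ (suc n) f ≡ ∑ᴺ n f + f n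
  ∑ᴺ-suc n f = trans (cong (λ xs → ∑ xs f) (sym (Listₚ.upTo-∷ʳ n)))
    (trans (∑-++ (upTo n) (n ∷ []) f) (cong (∑ᴺ n f +_) (ℕₚ.+-identityʳ (f n))))

  ∑ᶠ-toℕ : ∀ n (f : ℕ → ℕ) → ∑ᶠ {n} (f ∘ toℕ) ≡ ∑ᴺ n f
  ∑ᶠ-toℕ n f = go n id id (λ _ → refl)
    where
    go : ∀ k (g : Fin k → Fin n) (g′ : ℕ → ℕ) → (∀ i → toℕ (g i) ≡ g′ (toℕ i)) →
         ∑ (Data.List.tabulate g) (f ∘ toℕ) ≡ ∑ (Data.List.applyUpTo g′ k) f
    go zero    g g′ h = refl
    go (suc k) g g′ h = cong₂ _+_ (cong f (h Fin.zero)) (go k (g ∘ Fin.suc) (g′ ∘ suc) (h ∘ Fin.suc))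

  ∑ᴺ-square : ∀ (K : ℕ → ℕ → ℕ) → (∀ i j → K i j ≡ K j i) → (∀ i → K i i ≡ 0) →
              ∀ n → ∑ᴺ n (λ i → ∑ᴺ n (K i)) ≡ 2 * ∑ᴺ n (λ j → ∑ᴺ j (λ i → K i j))
  ∑ᴺ-square K K-sym K-diag zero    = refl
  ∑ᴺ-square K K-sym K-diag (suc n) = begin
    ∑ᴺ (suc n) (λ i → ∑ᴺ (suc n) (K i))
      ≡⟨ ∑ᴺ-suc n _ ⟩
    ∑ᴺ n (λ i → ∑ᴺ (suc n) (K i)) + ∑ᴺ (suc n) (K n)
      ≡⟨ cong₂ _+_ (trans (∑-cong (upTo n) (λ i _ → ∑ᴺ-suc n (K i))) (∑-+ (upTo n) _ _))
           (trans (∑ᴺ-suc n (K n)) (cong₂ _+_ (∑-cong (upTo n) (λ i _ → K-sym n i)) (K-diag n))) ⟩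
    (∑ᴺ n (λ i → ∑ᴺ n (K i)) + col) + (col + 0)
      ≡⟨ cong (λ s → (s + col) + (col + 0)) (∑ᴺ-square K K-sym K-diag n) ⟩
    (2 * below + col) + (col + 0)
      ≡⟨ rearrange below col ⟩
    2 * (below + col)
      ≡⟨ cong (2 *_) (sym (∑ᴺ-suc n _)) ⟩
    2 * ∑ᴺ (suc n) (λ j → ∑ᴺ j (λ i → K i j)) ∎
    where
    open ≡-Reasoning
    col = ∑ᴺ n (λ i → K i n)
    below = ∑ᴺ n (λ j → ∑ᴺ j (λ i → K i j))
    rearrange : ∀ a b → (2 * a + b) + (b + 0) ≡ 2 * (a + b)
    rearrange = solve 2 (λ a b → (con 2 :* a :+ b) :+ (b :+ con 0) := con 2 :* (a :+ b)) refl
      where open +-*-Solver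

  module _ {n : ℕ} where

    injective⇒↔ : (f : Fin n → Fin n) → Injective _≡_ _≡_ f → ∃ λ (σ : Fin n ↔ Fin n) → ∀ u → Inverse.to σ u ≡ f u
    injective⇒↔ f inj = Perm.permutation f (λ j → proj₁ (onto j)) (λ j → proj₂ (onto j)) (λ i → inj (proj₂ (onto (f i)))) , λ _ → refl
      where
      onto : ∀ j → ∃ λ i → f i ≡ j
      onto j with Finₚ.any? (λ i → f i Fin.≟ j)
      ... | yes found = found
      ... | no ¬found = contradiction
        (ℕₚ.≤-trans (∑-unique-≤ᶠ {n} {ys = j ∷ map f (allFin n)} (λ _ → 1)
            (All.tabulate (λ x∈ j≡x → let (i , _ , eq) = ∈ₚ.∈-map⁻ f x∈ in ¬found (i , trans (sym eq) (sym j≡x))) ∷ Uniqueₚ.map⁺ inj allFin-unique))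
          (ℕₚ.≤-reflexive (∑ᶠ-one {n})))
        (ℕₚ.<⇒≱ (s≤s (ℕₚ.≤-reflexive (sym (trans (∑-map f (allFin n) (λ _ → 1)) (∑ᶠ-one {n}))))))

  -- G3n relabelled by exchanging 0 and 2, which turns it into the path 1, 2, …, n-1 with 0 an adjacent twin of 1.
  Path△ : ℕ → ℕ → Set
  Path△ i j = j ≡ suc i ⊎ (i ≡ 0 × j ≡ 2)

  module RelabelG3 {n : ℕ} (3≤n : 3 ≤ n) where

    EdgeG3 : ℕ → ℕ → Set
    EdgeG3 a b = (a ≡ 0 × (b ≡ 1 ⊎ b ≡ 2 ⊎ b ≡ 3)) ⊎ (a ≡ 1 × b ≡ 2) ⊎ (3 ≤ a × b ≡ suc a)

    -- As for `EdgeJ?`, the nesting makes `does` compute to `edgeG3 a b`.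
    EdgeG3? : ∀ a b → Dec (EdgeG3 a b)
    EdgeG3? a b = (a ℕ.≟ 0 ×-dec (b ℕ.≟ 1 ⊎-dec b ℕ.≟ 2 ⊎-dec b ℕ.≟ 3)) ⊎-dec (a ℕ.≟ 1 ×-dec b ℕ.≟ 2)
                    ⊎-dec (3 ℕ.≤? a ×-dec b ℕ.≟ suc a)

    G3n⁺ : ∀ {u v : Fin n} → EdgeG3 (toℕ u) (toℕ v) ⊎ EdgeG3 (toℕ v) (toℕ u) → G3n n u v ≡ true
    G3n⁺ {u} {v} = does-true⁺ (EdgeG3? (toℕ u) (toℕ v) ⊎-dec EdgeG3? (toℕ v) (toℕ u))

    G3n⁻ : ∀ {u v : Fin n} → G3n n u v ≡ true → EdgeG3 (toℕ u) (toℕ v) ⊎ EdgeG3 (toℕ v) (toℕ u)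
    G3n⁻ {u} {v} = does-true⁻ (EdgeG3? (toℕ u) (toℕ v) ⊎-dec EdgeG3? (toℕ v) (toℕ u))

    private
      swapℕ : ℕ → ℕ
      swapℕ 0 = 2
      swapℕ 1 = 1
      swapℕ 2 = 0
      swapℕ i = i

      zeroᶠ twoᶠ : Fin n
      zeroᶠ = fromℕ< (ℕₚ.≤-trans (s≤s z≤n) 3≤n)
      twoᶠ  = fromℕ< 3≤n

      swap₀₂ : Fin n ↔ Fin n
      swap₀₂ = Perm.transpose zeroᶠ twoᶠ

      zero-toℕ : toℕ zeroᶠ ≡ 0
      zero-toℕ = Finₚ.toℕ-fromℕ< _

      two-toℕ : toℕ twoᶠ ≡ 2
      two-toℕ = Finₚ.toℕ-fromℕ< _

      swapℕ-fixed : ∀ i → i ≢ 0 → i ≢ 2 → swapℕ i ≡ i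
      swapℕ-fixed 0 i≢0 _ = contradiction refl i≢0
      swapℕ-fixed 1 _ _ = refl
      swapℕ-fixed 2 _ i≢2 = contradiction refl i≢2
      swapℕ-fixed (suc (suc (suc i))) _ _ = refl

      swapℕ-involutive : ∀ i → swapℕ (swapℕ i) ≡ i
      swapℕ-involutive 0 = refl
      swapℕ-involutive 1 = refl
      swapℕ-involutive 2 = refl
      swapℕ-involutive (suc (suc (suc i))) = refl

      swap-toℕ : ∀ u → toℕ (Inverse.to swap₀₂ u) ≡ swapℕ (toℕ u)
      swap-toℕ u with u Fin.≟ zeroᶠ
      ... | yes refl = trans two-toℕ (cong swapℕ (sym zero-toℕ))
      ... | no u≢0 with u Fin.≟ twoᶠ
      ... | yes refl = trans zero-toℕ (cong swapℕ (sym two-toℕ))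
      ... | no u≢2 = sym (swapℕ-fixed (toℕ u)
        (λ h → u≢0 (Finₚ.toℕ-injective (trans h (sym zero-toℕ))))
        (λ h → u≢2 (Finₚ.toℕ-injective (trans h (sym two-toℕ)))))

      EdgeG3⇒Path△ : ∀ {i j} → EdgeG3 i j → Path△ (swapℕ i) (swapℕ j) ⊎ Path△ (swapℕ j) (swapℕ i)
      EdgeG3⇒Path△ (inj₁ (refl , inj₁ refl))        = inj₂ (inj₁ refl)
      EdgeG3⇒Path△ (inj₁ (refl , inj₂ (inj₁ refl))) = inj₂ (inj₂ (refl , refl))
      EdgeG3⇒Path△ (inj₁ (refl , inj₂ (inj₂ refl))) = inj₁ (inj₁ refl)
      EdgeG3⇒Path△ (inj₂ (inj₁ (refl , refl)))      = inj₂ (inj₁ refl)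
      EdgeG3⇒Path△ {suc (suc (suc i))} (inj₂ (inj₂ (_ , refl))) = inj₁ (inj₁ refl)
      EdgeG3⇒Path△ {suc zero}       (inj₂ (inj₂ (s≤s () , _)))
      EdgeG3⇒Path△ {suc (suc zero)} (inj₂ (inj₂ (s≤s (s≤s ()) , _)))

      Path△⇒EdgeG3 : ∀ {i j} → Path△ i j → EdgeG3 (swapℕ i) (swapℕ j) ⊎ EdgeG3 (swapℕ j) (swapℕ i)
      Path△⇒EdgeG3 {0} (inj₁ refl) = inj₂ (inj₂ (inj₁ (refl , refl)))
      Path△⇒EdgeG3 {1} (inj₁ refl) = inj₂ (inj₁ (refl , inj₁ refl))
      Path△⇒EdgeG3 {2} (inj₁ refl) = inj₁ (inj₁ (refl , inj₂ (inj₂ refl)))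
      Path△⇒EdgeG3 {suc (suc (suc i))} (inj₁ refl) = inj₁ (inj₂ (inj₂ (s≤s (s≤s (s≤s z≤n)) , refl)))
      Path△⇒EdgeG3 (inj₂ (refl , refl)) = inj₂ (inj₁ (refl , inj₂ (inj₁ refl)))

    Labelling : Graph n → Set
    Labelling G = ∃ λ (σ : Fin n ↔ Fin n) → ∀ u v →
      (Graph.adj G u v ≡ true → Path△ (toℕ (Inverse.to σ u)) (toℕ (Inverse.to σ v)) ⊎ Path△ (toℕ (Inverse.to σ v)) (toℕ (Inverse.to σ u)))
      × (Path△ (toℕ (Inverse.to σ u)) (toℕ (Inverse.to σ v)) → Graph.adj G u v ≡ true)

    ≅⇒Labelling : ∀ G → G ≅ G3n n → Labelling G
    ≅⇒Labelling G (σ , iso) = σ Perm.∘ₚ swap₀₂ , λ u v → fwd u v , bwd u v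
      where
      ℓ : Fin n → ℕ
      ℓ u = toℕ (Inverse.to swap₀₂ (Inverse.to σ u))
      ℓ-swap : ∀ u → swapℕ (toℕ (Inverse.to σ u)) ≡ ℓ u
      ℓ-swap u = sym (swap-toℕ (Inverse.to σ u))
      swap-ℓ : ∀ u → swapℕ (ℓ u) ≡ toℕ (Inverse.to σ u)
      swap-ℓ u = trans (cong swapℕ (swap-toℕ (Inverse.to σ u))) (swapℕ-involutive _)
      fwd : ∀ u v → Graph.adj G u v ≡ true → Path△ (ℓ u) (ℓ v) ⊎ Path△ (ℓ v) (ℓ u)
      fwd u v e with G3n⁻ {Inverse.to σ u} {Inverse.to σ v} (trans (iso u v) e)
      ... | inj₁ h = subst₂ (λ i j → Path△ i j ⊎ Path△ j i) (ℓ-swap u) (ℓ-swap v) (EdgeG3⇒Path△ h)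
      ... | inj₂ h = Data.Sum.swap (subst₂ (λ i j → Path△ i j ⊎ Path△ j i) (ℓ-swap v) (ℓ-swap u) (EdgeG3⇒Path△ h))
      bwd : ∀ u v → Path△ (ℓ u) (ℓ v) → Graph.adj G u v ≡ true
      bwd u v h = trans (sym (iso u v)) (G3n⁺ {Inverse.to σ u} {Inverse.to σ v}
        (subst₂ (λ i j → EdgeG3 i j ⊎ EdgeG3 j i) (swap-ℓ u) (swap-ℓ v) (Path△⇒EdgeG3 h)))

    Labelling⇒≅ : ∀ G → Labelling G → G ≅ G3n n
    Labelling⇒≅ G (σ , lab) = σ Perm.∘ₚ swap₀₂ , λ u v → true-≡ (fwd u v) (bwd u v)
      where
      ℓ : Fin n → ℕ
      ℓ u = toℕ (Inverse.to σ u)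
      ℓ-swap : ∀ u → swapℕ (ℓ u) ≡ toℕ (Inverse.to swap₀₂ (Inverse.to σ u))
      ℓ-swap u = sym (swap-toℕ (Inverse.to σ u))
      swap-ℓ : ∀ u → swapℕ (toℕ (Inverse.to swap₀₂ (Inverse.to σ u))) ≡ ℓ u
      swap-ℓ u = trans (cong swapℕ (swap-toℕ (Inverse.to σ u))) (swapℕ-involutive _)
      edge : ∀ u v → Path△ (ℓ u) (ℓ v) ⊎ Path△ (ℓ v) (ℓ u) → Graph.adj G u v ≡ true
      edge u v (inj₁ h) = proj₂ (lab u v) h
      edge u v (inj₂ h) = trans (Graph.symm G u v) (proj₂ (lab v u) h)
      fwd : ∀ u v → G3n n (Inverse.to swap₀₂ (Inverse.to σ u)) (Inverse.to swap₀₂ (Inverse.to σ v)) ≡ true → Graph.adj G u v ≡ true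
      fwd u v e with G3n⁻ {Inverse.to swap₀₂ (Inverse.to σ u)} {Inverse.to swap₀₂ (Inverse.to σ v)} e
      ... | inj₁ h = edge u v (subst₂ (λ i j → Path△ i j ⊎ Path△ j i) (swap-ℓ u) (swap-ℓ v) (EdgeG3⇒Path△ h))
      ... | inj₂ h = edge u v (Data.Sum.swap (subst₂ (λ i j → Path△ i j ⊎ Path△ j i) (swap-ℓ v) (swap-ℓ u) (EdgeG3⇒Path△ h)))
      bwd : ∀ u v → Graph.adj G u v ≡ true → G3n n (Inverse.to swap₀₂ (Inverse.to σ u)) (Inverse.to swap₀₂ (Inverse.to σ v)) ≡ true
      bwd u v e with proj₁ (lab u v) e
      ... | inj₁ h = G3n⁺ {Inverse.to swap₀₂ (Inverse.to σ u)} {Inverse.to swap₀₂ (Inverse.to σ v)} (subst₂ (λ i j → EdgeG3 i j ⊎ EdgeG3 j i) (ℓ-swap u) (ℓ-swap v) (Path△⇒EdgeG3 h))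
      ... | inj₂ h = G3n⁺ {Inverse.to swap₀₂ (Inverse.to σ u)} {Inverse.to swap₀₂ (Inverse.to σ v)} (Data.Sum.swap (subst₂ (λ i j → EdgeG3 i j ⊎ EdgeG3 j i) (ℓ-swap v) (ℓ-swap u) (Path△⇒EdgeG3 h)))

  module _ (t : ℕ) where

    private
      Near : ℕ → ℕ → Set
      Near i j = i ≢ j × (pred i ≤ pred j + t × pred j ≤ pred i + t)

      Near? : ∀ i j → Dec (Near i j)
      Near? i j = ¬? (i ℕ.≟ j) ×-dec (pred i ℕ.≤? pred j + t ×-dec pred j ℕ.≤? pred i + t)

    -- `pred` is the position along the path, shared by the twins 0 and 1. For `t ≥ 1` this is the
    -- indicator of a distance at most `t` between distinct vertices of the relabelled G_{3,n}.
    near△ : ℕ → ℕ → ℕ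
    near△ i j = ⟦ Near? i j ⟧

    near△-≥ : ∀ {p} {P : Set p} (d : Dec P) {i j} → (P → i ≢ j) → (P → pred i ≤ pred j + t) → (P → pred j ≤ pred i + t) →
              ⟦ d ⟧ ≤ near△ i j
    near△-≥ d {i} {j} f g h = ⟦⟧-mono d (Near? i j) (λ p → f p , g p , h p)

    private
      near△-sym : ∀ i j → near△ i j ≡ near△ j i
      near△-sym i j = ⟦⟧-cong (Near? i j) (Near? j i) (flip i j) (flip j i)
        where
        flip : ∀ i j → Near i j → Near j i
        flip i j (i≢j , p , q) = (λ eq → i≢j (sym eq)) , q , p

      near△-diag : ∀ i → near△ i i ≡ 0
      near△-diag i = ⟦⟧-no (Near? i i) (λ (h , _) → h refl)

      drop-last : ∀ (f : ℕ → ℕ) → (∀ i → f i ≤ 1) → ∀ k m → ∑ᴺ (k + m) f ≤ k + ∑ᴺ m f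
      drop-last f f≤1 zero    m = ℕₚ.≤-refl
      drop-last f f≤1 (suc k) m = ℕₚ.≤-trans (ℕₚ.≤-reflexive (trans (∑ᴺ-suc (k + m) f) (ℕₚ.+-comm _ (f (k + m)))))
        (ℕₚ.+-mono-≤ (f≤1 (k + m)) (drop-last f f≤1 k m))

      -- The surplus of one over a path occurs when the window of `t` positions below `j` just
      -- reaches position 0, which carries two labels. For smaller `j` all `j` earlier labels are
      -- counted anyway, and for larger `j` the window stops short of position 0.
      column : ∀ j → ∑ᴺ j (λ i → near△ i j) ≤ t ⊓ j + ⟦ j ℕ.≟ suc t ⟧
      column j with ℕₚ.<-cmp j (suc t)
      ... | tri< (s≤s j≤t) _ _ = ℕₚ.≤-trans (∑-≤length (λ i → Near? i j) (upTo j))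
        (ℕₚ.≤-trans (ℕₚ.≤-reflexive (trans (Listₚ.length-upTo j) (sym (ℕₚ.m≥n⇒m⊓n≡n j≤t)))) (ℕₚ.m≤m+n _ _))
      ... | tri≈ _ refl _ = ℕₚ.≤-trans (∑-≤length (λ i → Near? i j) (upTo j))
        (ℕₚ.≤-reflexive (trans (Listₚ.length-upTo j) (trans (ℕₚ.+-comm 1 t)
          (cong₂ _+_ (sym (ℕₚ.m≤n⇒m⊓n≡m (ℕₚ.n≤1+n t))) (sym (⟦⟧-yes (suc t ℕ.≟ suc t) refl))))))
      ... | tri> _ _ t< = ℕₚ.≤-trans (subst (λ k → ∑ᴺ k (λ i → near△ i j) ≤ t) j≡ far)
        (ℕₚ.≤-trans (ℕₚ.≤-reflexive (sym (ℕₚ.m≤n⇒m⊓n≡m (ℕₚ.≤-trans (ℕₚ.n≤1+n t) (ℕₚ.<⇒≤ t<))))) (ℕₚ.m≤m+n _ _))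
        where
        -- Labels below `2 + e` have position at most `e`, whereas `pred j` is `t + 1 + e`, so they
        -- miss the window by at least one.
        e = j ∸ suc (suc t)
        j≡ : t + (2 + e) ≡ j
        j≡ = trans (trans (ℕₚ.+-suc t (suc e)) (cong suc (ℕₚ.+-suc t e))) (ℕₚ.m+[n∸m]≡n t<)
        pred-≤ : ∀ {i} → i < 2 + e → pred i ≤ e
        pred-≤ {zero}  _ = z≤n
        pred-≤ {suc i} (s≤s (s≤s h)) = h
        apart : ∀ i → i ∈ upTo (2 + e) → near△ i j ≡ 0
        apart i i∈ = ⟦⟧-no (Near? i j) (λ (_ , _ , h) →
          ℕₚ.1+n≰n (ℕₚ.≤-trans (subst (λ k → suc (e + t) ≤ pred k) j≡ (ℕₚ.≤-reflexive below))
            (ℕₚ.≤-trans h (ℕₚ.+-monoˡ-≤ t (pred-≤ (∈ₚ.∈-upTo⁻ i∈))))))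
          where
          below : suc (e + t) ≡ pred (t + (2 + e))
          below = trans (cong suc (ℕₚ.+-comm e t)) (sym (cong pred (trans (ℕₚ.+-suc t (suc e)) (cong suc (ℕₚ.+-suc t e)))))
        far : ∑ᴺ (t + (2 + e)) (λ i → near△ i j) ≤ t
        far = ℕₚ.≤-trans (drop-last (λ i → near△ i j) (λ i → ⟦⟧≤1 (Near? i j)) t (2 + e))
          (ℕₚ.≤-reflexive (trans (cong (t +_) (∑-zero (upTo (2 + e)) apart)) (ℕₚ.+-identityʳ t)))

      columns : ∀ n → ∑ᴺ n (λ j → ∑ᴺ j (λ i → near△ i j)) ≤ tri t n + ⟦ suc t ℕ.<? n ⟧
      columns zero    = z≤n
      columns (suc n) = ℕₚ.≤-trans (ℕₚ.≤-reflexive (∑ᴺ-suc n _))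
        (ℕₚ.≤-trans (ℕₚ.+-mono-≤ (columns n) (column n))
          (ℕₚ.≤-trans (ℕₚ.≤-reflexive (+-interchange (tri t n) _ (t ⊓ n) _)) (ℕₚ.+-monoʳ-≤ (tri t n + t ⊓ n) merge)))
        where
        merge : ⟦ suc t ℕ.<? n ⟧ + ⟦ n ℕ.≟ suc t ⟧ ≤ ⟦ suc t ℕ.<? suc n ⟧
        merge with suc t ℕ.<? n | n ℕ.≟ suc t
        ... | yes h | yes eq = contradiction h (ℕₚ.<-irrefl (sym eq))
        ... | yes h | no _   = ℕₚ.≤-reflexive (sym (⟦⟧-yes (suc t ℕ.<? suc n) (ℕₚ.m<n⇒m<1+n h)))
        ... | no _  | yes eq = ℕₚ.≤-reflexive (sym (⟦⟧-yes (suc t ℕ.<? suc n) (s≤s (ℕₚ.≤-reflexive (sym eq)))))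
        ... | no _  | no _   = z≤n

    ∑∑-near△ : ∀ n → ∑∑ {n} (λ u v → near△ (toℕ u) (toℕ v)) ≤ 2 * suc (tri t n)
    ∑∑-near△ n = ℕₚ.≤-trans
      (ℕₚ.≤-reflexive (trans (∑ᶠ-cong {n} (λ u → ∑ᶠ-toℕ n (near△ (toℕ u)))) (trans (∑ᶠ-toℕ n (λ i → ∑ᴺ n (near△ i))) (∑ᴺ-square near△ near△-sym near△-diag n))))
      (ℕₚ.*-monoʳ-≤ 2 (ℕₚ.≤-trans (columns n)
        (ℕₚ.≤-trans (ℕₚ.+-monoʳ-≤ (tri t n) (⟦⟧≤1 (suc t ℕ.<? n))) (ℕₚ.≤-reflexive (ℕₚ.+-comm (tri t n) 1)))))

  module G3Distances {n : ℕ} (3≤n : 3 ≤ n) (G : Graph n) (δ : Fin n → Fin n → ℕ) (isDist : IsDist (Graph.adj G) δ) where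

    open Metric G δ isDist
    open ConnectedOrders G δ isDist using (close)
    open RelabelG3 3≤n

    -- The position `pred ∘ ℓ` is Lipschitz along the edges, so close vertices have near labels.
    -- This is the counterpart of `close-≥` and pins the count down for G_{3,n}.
    close-≤ : G ≅ G3n n → ∀ t → ∑∑ (close t) ≤ 2 * suc (tri t n)
    close-≤ iso t = ℕₚ.≤-trans (∑∑-mono {n} bound) (ℕₚ.≤-trans
        (ℕₚ.≤-trans (∑ᶠ-mono {n} (λ u → ∑ᶠ-∘-≤ {n} (Inverse.to σ) (to-injective σ) (λ v → near△ t (ℓ u) (toℕ v))))
          (∑ᶠ-∘-≤ {n} (Inverse.to σ) (to-injective σ) (λ u → ∑ᶠ {n} (λ v → near△ t (toℕ u) (toℕ v)))))
        (∑∑-near△ t n))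
      where
      lab = ≅⇒Labelling G iso
      σ = proj₁ lab
      ℓ : Fin n → ℕ
      ℓ u = toℕ (Inverse.to σ u)
      step : ∀ {i j} → Path△ i j → pred j ≤ suc (pred i) × pred i ≤ suc (pred j)
      step {zero}  (inj₁ refl)          = z≤n , z≤n
      step {suc i} (inj₁ refl)          = ℕₚ.≤-refl , ℕₚ.≤-trans (ℕₚ.n≤1+n i) (ℕₚ.n≤1+n (suc i))
      step         (inj₂ (refl , refl)) = ℕₚ.≤-refl , z≤n
      lip : Lipschitz (pred ∘ ℓ)
      lip {u} {v} e with proj₁ (proj₂ lab u v) e
      ... | inj₁ h = proj₁ (step h)
      ... | inj₂ h = proj₂ (step h)
      bound : ∀ u v → close t u v ≤ near△ t (ℓ u) (ℓ v)
      bound u v = near△-≥ t (¬? (u Fin.≟ v) ×-dec δ u v ℕ.≤? t)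
        (λ (u≢v , _) eq → u≢v (to-injective σ (Finₚ.toℕ-injective eq)))
        (λ (_ , h) → ℕₚ.≤-trans (lipschitz-δ {pred ∘ ℓ} lip v u) (ℕₚ.+-monoʳ-≤ _ (subst (_≤ t) (δ-sym u v) h)))
        (λ (_ , h) → ℕₚ.≤-trans (lipschitz-δ {pred ∘ ℓ} lip u v) (ℕₚ.+-monoʳ-≤ _ h))

  -- Diameter n - 2: the equality case G_{3,n}.

  ∸-< : ∀ {a b} → 1 ≤ a → a ≤ b → b ∸ a < b
  ∸-< {suc a} {suc b} _ _ = s≤s (ℕₚ.m∸n≤m b a)

  module LongDiameter {n : ℕ} (G : Graph n) (δ : Fin n → Fin n → ℕ) (isDist : IsDist (Graph.adj G) δ)
    (unicyclic : Unicyclic G) (D : ℕ) (n≡ : n ≡ 2 + D) (3≤D : 3 ≤ D) (diam : ∀ u v → δ u v ≤ D) where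

    open Metric G δ isDist
    open UnicyclicGraph G δ isDist unicyclic using (C; C-isCycle)

    private
      parent-near : ∀ r v → δ (parent r v) v ≤ 1
      parent-near r v with 1 ℕ.≤? δ r v
      ... | yes h = ℕₚ.≤-reflexive (~⇒δ≡1 (parent-~ r v h))
      ... | no ¬h = ℕₚ.≤-trans (ℕₚ.≤-reflexive (trans (cong (λ w → δ w v) p≡v) (δ-refl v))) z≤n
        where
        rv : δ r v ≡ 0
        rv = ℕₚ.n<1⇒n≡0 (ℕₚ.≰⇒> ¬h)
        p≡v : parent r v ≡ v
        p≡v = trans (sym (δ-zero (trans (parent-δ r v) (cong pred rv)))) (δ-zero rv)

      ancestor-near : ∀ r k v → δ (ancestor r k v) v ≤ k
      ancestor-near r zero    v = ℕₚ.≤-reflexive (δ-refl v)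
      ancestor-near r (suc k) v = ℕₚ.≤-trans (δ-triangle _ (ancestor r k v) v)
        (ℕₚ.+-mono-≤ (parent-near r (ancestor r k v)) (ancestor-near r k v))

      ancestor-+ : ∀ r k l v → ancestor r (k + l) v ≡ ancestor r k (ancestor r l v)
      ancestor-+ r zero    l v = refl
      ancestor-+ r (suc k) l v = cong (parent r) (ancestor-+ r k l v)

    module Diametral {x y : Fin n} (xy : δ x y ≡ D) where

      at : ℕ → Fin n
      at i = ancestor x (D ∸ i) y

      at-δ : ∀ {i} → i ≤ D → δ x (at i) ≡ i
      at-δ {i} i≤ = trans (ancestor-δ x (D ∸ i) y) (trans (cong (_∸ (D ∸ i)) xy) (ℕₚ.m∸[m∸n]≡n i≤))

      On : Fin n → Set
      On u = at (δ x u) ≡ u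

      On? : ∀ u → Dec (On u)
      On? u = at (δ x u) Fin.≟ u

      On-y : On y
      On-y = trans (cong at xy) (cong (λ k → ancestor x k y) (ℕₚ.n∸n≡0 D))

      On-injective : ∀ {u v} → On u → On v → δ x u ≡ δ x v → u ≡ v
      On-injective hu hv eq = trans (sym hu) (trans (cong at eq) hv)

      -- The path uses D + 1 of the D + 2 vertices.
      off-unique : ∀ {u v} → ¬ On u → ¬ On v → u ≡ v
      off-unique {u} {v} ¬u ¬v = decidable-stable (u Fin.≟ v) λ u≢v → ℕₚ.1+n≰n (ℕₚ.≤-trans
        (ℕₚ.+-mono-≤
          (ℕₚ.≤-trans (ℕₚ.≤-reflexive (sym (cong₂ _+_ (⟦⟧-yes (¬? (On? u)) ¬u) (⟦⟧-yes (¬? (On? v)) ¬v))))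
            (∑ᶠ-∈₂ (λ w → ⟦ ¬? (On? w) ⟧) u≢v))
          on-path)
        (ℕₚ.≤-reflexive (trans (sym (∑-+ (allFin n) _ _))
          (trans (∑ᶠ-cong (λ w → trans (ℕₚ.+-comm ⟦ ¬? (On? w) ⟧ _) (⟦⟧+⟦¬⟧ (On? w)))) (trans (∑ᶠ-one {n}) n≡)))))
        where
        path : Fin (suc D) → Fin n
        path i = at (toℕ i)
        level : ∀ i → δ x (path i) ≡ toℕ i
        level i = at-δ (ℕₚ.≤-pred (Finₚ.toℕ<n i))
        on-path : suc D ≤ ∑ᶠ (λ w → ⟦ On? w ⟧)
        on-path = ℕₚ.≤-trans (ℕₚ.≤-reflexive (sym
            (trans (∑-map path (allFin (suc D)) (λ w → ⟦ On? w ⟧))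
              (trans (∑ᶠ-cong {suc D} (λ i → ⟦⟧-yes (On? (path i)) (cong at (level i)))) (∑ᶠ-one {suc D})))))
          (∑-unique-≤ᶠ {n} {map path (allFin (suc D))} (λ w → ⟦ On? w ⟧)
            (Uniqueₚ.map⁺ (λ {i} {j} eq → Finₚ.toℕ-injective (trans (sym (level i)) (trans (cong (δ x) eq) (level j)))) allFin-unique))

      -- Of two path vertices, the one nearer to `x` is an ancestor of the other, as many
      -- generations up as their levels differ.
      On-dist : ∀ {u v} → On u → On v → δ x u ≤ δ x v → δ u v ≤ δ x v ∸ δ x u
      On-dist {u} {v} hu hv u≤v = subst₂ (λ a b → δ a b ≤ δ x v ∸ δ x u)
        (trans (sym (trans (cong (λ k → ancestor x k y) gap) (ancestor-+ x (δ x v ∸ δ x u) (D ∸ δ x v) y))) hu) hv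
        (ancestor-near x (δ x v ∸ δ x u) (at (δ x v)))
        where
        gap : D ∸ δ x u ≡ (δ x v ∸ δ x u) + (D ∸ δ x v)
        gap = trans (cong (_∸ δ x u) (sym (ℕₚ.m+[n∸m]≡n (diam x v))))
          (ℕₚ.+-∸-comm (D ∸ δ x v) u≤v)

    -- If q is off the path, it sees x through w and y through w′; one of w, w′ leads to v quickly.
    module OffPath {x y : Fin n} (xy : δ x y ≡ D) where

      open Diametral xy

      off-near : ∀ {q v} → ¬ On q → On v → v ≢ x → v ≢ y → δ x q ≢ D → δ y q ≢ D → δ q v < D
      off-near {q} {v} ¬q hv v≢x v≢y xq≢D yq≢D =
        let (w , xw , wq) = predecessor x xq<D (λ x≡q → ¬q (subst On x≡q On-x))
            (w′ , yw′ , w′q) = predecessor y yq<D (λ y≡q → ¬q (subst On y≡q On-y))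
        in go (~-sym wq) (~-sym w′q) (on-neighbour wq) (on-neighbour w′q) xw
              -- `w′` is at distance at most `D - 2` from `y`, hence at least 2 from `x`.
              (ℕₚ.+-cancelʳ-≤ (δ y w′) 2 (δ x w′) (ℕₚ.≤-trans yw′ (ℕₚ.≤-trans (ℕₚ.≤-reflexive (sym xy))
                (ℕₚ.≤-trans (δ-triangle x w′ y) (ℕₚ.≤-reflexive (cong (δ x w′ +_) (δ-sym w′ y)))))))
        where
        On-x : On x
        On-x = sym (δ-zero (trans (cong (δ x) (cong at (δ-refl x))) (at-δ z≤n)))
        xq<D : δ x q < D
        xq<D = ℕₚ.≤∧≢⇒< (diam x q) xq≢D
        yq<D : δ y q < D
        yq<D = ℕₚ.≤∧≢⇒< (diam y q) yq≢D
        predecessor : ∀ r → δ r q < D → r ≢ q → ∃ λ w → 2 + δ r w ≤ D × w ~ q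
        predecessor r lt r≢q = parent r q ,
          ℕₚ.≤-trans (s≤s (ℕₚ.≤-reflexive (trans (cong suc (parent-δ r q)) (ℕₚ.suc-pred (δ r q) {{ℕ.>-nonZero (δ-pos r≢q)}})))) lt ,
          parent-~ r q (δ-pos r≢q)
        on-neighbour : ∀ {w} → w ~ q → On w
        on-neighbour {w} e = decidable-stable (On? w) (λ ¬w → ~⇒≢ e (off-unique ¬w ¬q))
        1≤v : 1 ≤ δ x v
        1≤v = δ-pos (λ eq → v≢x (sym eq))
        v<D : δ x v < D
        v<D = ℕₚ.≤∧≢⇒< (diam x v) (λ eq → v≢y (On-injective hv On-y (trans eq (sym xy))))
        via : ∀ {w} → q ~ w → δ q v ≤ suc (δ w v)
        via {w} e = ℕₚ.≤-trans (δ-triangle q w v) (ℕₚ.≤-reflexive (cong (_+ δ w v) (~⇒δ≡1 e)))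
        below : ∀ {w} → q ~ w → On w → δ x v ≤ δ x w → δ x w < D → δ q v < D
        below {w} e hw le lt = ℕₚ.≤-trans (s≤s (via e)) (ℕₚ.≤-trans (s≤s (s≤s
            (subst (_≤ δ x w ∸ δ x v) (δ-sym v w) (On-dist hv hw le))))
          (ℕₚ.≤-trans (s≤s (∸-< 1≤v le)) lt))
        above : ∀ {w} → q ~ w → On w → δ x w ≤ δ x v → 1 ≤ δ x w → δ q v < D
        above {w} e hw le pos = ℕₚ.≤-trans (s≤s (via e)) (ℕₚ.≤-trans (s≤s (s≤s (On-dist hw hv le)))
          (ℕₚ.≤-trans (s≤s (∸-< pos le)) v<D))
        go : ∀ {w w′} → q ~ w → q ~ w′ → On w → On w′ → 2 + δ x w ≤ D → 2 ≤ δ x w′ → δ q v < D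
        go {w} {w′} e e′ hw hw′ w≤ 2≤w′ with ℕₚ.≤-total (δ x v) (δ x w)
        ... | inj₁ le = below e hw le (ℕₚ.<⇒≤ w≤)
        ... | inj₂ ge with 1 ℕ.≤? δ x w
        ... | yes pos = above e hw ge pos
        ... | no ¬pos with ℕₚ.≤-total (δ x w′) (δ x v)
        ... | inj₁ le′ = above e′ hw′ le′ (ℕₚ.≤-trans (s≤s z≤n) 2≤w′)
        -- Here `w` is `x` itself, so `w′` is on level at most 2 and `3 ≤ D` keeps it below level
        -- `D`. In the four-cycle, where `D` is 2, the claim fails at this point.
        ... | inj₂ ge′ = below e′ hw′ ge′ (ℕₚ.≤-trans (s≤s w′≤2) 3≤D)
          where
          w′≤2 : δ x w′ ≤ 2
          w′≤2 = ℕₚ.≤-trans (δ-step x e′) (s≤s (ℕₚ.≤-trans (δ-step x (~-sym e))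
            (s≤s (ℕₚ.≤-pred (ℕₚ.≰⇒> ¬pos)))))

    Fork : Set
    Fork = ∃ λ x → ∃ λ a → ∃ λ b → a ≢ b × δ x a ≡ D × δ x b ≡ D

    -- If the pairs are disjoint, `u` and `v` cannot both lie on the path from `x` to `y`, where
    -- they would be too close, nor both off it, where there is room for one vertex. The one off the
    -- path is then at distance `D` from `x` or `y` by `off-near`, so a third far pair provides the
    -- fork.
    two-far⇒Fork : ∀ {x y u v} → δ x y ≡ D → δ u v ≡ D → ¬ (u ≡ x × v ≡ y) → ¬ (u ≡ y × v ≡ x) → Fork
    two-far⇒Fork {x} {y} {u} {v} xy uv ¬same ¬swap with u Fin.≟ x | u Fin.≟ y | v Fin.≟ x | v Fin.≟ y
    ... | yes refl | _ | _ | _ = x , y , v , (λ eq → ¬same (refl , sym eq)) , xy , uv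
    ... | no _ | yes refl | _ | _ = y , x , v , (λ eq → ¬swap (refl , sym eq)) , trans (δ-sym y x) xy , uv
    ... | no _ | no u≢y | yes refl | _ = x , y , u , (λ eq → u≢y (sym eq)) , xy , trans (δ-sym x u) uv
    ... | no u≢x | no _ | no _ | yes refl = y , x , u , (λ eq → u≢x (sym eq)) , trans (δ-sym y x) xy , trans (δ-sym y u) uv
    ... | no u≢x | no u≢y | no v≢x | no v≢y = cases (On? u) (On? v)
      where
      open Diametral xy
      open OffPath xy
      fork-at : ∀ {q w} → ¬ On q → On w → w ≢ x → w ≢ y → q ≢ x → q ≢ y → δ q w ≡ D → Fork
      fork-at {q} {w} ¬q hw w≢x w≢y q≢x q≢y qw with δ x q ℕ.≟ D | δ y q ℕ.≟ D
      ... | yes xq | _      = x , y , q , (λ eq → q≢y (sym eq)) , xy , xq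
      ... | no _   | yes yq = y , x , q , (λ eq → q≢x (sym eq)) , trans (δ-sym y x) xy , yq
      ... | no xq  | no yq  = contradiction (off-near ¬q hw w≢x w≢y xq yq) (ℕₚ.≤⇒≯ (ℕₚ.≤-reflexive (sym qw)))
      close-on : ∀ {a b} → On a → On b → a ≢ x → δ x a ≤ δ x b → δ a b < D
      close-on {a} {b} ha hb a≢x le = ℕₚ.≤-trans (s≤s (On-dist ha hb le)) (ℕₚ.≤-trans (∸-< (δ-pos (λ eq → a≢x (sym eq))) le) (diam x b))
      cases : Dec (On u) → Dec (On v) → Fork
      cases (yes hu) (yes hv) with ℕₚ.≤-total (δ x u) (δ x v)
      ... | inj₁ le = contradiction (close-on hu hv u≢x le) (ℕₚ.≤⇒≯ (ℕₚ.≤-reflexive (sym uv)))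
      ... | inj₂ ge = contradiction (close-on hv hu v≢x ge) (ℕₚ.≤⇒≯ (ℕₚ.≤-reflexive (sym (trans (δ-sym v u) uv))))
      cases (no ¬u) (yes hv) = fork-at ¬u hv v≢x v≢y u≢x u≢y uv
      cases (yes hu) (no ¬v) = fork-at ¬v hu u≢x u≢y v≢x v≢y (trans (δ-sym v u) uv)
      cases (no ¬u) (no ¬v)  = contradiction (trans (sym uv) (trans (cong (δ u) (sym (off-unique ¬u ¬v))) (δ-refl u)))
        (λ D≡0 → contradiction (subst (3 ≤_) D≡0 3≤D) λ ())

    -- The path from `x` to `b` misses only `a`, so around `x` all levels below `D` are singletons
    -- and level `D` consists of `a` and `b`. The labels count from the top: 0 for `a`, 1 for `b`,
    -- and so on down to `x`.
    Fork⇒G3n : Fork → G ≅ G3n n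
    Fork⇒G3n (x , a , b , a≢b , xa , xb) = Labelling⇒≅ G (σ , λ u v →
        (λ e → subst₂ (λ i j → Path△ i j ⊎ Path△ j i) (sym (σ-label u)) (sym (σ-label v)) (edge⇒path u v e))
      , (λ h → path⇒edge u v (subst₂ Path△ (σ-label u) (σ-label v) h)))
      where
      open Diametral xb
      open CycleNeighbours G C C-isCycle
      open RelabelG3 {n} (subst (3 ≤_) (sym n≡) (ℕₚ.≤-trans 3≤D (ℕₚ.≤-trans (ℕₚ.n≤1+n D) (ℕₚ.n≤1+n (suc D)))))

      ¬On-a : ¬ On a
      ¬On-a h = a≢b (On-injective h On-y (trans xa (sym xb)))

      on : ∀ {u} → u ≢ a → On u
      on {u} u≢a = decidable-stable (On? u) (λ ¬u → u≢a (off-unique ¬u ¬On-a))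

      single : ∀ {u v} → u ≢ a → v ≢ a → δ x u ≡ δ x v → u ≡ v
      single u≢a v≢a = On-injective (on u≢a) (on v≢a)

      low : ∀ {u} → δ x u < D → u ≢ a
      low lt refl = ℕₚ.<-irrefl xa lt

      top : ∀ {u} → δ x u ≡ D → u ≡ a ⊎ u ≡ b
      top {u} h with u Fin.≟ a
      ... | yes eq = inj₁ eq
      ... | no u≢a = inj₂ (single u≢a (λ eq → a≢b (sym eq)) (trans h (sym xb)))

      -- Levels below D are singletons, so one of the two cycle neighbours is one level further up.
      climb : ∀ k {u w} → k + δ x u ≡ D → C u w ≡ true → ∃ λ u′ → δ x u′ ≡ D × ∃ λ w → C u′ w ≡ true
      climb zero    {u} {w} h e = u , h , w , e
      climb (suc k) {u} h e with cycle-neighbours e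
      ... | p , q , p≢q , up , uq = choose (level up) (level uq)
        where
        u<D : δ x u < D
        u<D = subst (suc (δ x u) ≤_) h (s≤s (ℕₚ.m≤n+m (δ x u) k))
        level : ∀ {w} → C u w ≡ true → δ x w ≡ suc (δ x u) ⊎ (w ≢ a × suc (δ x w) ≡ δ x u)
        level {w} s with ℕₚ.<-cmp (δ x w) (δ x u)
        ... | tri< lt _ _ = inj₂ (low (ℕₚ.<-trans lt u<D) , ℕₚ.≤-antisym lt (δ-step x (~-sym (cycle-adj s))))
        ... | tri≈ _ eq _ = contradiction (sym (single (low (subst (_< D) (sym eq) u<D)) (low u<D) eq)) (~⇒≢ (cycle-adj s))
        ... | tri> _ _ gt = inj₁ (ℕₚ.≤-antisym (δ-step x (cycle-adj s)) gt)
        up-from : ∀ {w} → C u w ≡ true → δ x w ≡ suc (δ x u) → ∃ λ u′ → δ x u′ ≡ D × ∃ λ w → C u′ w ≡ true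
        up-from s eq = climb k (trans (cong (k +_) eq) (trans (ℕₚ.+-suc k (δ x u)) h)) (cycle-sym s)
        choose : _ → _ → ∃ λ u′ → δ x u′ ≡ D × ∃ λ w → C u′ w ≡ true
        choose (inj₁ eq) _ = up-from up eq
        choose (inj₂ _) (inj₁ eq) = up-from uq eq
        choose (inj₂ (p≢a , hp)) (inj₂ (q≢a , hq)) =
          contradiction (single p≢a q≢a (ℕₚ.suc-injective (trans hp (sym hq)))) p≢q

      -- A cycle vertex on level `D` has two cycle neighbours, but level `D - 1` holds only one
      -- vertex, so the other neighbour is on level `D` as well.
      a~b : a ~ b
      a~b = let (u , _ , e) = cycle-edge in finish (climb (D ∸ δ x u) (ℕₚ.m∸n+n≡m (diam x u)) e)
        where
        level : ∀ {u w} → δ x u ≡ D → C u w ≡ true → δ x w ≡ D ⊎ (w ≢ a × suc (δ x w) ≡ D)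
        level {u} {w} h s with ℕₚ.m≤n⇒m<n∨m≡n (diam x w)
        ... | inj₂ eq = inj₁ eq
        ... | inj₁ lt = inj₂ (low lt , ℕₚ.≤-antisym lt (subst (_≤ suc (δ x w)) h (δ-step x (~-sym (cycle-adj s)))))
        pair : ∀ {u w} → δ x u ≡ D → C u w ≡ true → δ x w ≡ D → a ~ b
        pair hu s hw with top hu | top hw
        ... | inj₁ refl | inj₂ refl = cycle-adj s
        ... | inj₂ refl | inj₁ refl = ~-sym (cycle-adj s)
        ... | inj₁ refl | inj₁ refl = contradiction refl (~⇒≢ (cycle-adj s))
        ... | inj₂ refl | inj₂ refl = contradiction refl (~⇒≢ (cycle-adj s))
        finish : (∃ λ u′ → δ x u′ ≡ D × ∃ λ w → C u′ w ≡ true) → a ~ b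
        finish (u , hu , w , e) with cycle-neighbours e
        ... | p , q , p≢q , up , uq with level hu up | level hu uq
        ... | inj₁ hp | _       = pair hu up hp
        ... | inj₂ _  | inj₁ hq = pair hu uq hq
        ... | inj₂ (p≢a , hp) | inj₂ (q≢a , hq) =
          contradiction (single p≢a q≢a (ℕₚ.suc-injective (trans hp (sym hq)))) p≢q

      label : Fin n → ℕ
      label u with u Fin.≟ a
      ... | yes _ = 0
      ... | no _  = suc (D ∸ δ x u)

      label-a : label a ≡ 0
      label-a with a Fin.≟ a
      ... | yes _  = refl
      ... | no a≢a = contradiction refl a≢a

      label-≢a : ∀ {u} → u ≢ a → label u ≡ suc (D ∸ δ x u)
      label-≢a {u} u≢a with u Fin.≟ a
      ... | yes u≡a = contradiction u≡a u≢a
      ... | no _    = refl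

      complement-suc : ∀ {i j} → i ≤ D → j ≤ D → D ∸ i ≡ suc (D ∸ j) → j ≡ suc i
      complement-suc {i} {j} i≤ j≤ eq = ℕₚ.+-cancelʳ-≡ (D ∸ j) j (suc i) (trans (ℕₚ.m+[n∸m]≡n j≤)
        (trans (sym (ℕₚ.m+[n∸m]≡n i≤)) (trans (cong (i +_) eq) (ℕₚ.+-suc i (D ∸ j)))))

      label-< : ∀ u → label u < n
      label-< u with u Fin.≟ a
      ... | yes _ = subst (0 <_) (sym n≡) (s≤s z≤n)
      ... | no _  = subst (suc (D ∸ δ x u) <_) (sym n≡) (s≤s (s≤s (ℕₚ.m∸n≤m D (δ x u))))

      label-injective : ∀ {u v} → label u ≡ label v → u ≡ v
      label-injective {u} {v} eq with u Fin.≟ a | v Fin.≟ a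
      ... | yes p | yes q = trans p (sym q)
      ... | no p  | no q  = single p q (ℕₚ.∸-cancelˡ-≡ (diam x u) (diam x v) (ℕₚ.suc-injective eq))

      labelᶠ : Fin n → Fin n
      labelᶠ u = fromℕ< (label-< u)

      labelling = injective⇒↔ labelᶠ (λ {u} {v} eq → label-injective
        (trans (sym (Finₚ.toℕ-fromℕ< (label-< u))) (trans (cong toℕ eq) (Finₚ.toℕ-fromℕ< (label-< v)))))

      σ = proj₁ labelling

      σ-label : ∀ u → toℕ (Inverse.to σ u) ≡ label u
      σ-label u = trans (cong toℕ (proj₂ labelling u)) (Finₚ.toℕ-fromℕ< (label-< u))

      label-step : ∀ {u v} → u ≢ a → v ≢ a → δ x v ≡ suc (δ x u) → label u ≡ suc (label v)
      label-step {u} {v} u≢a v≢a eq = trans (label-≢a u≢a) (cong suc (trans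
        (trans (ℕₚ.+-∸-assoc 1 {D} (subst (_≤ D) eq (diam x v))) (cong (λ i → suc (D ∸ i)) (sym eq)))
        (sym (label-≢a v≢a))))

      a-edge : ∀ v → a ~ v → Path△ (label a) (label v)
      a-edge v e with ℕₚ.m≤n⇒m<n∨m≡n (diam x v)
      ... | inj₂ eq = inj₁ (trans (label-≢a v≢a) (cong suc (trans (cong (D ∸_) eq) (trans (ℕₚ.n∸n≡0 D) (sym label-a)))))
        where
        v≢a : v ≢ a
        v≢a v≡a = ~⇒≢ e (sym v≡a)
      ... | inj₁ lt = inj₂ (label-a , trans (label-≢a (low lt)) (cong suc (trans (cong (_∸ δ x v) (sym sv))
          (ℕₚ.m+n∸n≡m 1 (δ x v)))))
        where
        sv : suc (δ x v) ≡ D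
        sv = ℕₚ.≤-antisym lt (subst (_≤ suc (δ x v)) xa (δ-step x (~-sym e)))

      edge⇒path : ∀ u v → u ~ v → Path△ (label u) (label v) ⊎ Path△ (label v) (label u)
      edge⇒path u v e = go (u Fin.≟ a) (v Fin.≟ a)
        where
        go : Dec (u ≡ a) → Dec (v ≡ a) → Path△ (label u) (label v) ⊎ Path△ (label v) (label u)
        go (yes refl) _ = inj₁ (a-edge v e)
        go (no _) (yes refl) = inj₂ (a-edge u (~-sym e))
        go (no u≢a) (no v≢a) with ℕₚ.<-cmp (δ x u) (δ x v)
        ... | tri< lt _ _ = inj₂ (inj₁ (label-step u≢a v≢a (ℕₚ.≤-antisym (δ-step x e) lt)))
        ... | tri≈ _ eq _ = contradiction (single u≢a v≢a eq) (~⇒≢ e)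
        ... | tri> _ _ gt = inj₁ (inj₁ (label-step v≢a u≢a (ℕₚ.≤-antisym (δ-step x (~-sym e)) gt)))

      below-~ : ∀ {u v} → u ≢ a → δ x v ≡ suc (δ x u) → u ~ v
      below-~ {u} {v} u≢a eq with δ-pred eq
      ... | w , xw , e = subst (_~ v)
        (single (low (subst (_< D) (sym xw) (subst (_≤ D) eq (diam x v)))) u≢a xw) e

      path⇒edge : ∀ u v → Path△ (label u) (label v) → u ~ v
      path⇒edge u v h = go (u Fin.≟ a) (v Fin.≟ a) h
        where
        go : Dec (u ≡ a) → Dec (v ≡ a) → Path△ (label u) (label v) → u ~ v
        go _ (yes refl) (inj₁ eq) = contradiction (trans (sym label-a) eq) λ ()
        go _ (yes refl) (inj₂ (_ , eq)) = contradiction (trans (sym label-a) eq) λ ()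
        go (yes refl) (no v≢a) (inj₁ eq) = subst (a ~_) (single (λ b≡a → a≢b (sym b≡a)) v≢a (trans xb (sym
          (ℕₚ.∸-cancelˡ-≡ (diam x v) ℕₚ.≤-refl
            (trans (ℕₚ.suc-injective (trans (sym (label-≢a v≢a)) (trans eq (cong suc label-a)))) (sym (ℕₚ.n∸n≡0 D))))))) a~b
        go (yes refl) (no v≢a) (inj₂ (_ , eq)) = ~-sym (below-~ v≢a (trans xa (complement-suc (diam x v) ℕₚ.≤-refl
          (trans (ℕₚ.suc-injective (trans (sym (label-≢a v≢a)) eq)) (cong suc (sym (ℕₚ.n∸n≡0 D)))))))
        go (no u≢a) (no v≢a) (inj₁ eq) = ~-sym (below-~ v≢a (complement-suc (diam x v) (diam x u)
          (ℕₚ.suc-injective (trans (sym (label-≢a v≢a)) (trans eq (cong suc (label-≢a u≢a)))))))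
        go (no u≢a) (no v≢a) (inj₂ (eq , _)) = contradiction (trans (sym (label-≢a u≢a)) eq) λ ()

  -- Summation by parts in an ordered abelian group.

  far : List X → (X → ℕ) → ℕ → ℕ
  far xs d t = ∑ xs (λ x → ⟦ t ℕ.<? d x ⟧)

  ∑≤+far : (xs : List X) (d : X → ℕ) (t : ℕ) → ∑ xs (λ x → ⟦ d x ℕ.≤? t ⟧) + far xs d t ≡ length xs
  ∑≤+far xs d t = trans (sym (∑-+ xs _ _)) (trans (∑-cong xs (λ x _ → split (d x))) (∑-one xs))
    where
    split : ∀ k → ⟦ k ℕ.≤? t ⟧ + ⟦ t ℕ.<? k ⟧ ≡ 1
    split k with k ℕ.≤? t
    ... | yes k≤t = cong suc (⟦⟧-no (t ℕ.<? k) (ℕₚ.≤⇒≯ k≤t))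
    ... | no k≰t  = ⟦⟧-yes (t ℕ.<? k) (ℕₚ.≰⇒> k≰t)

  module GroupSums {c ℓ : Level} (A : OrderedAbelianGroup c ℓ) where

    private
      module A = OrderedAbelianGroup A
      module <ᴬ = IsStrictTotalOrder A.isStrictTotalOrder
    open A using (Carrier; 0#; _·_) renaming (_+_ to _⊕_; -_ to ⊖_; _<_ to _<ᴬ_; _≤_ to _≤ᴬ_)
    open IsAbelianGroup A.isAbelianGroup using (assoc; comm; identityˡ; identityʳ; inverseˡ; inverseʳ)

    ⊕-interchange : ∀ a b c d → (a ⊕ b) ⊕ (c ⊕ d) ≡ (a ⊕ c) ⊕ (b ⊕ d)
    ⊕-interchange a b c d = trans (assoc a b (c ⊕ d))
      (trans (cong (a ⊕_) (trans (sym (assoc b c d)) (trans (cong (_⊕ d) (comm b c)) (assoc c b d)))) (sym (assoc a c (b ⊕ d))))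

    ⊕-monoˡ-≤ : ∀ {x y} z → x ≤ᴬ y → (x ⊕ z) ≤ᴬ (y ⊕ z)
    ⊕-monoˡ-≤ z (inj₁ lt) = inj₁ (A.+-mono-< z lt)
    ⊕-monoˡ-≤ z (inj₂ eq) = inj₂ (cong (_⊕ z) eq)

    ⊕-monoʳ-< : ∀ {x y} z → x <ᴬ y → (z ⊕ x) <ᴬ (z ⊕ y)
    ⊕-monoʳ-< {x} {y} z lt = subst₂ _<ᴬ_ (comm x z) (comm y z) (A.+-mono-< z lt)

    ≤-<-trans : ∀ {x y z} → x ≤ᴬ y → y <ᴬ z → x <ᴬ z
    ≤-<-trans (inj₁ lt)   lt′ = <ᴬ.trans lt lt′
    ≤-<-trans (inj₂ refl) lt′ = lt′

    ·-+ : ∀ k l x → (k + l) · x ≡ (k · x) ⊕ (l · x)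
    ·-+ zero    l x = sym (identityˡ (l · x))
    ·-+ (suc k) l x = trans (cong (x ⊕_) (·-+ k l x)) (sym (assoc x (k · x) (l · x)))

    ·-mono-< : ∀ {x k l} → 0# <ᴬ x → k < l → (k · x) <ᴬ (l · x)
    ·-mono-< {x} {zero}  {suc zero}    0<x _ = subst (0# <ᴬ_) (sym (identityʳ x)) 0<x
    ·-mono-< {x} {zero}  {suc (suc l)} 0<x _ = <ᴬ.trans (·-mono-< {x} {zero} {suc l} 0<x (s≤s z≤n))
      (subst (_<ᴬ (x ⊕ (suc l · x))) (identityˡ (suc l · x)) (A.+-mono-< (suc l · x) 0<x))
    ·-mono-< {x} {suc k} {suc l} 0<x (s≤s k<l) = ⊕-monoʳ-< x (·-mono-< 0<x k<l)

    ∑ᴬ : List X → (X → Carrier) → Carrier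
    ∑ᴬ xs f = foldr (λ x acc → f x ⊕ acc) 0# xs

    ∑ᴬ-cong : (xs : List X) {f g : X → Carrier} → (∀ x → x ∈ xs → f x ≡ g x) → ∑ᴬ xs f ≡ ∑ᴬ xs g
    ∑ᴬ-cong []       h = refl
    ∑ᴬ-cong (x ∷ xs) h = cong₂ _⊕_ (h x (here refl)) (∑ᴬ-cong xs (λ y y∈ → h y (there y∈)))

    ∑ᴬ-+ : (xs : List X) (f g : X → Carrier) → ∑ᴬ xs (λ x → f x ⊕ g x) ≡ ∑ᴬ xs f ⊕ ∑ᴬ xs g
    ∑ᴬ-+ []       f g = sym (identityˡ 0#)
    ∑ᴬ-+ (x ∷ xs) f g = trans (cong ((f x ⊕ g x) ⊕_) (∑ᴬ-+ xs f g)) (⊕-interchange _ _ _ _)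

    ∑ᴬ-· : (xs : List X) (k : X → ℕ) (a : Carrier) → ∑ᴬ xs (λ x → k x · a) ≡ ∑ xs k · a
    ∑ᴬ-· []       k a = refl
    ∑ᴬ-· (x ∷ xs) k a = trans (cong ((k x · a) ⊕_) (∑ᴬ-· xs k a)) (sym (·-+ (k x) (∑ xs k) a))

    ∑ᴬ-const : (xs : List X) (a : Carrier) → ∑ᴬ xs (λ _ → a) ≡ length xs · a
    ∑ᴬ-const []       a = refl
    ∑ᴬ-const (x ∷ xs) a = cong (a ⊕_) (∑ᴬ-const xs a)

    ∑ᴬ-++ : (xs ys : List X) (f : X → Carrier) → ∑ᴬ (xs ++ ys) f ≡ ∑ᴬ xs f ⊕ ∑ᴬ ys f
    ∑ᴬ-++ []       ys f = sym (identityˡ _)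
    ∑ᴬ-++ (x ∷ xs) ys f = trans (cong (f x ⊕_) (∑ᴬ-++ xs ys f)) (sym (assoc _ _ _))

    ∑ᴬ-concatMap : (g : Y → List X) (ys : List Y) (f : X → Carrier) → ∑ᴬ (concatMap g ys) f ≡ ∑ᴬ ys (λ y → ∑ᴬ (g y) f)
    ∑ᴬ-concatMap g []       f = refl
    ∑ᴬ-concatMap g (y ∷ ys) f = trans (∑ᴬ-++ (g y) _ f) (cong (∑ᴬ (g y) f ⊕_) (∑ᴬ-concatMap g ys f))

    ∑ᴬ-replicate : ∀ k (x : X) (f : X → Carrier) → ∑ᴬ (replicate k x) f ≡ k · f x
    ∑ᴬ-replicate zero    x f = refl
    ∑ᴬ-replicate (suc k) x f = cong (f x ⊕_) (∑ᴬ-replicate k x f)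

    module Increasing (h : ℕ → Carrier) (inc : StrictlyIncreasing A h) where

      gap : ℕ → Carrier
      gap M = h (suc M) ⊕ (⊖ h M)

      gap-pos : ∀ M → 1 ≤ M → 0# <ᴬ gap M
      gap-pos M 1≤M = subst (_<ᴬ gap M) (inverseʳ (h M)) (A.+-mono-< (⊖ h M) (inc M (suc M) 1≤M (ℕₚ.n<1+n M)))

      -- Summation by parts, one level at a time: raising the truncation from `M` to `suc M` adds
      -- `gap M` once for each element beyond `M`, and at truncation 1 only the length of the list
      -- matters.
      clipped : ℕ → List X → (X → ℕ) → Carrier
      clipped M xs d = ∑ᴬ xs (λ x → h (d x ⊓ M))

      clipped-suc : ∀ M (xs : List X) d → clipped (suc M) xs d ≡ clipped M xs d ⊕ (far xs d M · gap M)
      clipped-suc M xs d = trans (∑ᴬ-cong xs (λ x _ → one (d x)))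
        (trans (∑ᴬ-+ xs _ _) (cong (clipped M xs d ⊕_) (∑ᴬ-· xs _ (gap M))))
        where
        one : ∀ k → h (k ⊓ suc M) ≡ h (k ⊓ M) ⊕ (⟦ M ℕ.<? k ⟧ · gap M)
        one k with M ℕ.<? k
        ... | yes M<k = trans (cong h (ℕₚ.m≥n⇒m⊓n≡n M<k)) (sym (trans
          (cong₂ _⊕_ (cong h (ℕₚ.m≥n⇒m⊓n≡n (ℕₚ.<⇒≤ M<k))) (trans (identityʳ (gap M)) (comm _ _)))
          (trans (sym (assoc (h M) (⊖ h M) (h (suc M)))) (trans (cong (_⊕ h (suc M)) (inverseʳ (h M))) (identityˡ _)))))
        ... | no M≮k  = let k≤M = ℕₚ.≮⇒≥ M≮k in
          trans (cong h (trans (ℕₚ.m≤n⇒m⊓n≡m (ℕₚ.m≤n⇒m≤1+n k≤M)) (sym (ℕₚ.m≤n⇒m⊓n≡m k≤M)))) (sym (identityʳ _))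

      clipped-full : ∀ M (xs : List X) d → (∀ x → x ∈ xs → d x ≤ M) → clipped M xs d ≡ ∑ᴬ xs (h ∘ d)
      clipped-full M xs d d≤ = ∑ᴬ-cong xs (λ x x∈ → cong h (ℕₚ.m≤n⇒m⊓n≡m (d≤ x x∈)))

      clipped-1 : (xs : List X) (d : X → ℕ) → (∀ x → x ∈ xs → 1 ≤ d x) → clipped 1 xs d ≡ length xs · h 1
      clipped-1 xs d 1≤d = trans (∑ᴬ-cong xs (λ x x∈ → cong h (ℕₚ.m≥n⇒m⊓n≡n (1≤d x x∈)))) (∑ᴬ-const xs (h 1))

      module _ (xs : List X) (d : X → ℕ) (ys : List Y) (e : Y → ℕ) (len : length xs ≡ length ys)
               (1≤d : ∀ x → x ∈ xs → 1 ≤ d x) (1≤e : ∀ y → y ∈ ys → 1 ≤ e y) where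

        -- Lists of equal length agree at truncation 1. As every gap is positive, one strict
        -- inequality between the counts makes the sums differ for good. The equal counts are kept
        -- in the second alternative because the equality cases start from them.
        clipped-compare : (∀ t → 1 ≤ t → far xs d t ≤ far ys e t) → ∀ k →
          (clipped (suc k) xs d <ᴬ clipped (suc k) ys e) ⊎
          (clipped (suc k) xs d ≡ clipped (suc k) ys e × (∀ t → 1 ≤ t → t ≤ k → far xs d t ≡ far ys e t))
        clipped-compare far≤ zero = inj₂
          ( trans (clipped-1 xs d 1≤d) (trans (cong (_· h 1) len) (sym (clipped-1 ys e 1≤e)))
          , λ { zero () _ ; (suc t) _ () })
        clipped-compare far≤ (suc k)
          with clipped-compare far≤ k | ℕₚ.m≤n⇒m<n∨m≡n (far≤ (suc k) (s≤s z≤n))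
        ... | previous | inj₁ lt = inj₁ (subst₂ _<ᴬ_ (sym (clipped-suc (suc k) xs d)) (sym (clipped-suc (suc k) ys e))
            (≤-<-trans (⊕-monoˡ-≤ _ ([ inj₁ , inj₂ ∘ proj₁ ]′ previous)) (⊕-monoʳ-< _ (·-mono-< (gap-pos (suc k) (s≤s z≤n)) lt))))
        ... | inj₁ lt | inj₂ eq = inj₁ (subst₂ _<ᴬ_ (sym (clipped-suc (suc k) xs d))
            (trans (cong (λ m → clipped (suc k) ys e ⊕ (m · gap (suc k))) eq) (sym (clipped-suc (suc k) ys e)))
            (A.+-mono-< _ lt))
        ... | inj₂ (same , fars) | inj₂ eq = inj₂
            ( trans (clipped-suc (suc k) xs d) (trans (cong₂ (λ a m → a ⊕ (m · gap (suc k))) same eq) (sym (clipped-suc (suc k) ys e)))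
            , λ t 1≤t t≤ → [ (λ lt → fars t 1≤t (ℕₚ.≤-pred lt)) , (λ { refl → eq }) ]′ (ℕₚ.m≤n⇒m<n∨m≡n t≤) )

        compare : ∀ M → (∀ x → x ∈ xs → d x ≤ suc M) → (∀ y → y ∈ ys → e y ≤ suc M) →
          (∀ t → 1 ≤ t → far xs d t ≤ far ys e t) →
          (∑ᴬ xs (h ∘ d) <ᴬ ∑ᴬ ys (h ∘ e)) ⊎
          (∑ᴬ xs (h ∘ d) ≡ ∑ᴬ ys (h ∘ e) × (∀ t → 1 ≤ t → t ≤ M → far xs d t ≡ far ys e t))
        compare M d≤ e≤ far≤ = subst₂ (λ a b → (a <ᴬ b) ⊎ (a ≡ b × (∀ t → 1 ≤ t → t ≤ M → far xs d t ≡ far ys e t)))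
          (clipped-full (suc M) xs d d≤) (clipped-full (suc M) ys e e≤) (clipped-compare far≤ M)

  -- The distance lists of J_n and G_{3,n}.

  -- The added term is the number of pairs at distance exactly `suc t` on a path with `n` vertices.
  tri-suc : ∀ t n → tri (suc t) n ≡ tri t n + (n ∸ suc t)
  tri-suc t zero    = refl
  tri-suc t (suc n) = begin
    tri (suc t) n + suc t ⊓ n
      ≡⟨ cong (_+ suc t ⊓ n) (tri-suc t n) ⟩
    (tri t n + (n ∸ suc t)) + suc t ⊓ n
      ≡⟨ ℕₚ.+-assoc (tri t n) _ _ ⟩
    tri t n + ((n ∸ suc t) + suc t ⊓ n)
      ≡⟨ cong (tri t n +_) (trans (ℕₚ.+-comm _ (suc t ⊓ n)) (trans (ℕₚ.m⊓n+n∸m≡n (suc t) n) (sym (ℕₚ.m⊓n+n∸m≡n t n)))) ⟩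
    tri t n + (t ⊓ n + (n ∸ t))
      ≡⟨ sym (ℕₚ.+-assoc (tri t n) _ _) ⟩
    tri t (suc n) + (n ∸ t) ∎
    where open ≡-Reasoning

  tri-0 : ∀ n → tri 0 n ≡ 0
  tri-0 zero    = refl
  tri-0 (suc n) = trans (ℕₚ.+-identityʳ (tri 0 n)) (tri-0 n)

  2*tri : ∀ N n → n ≤ suc N → 2 * tri N n ≡ n * (n ∸ 1)
  2*tri N zero    _         = refl
  2*tri N (suc n) (s≤s n≤N) = trans (ℕₚ.*-distribˡ-+ 2 (tri N n) (N ⊓ n))
    (trans (cong₂ _+_ (2*tri N n (ℕₚ.m≤n⇒m≤1+n n≤N)) (cong (2 *_) (ℕₚ.m≥n⇒m⊓n≡n n≤N))) (square n))
    where
    square : ∀ n → n * (n ∸ 1) + 2 * n ≡ suc n * n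
    square zero    = refl
    square (suc k) = solve 1 (λ k → (con 1 :+ k) :* k :+ con 2 :* (con 1 :+ k) := (con 2 :+ k) :* (con 1 :+ k)) refl k
      where open +-*-Solver

  length-pairs : ∀ n → length (pairs {n}) ≡ tri (n ∸ 1) n
  length-pairs n = ℕₚ.*-cancelˡ-≡ _ _ 2 (begin
    2 * length (pairs {n})
      ≡⟨ cong (2 *_) (trans (sym (∑-one (pairs {n}))) (∑-cong (pairs {n}) (λ (u , v) p∈ →
           sym (⟦⟧-yes (¬? (u Fin.≟ v)) (λ u≡v → ℕₚ.<-irrefl (cong toℕ u≡v) (pairs-< p∈)))))) ⟩
    2 * ∑ (pairs {n}) (λ p → ⟦ ¬? (proj₁ p Fin.≟ proj₂ p) ⟧)
      ≡⟨ 2*∑-pairs {n} (λ u v → ⟦ ¬? (u Fin.≟ v) ⟧)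
           (λ u v → ⟦⟧-cong (¬? (u Fin.≟ v)) (¬? (v Fin.≟ u)) (λ h eq → h (sym eq)) (λ h eq → h (sym eq)))
           (λ u → ⟦⟧-no (¬? (u Fin.≟ u)) (λ h → h refl)) ⟩
    ∑∑ {n} (λ u v → ⟦ ¬? (u Fin.≟ v) ⟧)
      ≡⟨ ∑ᶠ-cong {n} row ⟩
    ∑ᶠ {n} (λ _ → n ∸ 1)
      ≡⟨ trans (∑-const (allFin n) (n ∸ 1)) (cong (_* (n ∸ 1)) (length-all {n})) ⟩
    n * (n ∸ 1)
      ≡⟨ sym (2*tri (n ∸ 1) n (ℕₚ.m≤n+m∸n n 1)) ⟩
    2 * tri (n ∸ 1) n ∎)
    where
    open ≡-Reasoning
    row : ∀ (u : Fin n) → ∑ᶠ (λ v → ⟦ ¬? (u Fin.≟ v) ⟧) ≡ n ∸ 1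
    row u = trans (sym (ℕₚ.m+n∸m≡n 1 _)) (cong (_∸ 1) (trans (cong (_+ ∑ᶠ (λ v → ⟦ ¬? (u Fin.≟ v) ⟧)) (sym (∑ᶠ-point₂ u)))
      (trans (sym (∑-+ (allFin n) (λ v → ⟦ u Fin.≟ v ⟧) _)) (trans (∑ᶠ-cong (λ v → ⟦⟧+⟦¬⟧ (u Fin.≟ v))) (∑ᶠ-one {n})))))

  ∑-replicate : ∀ k (x : X) f → ∑ (replicate k x) f ≡ k * f x
  ∑-replicate zero    x f = refl
  ∑-replicate (suc k) x f = cong (f x +_) (∑-replicate k x f)

  ∈-replicate : ∀ k {x y : X} → y ∈ replicate k x → y ≡ x
  ∈-replicate (suc k) (here refl) = refl
  ∈-replicate (suc k) (there y∈)  = ∈-replicate k y∈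

  -- The distances in J_n and in G_{3,n} (for n = D + 2), with multiplicity.
  distancesJ : ℕ → List ℕ
  distancesJ n = replicate n 1 ++ replicate (n * (n ∸ 3) ℕ./ 2) 2

  distancesG3 : ℕ → List ℕ
  distancesG3 D = replicate (2 + D) 1 ++ concatMap (λ j → replicate (2 + D ∸ j) j) (map (2 +_) (upTo (D ∸ 1)))

  module _ {c ℓ : Level} (A : OrderedAbelianGroup c ℓ) where

    open GroupSums A

    LowJ-sum : ∀ h n → LowJ A h n ≡ ∑ᴬ (distancesJ n) h
    LowJ-sum h n = sym (trans (∑ᴬ-++ (replicate n 1) _ h)
      (cong₂ (OrderedAbelianGroup._+_ A) (∑ᴬ-replicate n 1 h) (∑ᴬ-replicate (n * (n ∸ 3) ℕ./ 2) 2 h)))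

    F3-sum : ∀ h D → F3 A h (2 + D) ≡ ∑ᴬ (distancesG3 D) h
    F3-sum h D = sym (trans (∑ᴬ-++ (replicate (2 + D) 1) _ h)
      (cong₂ (OrderedAbelianGroup._+_ A) (∑ᴬ-replicate (2 + D) 1 h)
        (trans (∑ᴬ-concatMap _ (map (2 +_) (upTo (D ∸ 1))) h) (∑ᴬ-cong (map (2 +_) (upTo (D ∸ 1))) (λ j _ → ∑ᴬ-replicate (2 + D ∸ j) j h)))))

  far-suc : (xs : List X) (d : X → ℕ) (t : ℕ) → far xs d t ≡ far xs d (suc t) + ∑ xs (λ x → ⟦ d x ℕ.≟ suc t ⟧)
  far-suc xs d t = trans (∑-cong xs (λ x _ → split (d x))) (∑-+ xs _ _)
    where
    split : ∀ k → ⟦ t ℕ.<? k ⟧ ≡ ⟦ suc t ℕ.<? k ⟧ + ⟦ k ℕ.≟ suc t ⟧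
    split k with ℕₚ.<-cmp (suc t) k
    ... | tri< lt k≢ _ = trans (⟦⟧-yes (t ℕ.<? k) (ℕₚ.<⇒≤ lt))
      (sym (cong₂ _+_ (⟦⟧-yes (suc t ℕ.<? k) lt) (⟦⟧-no (k ℕ.≟ suc t) (λ eq → k≢ (sym eq)))))
    ... | tri≈ nlt refl _ = trans (⟦⟧-yes (t ℕ.<? k) (ℕₚ.n<1+n t))
      (sym (cong₂ _+_ (⟦⟧-no (suc t ℕ.<? k) nlt) (⟦⟧-yes (k ℕ.≟ suc t) refl)))
    ... | tri> nlt k≢ (s≤s gt) = trans (⟦⟧-no (t ℕ.<? k) (ℕₚ.≤⇒≯ gt))
      (sym (cong₂ _+_ (⟦⟧-no (suc t ℕ.<? k) nlt) (⟦⟧-no (k ℕ.≟ suc t) (λ eq → k≢ (sym eq)))))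

  far-zero : (xs : List X) (d : X → ℕ) (t : ℕ) → (∀ x → x ∈ xs → d x ≤ t) → far xs d t ≡ 0
  far-zero xs d t d≤ = ∑-zero xs (λ x x∈ → ⟦⟧-no (t ℕ.<? d x) (ℕₚ.≤⇒≯ (d≤ x x∈)))

  far-all : (xs : List X) (d : X → ℕ) (t : ℕ) → (∀ x → x ∈ xs → t < d x) → far xs d t ≡ length xs
  far-all xs d t t< = trans (∑-cong xs (λ x x∈ → ⟦⟧-yes (t ℕ.<? d x) (t< x x∈))) (∑-one xs)

  ∑ᴺ-select-out : ∀ m k (c : ℕ → ℕ) → m ≤ k → ∑ᴺ m (λ i → c i * ⟦ i ℕ.≟ k ⟧) ≡ 0
  ∑ᴺ-select-out m k c m≤k = ∑-zero (upTo m) (λ i i∈ → trans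
    (cong (c i *_) (⟦⟧-no (i ℕ.≟ k) (ℕₚ.<⇒≢ (ℕₚ.<-≤-trans (∈ₚ.∈-upTo⁻ i∈) m≤k)))) (ℕₚ.*-zeroʳ (c i)))

  ∑ᴺ-select : ∀ m k (c : ℕ → ℕ) → k < m → ∑ᴺ m (λ i → c i * ⟦ i ℕ.≟ k ⟧) ≡ c k
  ∑ᴺ-select (suc m) k c k<sm with ℕₚ.m≤n⇒m<n∨m≡n (ℕₚ.≤-pred k<sm)
  ... | inj₁ k<m = trans (∑ᴺ-suc m _) (trans (cong₂ _+_ (∑ᴺ-select m k c k<m)
      (trans (cong (c m *_) (⟦⟧-no (m ℕ.≟ k) (λ m≡k → ℕₚ.<-irrefl (sym m≡k) k<m))) (ℕₚ.*-zeroʳ (c m)))) (ℕₚ.+-identityʳ (c k)))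
  ... | inj₂ refl = trans (∑ᴺ-suc m _) (cong₂ _+_ (∑ᴺ-select-out m m c ℕₚ.≤-refl)
      (trans (cong (c m *_) (⟦⟧-yes (m ℕ.≟ m) refl)) (ℕₚ.*-identityʳ (c m))))

  module _ (D : ℕ) (1≤D : 1 ≤ D) where

    private
      n : ℕ
      n = 2 + D

      ∑-G3 : ∀ f → ∑ (distancesG3 D) f ≡ n * f 1 + ∑ᴺ (D ∸ 1) (λ i → (D ∸ i) * f (2 + i))
      ∑-G3 f = trans (∑-++ (replicate n 1) _ f) (cong₂ _+_ (∑-replicate n 1 f)
        (trans (∑-concatMap _ (map (2 +_) (upTo (D ∸ 1))) f)
          (trans (∑-map (2 +_) (upTo (D ∸ 1)) _) (∑-cong (upTo (D ∸ 1)) (λ i _ → ∑-replicate (D ∸ i) (2 + i) f)))))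

      exact : ∀ s → 1 ≤ s → s < D → ∑ (distancesG3 D) (λ e → ⟦ e ℕ.≟ suc s ⟧) ≡ n ∸ suc s
      exact (suc s) _ s<D = trans (∑-G3 (λ e → ⟦ e ℕ.≟ 2 + s ⟧)) (trans (cong₂ _+_
          (trans (cong (n *_) (⟦⟧-no (1 ℕ.≟ suc (suc s)) (λ ()))) (ℕₚ.*-zeroʳ n))
          (trans (∑-cong (upTo (D ∸ 1)) (λ i _ → cong ((D ∸ i) *_)
              (⟦⟧-cong (2 + i ℕ.≟ suc (suc s)) (i ℕ.≟ s) (λ eq → ℕₚ.suc-injective (ℕₚ.suc-injective eq)) (cong (2 +_)))))
            (∑ᴺ-select (D ∸ 1) s (D ∸_) (ℕₚ.∸-monoˡ-≤ 1 s<D)))) refl)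

      exact-1 : ∑ (distancesG3 D) (λ e → ⟦ e ℕ.≟ 1 ⟧) ≡ n
      exact-1 = trans (∑-G3 (λ e → ⟦ e ℕ.≟ 1 ⟧)) (trans (cong₂ _+_ (ℕₚ.*-identityʳ n)
        (∑-zero (upTo (D ∸ 1)) (λ i _ → ℕₚ.*-zeroʳ (D ∸ i)))) (ℕₚ.+-identityʳ n))

      range : ∀ e → e ∈ distancesG3 D → 1 ≤ e × e ≤ D
      range e e∈ with ∈ₚ.∈-++⁻ (replicate n 1) e∈
      ... | inj₁ h with ∈-replicate n h
      ... | refl = ℕₚ.≤-refl , 1≤D
      range e e∈ | inj₂ h with find (∈ₚ.∈-concatMap⁻ _ {xs = map (2 +_) (upTo (D ∸ 1))} h)
      ... | j , j∈ , r with ∈-replicate (n ∸ j) r | ∈ₚ.∈-map⁻ (2 +_) j∈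
      ... | refl | i , i∈ , refl = s≤s z≤n , ℕₚ.≤-trans (s≤s (∈ₚ.∈-upTo⁻ i∈)) (ℕₚ.≤-reflexive (ℕₚ.suc-pred D {{ℕ.>-nonZero 1≤D}}))

    distancesG3-pos : ∀ e → e ∈ distancesG3 D → 1 ≤ e
    distancesG3-pos e e∈ = proj₁ (range e e∈)

    distancesG3-≤ : ∀ e → e ∈ distancesG3 D → e ≤ D
    distancesG3-≤ e e∈ = proj₂ (range e e∈)

    -- The list has one more entry up to `t` than a path. The induction descends from `t = D`, where
    -- nothing is farther away and the surplus is the single pair that a path has at distance
    -- `D + 1`. On levels 2 to `D` list and path have equally many pairs, so the surplus persists.
    far-G3 : ∀ t → 1 ≤ t → t ≤ D → far (distancesG3 D) id t + suc (tri t n) ≡ tri (suc D) n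
    far-G3 t 1≤t t≤D = go (D ∸ t) t 1≤t (ℕₚ.m∸n+n≡m t≤D)
      where
      go : ∀ k t → 1 ≤ t → k + t ≡ D → far (distancesG3 D) id t + suc (tri t n) ≡ tri (suc D) n
      go zero t _ refl = trans (cong (_+ suc (tri t n)) (far-zero (distancesG3 D) id t distancesG3-≤))
        (sym (trans (tri-suc t n) (trans (cong (tri t n +_) (ℕₚ.m+n∸n≡m 1 t)) (ℕₚ.+-comm (tri t n) 1))))
      go (suc k) t 1≤t eq = begin
        far (distancesG3 D) id t + suc (tri t n)
          ≡⟨ cong (_+ suc (tri t n)) (trans (far-suc (distancesG3 D) id t) (cong (far (distancesG3 D) id (suc t) +_)
               (exact t 1≤t (subst (suc t ≤_) eq (s≤s (ℕₚ.m≤n+m t k)))))) ⟩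
        (far (distancesG3 D) id (suc t) + (n ∸ suc t)) + suc (tri t n)
          ≡⟨ ℕₚ.+-assoc (far (distancesG3 D) id (suc t)) _ _ ⟩
        far (distancesG3 D) id (suc t) + ((n ∸ suc t) + suc (tri t n))
          ≡⟨ cong (far (distancesG3 D) id (suc t) +_) (trans (ℕₚ.+-comm (n ∸ suc t) _) (cong suc (sym (tri-suc t n)))) ⟩
        far (distancesG3 D) id (suc t) + suc (tri (suc t) n)
          ≡⟨ go k (suc t) (s≤s z≤n) (trans (ℕₚ.+-suc k t) eq) ⟩
        tri (suc D) n ∎
        where open ≡-Reasoning

    length-G3 : length (distancesG3 D) ≡ tri (suc D) n
    length-G3 = begin
      length (distancesG3 D)
        ≡⟨ sym (far-all (distancesG3 D) id 0 distancesG3-pos) ⟩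
      far (distancesG3 D) id 0
        ≡⟨ trans (far-suc (distancesG3 D) id 0) (cong (far (distancesG3 D) id 1 +_) exact-1) ⟩
      far (distancesG3 D) id 1 + n
        ≡⟨ cong (far (distancesG3 D) id 1 +_) (sym (trans (cong suc (tri-suc 0 n)) (cong (λ k → suc (k + suc D)) (tri-0 n)))) ⟩
      far (distancesG3 D) id 1 + suc (tri 1 n)
        ≡⟨ far-G3 1 ℕₚ.≤-refl 1≤D ⟩
      tri (suc D) n ∎
      where open ≡-Reasoning

  -- The division is exact: n(n - 3) = n(n - 1) - 2n is twice the number of pairs that remain once
  -- `n` of them are set aside.
  length-J : ∀ n → 3 ≤ n → length (distancesJ n) ≡ tri (n ∸ 1) n
  length-J n 3≤n = trans (Listₚ.length-++ (replicate n 1)) (trans (cong₂ _+_ (Listₚ.length-replicate n) (Listₚ.length-replicate _))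
    (trans (cong (n +_) half) (ℕₚ.m+[n∸m]≡n n≤)))
    where
    N = tri (n ∸ 1) n
    rearrange : ∀ k → (3 + k) * (2 + k) ≡ 2 * (3 + k) + (3 + k) * k
    rearrange = solve 1 (λ k → (con 3 :+ k) :* (con 2 :+ k) := con 2 :* (con 3 :+ k) :+ (con 3 :+ k) :* k) refl
      where open +-*-Solver
    double : 2 * N ≡ 2 * n + n * (n ∸ 3)
    double = trans (2*tri (n ∸ 1) n (ℕₚ.m≤n+m∸n n 1)) (subst (λ m → m * (m ∸ 1) ≡ 2 * m + m * (m ∸ 3)) (ℕₚ.m+[n∸m]≡n 3≤n) (rearrange (n ∸ 3)))
    n≤ : n ≤ N
    n≤ = ℕₚ.*-cancelˡ-≤ 2 (subst (2 * n ≤_) (sym double) (ℕₚ.m≤m+n (2 * n) _))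
    half : n * (n ∸ 3) ℕ./ 2 ≡ N ∸ n
    half = trans (cong (ℕ._/ 2) (sym (trans (ℕₚ.*-distribʳ-∸ 2 N n)
        (trans (cong₂ _∸_ (trans (ℕₚ.*-comm N 2) double) (ℕₚ.*-comm n 2)) (ℕₚ.m+n∸m≡n (2 * n) (n * (n ∸ 3)))))))
      (DivMod.m*n/n≡m (N ∸ n) 2)

  distancesJ-range : ∀ n e → e ∈ distancesJ n → 1 ≤ e × e ≤ 2
  distancesJ-range n e e∈ with ∈ₚ.∈-++⁻ (replicate n 1) e∈
  ... | inj₁ h with ∈-replicate n h
  ... | refl = ℕₚ.≤-refl , s≤s z≤n
  distancesJ-range n e e∈ | inj₂ h with ∈-replicate (n * (n ∸ 3) ℕ./ 2) h
  ... | refl = s≤s z≤n , ℕₚ.≤-refl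

  far-J-1 : ∀ n → far (distancesJ n) id 1 + n ≡ length (distancesJ n)
  far-J-1 n = trans (cong (_+ n) (trans (∑-++ (replicate n 1) _ _) (cong₂ _+_
      (trans (∑-replicate n 1 _) (ℕₚ.*-zeroʳ n)) (trans (∑-replicate q 2 _) (ℕₚ.*-identityʳ q)))))
    (trans (ℕₚ.+-comm q n) (sym (trans (Listₚ.length-++ (replicate n 1)) (cong₂ _+_ (Listₚ.length-replicate n) (Listₚ.length-replicate q)))))
    where q = n * (n ∸ 3) ℕ./ 2

  -- Distance counts of a unicyclic graph against the two lists.

  module DistanceCounts {n : ℕ} (6≤n : 6 ≤ n) (G : Graph n) (unicyclic : Unicyclic G) where

    private
      D : ℕ
      D = n ∸ 2

      n≡ : 2 + D ≡ n
      n≡ = ℕₚ.m+[n∸m]≡n (ℕₚ.≤-trans (s≤s (s≤s z≤n)) 6≤n)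

      4≤D : 4 ≤ D
      4≤D = ℕₚ.∸-monoˡ-≤ 2 6≤n

      δ : Fin n → Fin n → ℕ
      δ = dist G

      isDist : IsDist (Graph.adj G) δ
      isDist = dist-isDist G (proj₁ unicyclic)

    open ConnectedOrders G δ isDist using (close; close-sym; close-diag)
    open UnicyclicGraph G δ isDist unicyclic using (C; C-isCycle; close-1-≤)
    open Metric G δ isDist using (δ-sym; δ-pos; δ-refl)
    open CycleOrder G δ isDist C C-isCycle using (close-≥)

    distance : Fin n × Fin n → ℕ
    distance (u , v) = δ u v

    total : length (pairs {n}) ≡ tri (suc D) n
    total = trans (length-pairs n) (cong (λ m → tri (m ∸ 1) n) (sym n≡))

    within-pairs : ℕ → ℕ
    within-pairs t = ∑ pairs (λ p → ⟦ distance p ℕ.≤? t ⟧)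

    2*within-pairs : ∀ t → 2 * within-pairs t ≡ ∑∑ (close t)
    2*within-pairs t = trans (cong (2 *_) (∑-cong pairs (λ (u , v) p∈ →
        ⟦⟧-cong (δ u v ℕ.≤? t) (¬? (u Fin.≟ v) ×-dec δ u v ℕ.≤? t)
          (λ h → (λ u≡v → ℕₚ.<-irrefl (cong toℕ u≡v) (pairs-< p∈)) , h) proj₂)))
      (2*∑-pairs (close t) (close-sym t) (close-diag t))

    within-pairs-≥ : ∀ t → 1 ≤ t → t ≤ D → tri t n < within-pairs t
    within-pairs-≥ t 1≤t t≤D = ℕₚ.*-cancelˡ-≤ 2 (subst (2 * suc (tri t n) ≤_) (sym (2*within-pairs t))
      (close-≥ t 1≤t (ℕₚ.≤-trans (ℕₚ.+-monoʳ-≤ 2 t≤D) (ℕₚ.≤-reflexive n≡))))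

    within-pairs-1 : within-pairs 1 ≤ n
    within-pairs-1 = ℕₚ.*-cancelˡ-≤ 2 (subst (_≤ 2 * n) (sym (2*within-pairs 1)) close-1-≤)

    tri-top : tri (suc D) n ≡ suc (tri D n)
    tri-top = trans (tri-suc D n) (trans (cong (tri D n +_) (trans (cong (_∸ suc D) (sym n≡)) (ℕₚ.m+n∸n≡m 1 D))) (ℕₚ.+-comm (tri D n) 1))

    every-pair : (P : ℕ → Set) → P 0 → (∀ p → p ∈ pairs → P (distance p)) → ∀ u v → P (δ u v)
    every-pair P p0 h u v with ℕₚ.<-cmp (toℕ u) (toℕ v)
    ... | tri< lt _ _ = h (u , v) (pairs-∈ lt)
    ... | tri≈ _ eq _ = subst P (sym (trans (cong (δ u) (sym (Finₚ.toℕ-injective eq))) (δ-refl u))) p0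
    ... | tri> _ _ gt = subst P (δ-sym v u) (h (v , u) (pairs-∈ gt))

    -- At `t = D` the lower estimate of the close pairs is already the number of all pairs.
    diameter-≤ : ∀ u v → δ u v ≤ D
    diameter-≤ = every-pair (_≤ D) z≤n (λ _ → ∑-full (λ p → distance p ℕ.≤? D) pairs
      (subst (_≤ within-pairs D) (sym (trans total tri-top)) (within-pairs-≥ D (ℕₚ.≤-trans (s≤s z≤n) 4≤D) ℕₚ.≤-refl)))

    distance-pos : ∀ p → p ∈ pairs → 1 ≤ distance p
    distance-pos (u , v) p∈ = δ-pos (λ u≡v → ℕₚ.<-irrefl (cong toℕ u≡v) (pairs-< p∈))

    far-pairs : ℕ → ℕ
    far-pairs = far pairs distance

    far-cancel : ∀ {a b c d N} → a + b ≡ N → c + d ≡ N → a ≤ c → d ≤ b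
    far-cancel {a} {b} {c} {d} p q a≤c = ℕₚ.+-cancelˡ-≤ c d b
      (ℕₚ.≤-trans (ℕₚ.≤-reflexive (trans q (sym p))) (ℕₚ.+-monoˡ-≤ b a≤c))

    far-G3′ : ∀ t → 1 ≤ t → t ≤ D → suc (tri t n) + far (distancesG3 D) id t ≡ length (pairs {n})
    far-G3′ t 1≤t t≤D = trans (ℕₚ.+-comm _ (far (distancesG3 D) id t)) (trans (subst (λ m → far (distancesG3 D) id t + suc (tri t m) ≡ tri (suc D) m) n≡
      (far-G3 D (ℕₚ.≤-trans (s≤s z≤n) 4≤D) t 1≤t t≤D)) (sym total))

    far-pairs-≤-G3 : ∀ t → 1 ≤ t → far-pairs t ≤ far (distancesG3 D) id t
    far-pairs-≤-G3 t 1≤t with t ℕ.≤? D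
    ... | yes t≤D = far-cancel (far-G3′ t 1≤t t≤D) (∑≤+far pairs distance t) (within-pairs-≥ t 1≤t t≤D)
    ... | no t≰D  = ℕₚ.≤-trans (ℕₚ.≤-reflexive (far-zero pairs distance t
      (λ (u , v) _ → ℕₚ.≤-trans (diameter-≤ u v) (ℕₚ.<⇒≤ (ℕₚ.≰⇒> t≰D))))) z≤n

    far-G3-≤-pairs : G ≅ G3n n → ∀ t → 1 ≤ t → far (distancesG3 D) id t ≤ far-pairs t
    far-G3-≤-pairs iso t 1≤t with t ℕ.≤? D
    ... | yes t≤D = far-cancel (∑≤+far pairs distance t) (far-G3′ t 1≤t t≤D)
      (ℕₚ.*-cancelˡ-≤ 2 (subst (_≤ 2 * suc (tri t n)) (sym (2*within-pairs t))
        (G3Distances.close-≤ (ℕₚ.≤-trans (s≤s (s≤s (s≤s z≤n))) 6≤n) G δ isDist iso t)))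
    ... | no t≰D  = ℕₚ.≤-trans (ℕₚ.≤-reflexive (far-zero (distancesG3 D) id t
      (λ e e∈ → ℕₚ.≤-trans (distancesG3-≤ D (ℕₚ.≤-trans (s≤s z≤n) 4≤D) e e∈) (ℕₚ.<⇒≤ (ℕₚ.≰⇒> t≰D))))) z≤n

    G3-length : length (pairs {n}) ≡ length (distancesG3 D)
    G3-length = trans total (sym (subst (λ m → length (distancesG3 D) ≡ tri (suc D) m) n≡ (length-G3 D (ℕₚ.≤-trans (s≤s z≤n) 4≤D))))

    -- G_{3,n} has exactly two pairs at the maximal distance n - 2.
    far-≡⇒G3n : (∀ t → 1 ≤ t → t ≤ D → far-pairs t ≡ far (distancesG3 D) id t) → G ≅ G3n n
    far-≡⇒G3n far≡ = search (Finₚ.any? (λ x → Finₚ.any? (λ y → Far? x y)))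
      where
      open LongDiameter G δ isDist unicyclic D (sym n≡) (ℕₚ.<⇒≤ 4≤D) diameter-≤
      s : ℕ
      s = D ∸ 1
      D≡ : suc s ≡ D
      D≡ = ℕₚ.m+[n∸m]≡n (ℕₚ.≤-trans (s≤s z≤n) 4≤D)
      Far? : ∀ u v → Dec (s < δ u v)
      Far? u v = s ℕ.<? δ u v
      at-D : ∀ {u v} → s < δ u v → δ u v ≡ D
      at-D {u} {v} lt = ℕₚ.≤-antisym (diameter-≤ u v) (subst (_≤ δ u v) D≡ lt)
      two : far-pairs s ≡ 2
      two = trans (far≡ s (ℕₚ.≤-trans (s≤s z≤n) (ℕₚ.∸-monoˡ-≤ 1 4≤D)) (ℕₚ.m∸n≤m D 1))
        (ℕₚ.+-cancelˡ-≡ (suc (tri s n)) _ _ (trans (far-G3′ s (ℕₚ.≤-trans (s≤s z≤n) (ℕₚ.∸-monoˡ-≤ 1 4≤D)) (ℕₚ.m∸n≤m D 1))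
          (trans total (trans tri-top (cong suc (trans (cong (λ k → tri k n) (sym D≡)) (trans (tri-suc s n)
            (trans (cong (tri s n +_) (trans (cong₂ _∸_ (sym n≡) D≡) (ℕₚ.m+n∸n≡m 2 D))) refl))))))))
      four : ∑∑ (λ u v → ⟦ Far? u v ⟧) ≡ 4
      four = trans (sym (2*∑-pairs (λ u v → ⟦ Far? u v ⟧)
          (λ u v → ⟦⟧-cong (Far? u v) (Far? v u) (subst (s <_) (δ-sym u v)) (subst (s <_) (δ-sym v u)))
          (λ u → ⟦⟧-no (Far? u u) (λ h → contradiction (subst (s <_) (δ-refl u) h) λ ()))))
        (cong (2 *_) two)
      search : Dec (∃ λ x → ∃ λ y → s < δ x y) → G ≅ G3n n
      search (no ¬∃) = contradiction (trans (sym four) (∑-zero (allFin n) (λ u _ → ∑-zero (allFin n)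
        (λ v _ → ⟦⟧-no (Far? u v) (λ h → ¬∃ (u , v , h)))))) λ ()
      search (yes (x , y , xy)) = second (Finₚ.any? (λ u → Finₚ.any? (λ v →
          Far? u v ×-dec ¬? ((u Fin.≟ x ×-dec v Fin.≟ y) ⊎-dec (u Fin.≟ y ×-dec v Fin.≟ x)))))
        where
        second : Dec (∃ λ u → ∃ λ v → s < δ u v × ¬ ((u ≡ x × v ≡ y) ⊎ (u ≡ y × v ≡ x))) → G ≅ G3n n
        second (yes (u , v , uv , ¬h)) = Fork⇒G3n (two-far⇒Fork (at-D xy) (at-D uv) (¬h ∘ inj₁) (¬h ∘ inj₂))
        -- Two far pairs make four ordered ones, and a single pair accounts for at most two of them.
        second (no ¬∃) = contradiction (∑∑-≤2 Far? x y (λ u v h → decidable-stable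
            ((u Fin.≟ x ×-dec v Fin.≟ y) ⊎-dec (u Fin.≟ y ×-dec v Fin.≟ x)) (λ ¬h → ¬∃ (u , v , h , ¬h))))
          (ℕₚ.<⇒≱ (subst (2 <_) (sym four) (s≤s (s≤s (s≤s z≤n)))))

    J-length : length (distancesJ n) ≡ length (pairs {n})
    J-length = trans (length-J n (ℕₚ.≤-trans (s≤s (s≤s (s≤s z≤n))) 6≤n)) (sym (length-pairs n))

    far-J-≤-pairs : ∀ t → 1 ≤ t → far (distancesJ n) id t ≤ far-pairs t
    far-J-≤-pairs (suc zero)    _ = far-cancel (∑≤+far pairs distance 1)
      (trans (ℕₚ.+-comm n _) (trans (far-J-1 n) J-length)) within-pairs-1
    far-J-≤-pairs (suc (suc t)) _ = ℕₚ.≤-trans (ℕₚ.≤-reflexive (far-zero (distancesJ n) id (2 + t)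
      (λ e e∈ → ℕₚ.≤-trans (proj₂ (distancesJ-range n e e∈)) (ℕₚ.m≤m+n 2 t)))) z≤n

    -- At `t = 1` the estimate is the edge count, because `suc (tri 1 n)` is `n`; from `t = 2` on,
    -- the diameter of J_n leaves nothing beyond.
    far-pairs-≤-J : G ≅ Jn n → ∀ t → 1 ≤ t → far-pairs t ≤ far (distancesJ n) id t
    far-pairs-≤-J iso (suc zero)    _ = far-cancel (trans (ℕₚ.+-comm n _) (trans (far-J-1 n) J-length))
      (∑≤+far pairs distance 1)
      (subst (_≤ within-pairs 1) (trans (cong suc (tri-suc 0 n)) (trans (cong (λ k → suc (k + (n ∸ 1))) (tri-0 n))
          (ℕₚ.m+[n∸m]≡n (ℕₚ.≤-trans (s≤s z≤n) 6≤n))))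
        (within-pairs-≥ 1 ℕₚ.≤-refl (ℕₚ.≤-trans (s≤s z≤n) 4≤D)))
    far-pairs-≤-J iso (suc (suc t)) _ = ℕₚ.≤-trans (ℕₚ.≤-reflexive (far-zero pairs distance (2 + t)
      (λ (u , v) _ → ℕₚ.≤-trans (DiameterTwo.Jn-diameter G δ isDist unicyclic 6≤n iso u v) (ℕₚ.m≤m+n 2 t)))) z≤n

    far-≡⇒Jn : far (distancesJ n) id 2 ≡ far-pairs 2 → G ≅ Jn n
    far-≡⇒Jn eq = DiameterTwo.diameter-two⇒Jn G δ isDist unicyclic 6≤n (every-pair (_≤ 2) z≤n
      (λ _ → ∑-full (λ p → distance p ℕ.≤? 2) pairs (ℕₚ.≤-reflexive (sym
        (trans (sym (ℕₚ.+-identityʳ _)) (trans (cong (within-pairs 2 +_) (sym none)) (∑≤+far pairs distance 2)))))))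
      where
      none : far-pairs 2 ≡ 0
      none = trans (sym eq) (far-zero (distancesJ n) id 2 (λ e e∈ → proj₂ (distancesJ-range n e e∈)))

  -- The bounds for increasing `h`, and their transfer to decreasing `h`.

  module Bounds {c ℓ : Level} (A : OrderedAbelianGroup c ℓ) (n : ℕ) (6≤n : 6 ≤ n) (G : Graph n) (unicyclic : Unicyclic G)
                (h : ℕ → OrderedAbelianGroup.Carrier A) (inc : StrictlyIncreasing A h) where

    open OrderedAbelianGroup A using () renaming (_≤_ to _≤ᴬ_; _<_ to _<ᴬ_)
    open GroupSums A
    open Increasing h inc
    open DistanceCounts 6≤n G unicyclic
    private
      module <ᴬ = IsStrictTotalOrder (OrderedAbelianGroup.isStrictTotalOrder A)

      D : ℕ
      D = n ∸ 2

      n≡ : 2 + D ≡ n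
      n≡ = ℕₚ.m+[n∸m]≡n (ℕₚ.≤-trans (s≤s (s≤s z≤n)) 6≤n)

      2≤D : 2 ≤ D
      2≤D = ℕₚ.≤-trans (s≤s (s≤s z≤n)) (ℕₚ.∸-monoˡ-≤ 2 6≤n)

      distance-≤ : ∀ p → p ∈ pairs → distance p ≤ suc D
      distance-≤ (u , v) _ = ℕₚ.m≤n⇒m≤1+n (diameter-≤ u v)

      J-pos : ∀ e → e ∈ distancesJ n → 1 ≤ e
      J-pos e e∈ = proj₁ (distancesJ-range n e e∈)

      J-≤ : ∀ e → e ∈ distancesJ n → e ≤ suc D
      J-≤ e e∈ = ℕₚ.≤-trans (proj₂ (distancesJ-range n e e∈)) (ℕₚ.m≤n⇒m≤1+n 2≤D)

      G3-pos : ∀ e → e ∈ distancesG3 D → 1 ≤ e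
      G3-pos = distancesG3-pos D (ℕₚ.<⇒≤ 2≤D)

      G3-≤ : ∀ e → e ∈ distancesG3 D → e ≤ suc D
      G3-≤ e e∈ = ℕₚ.m≤n⇒m≤1+n (distancesG3-≤ D (ℕₚ.<⇒≤ 2≤D) e e∈)

      LowJ≡ : LowJ A h n ≡ ∑ᴬ (distancesJ n) h
      LowJ≡ = LowJ-sum A h n

      F3≡ : F3 A h n ≡ ∑ᴬ (distancesG3 D) h
      F3≡ = subst (λ m → F3 A h m ≡ ∑ᴬ (distancesG3 D) h) n≡ (F3-sum A h D)

      -- For an extremal graph `compare` applies in both directions, and the two results are
      -- compatible only if the sums are equal.
      sandwich : ∀ {x y} {P Q : Set} → (x <ᴬ y) ⊎ (x ≡ y × P) → (y <ᴬ x) ⊎ (y ≡ x × Q) → x ≡ y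
      sandwich (inj₂ (eq , _)) _               = eq
      sandwich (inj₁ _)        (inj₂ (eq , _)) = sym eq
      sandwich (inj₁ lt)       (inj₁ gt)       = contradiction gt (<ᴬ.asym lt)

      equality : ∀ {x y} {P : Set} → (x <ᴬ y) ⊎ (x ≡ y × P) → x ≡ y → P
      equality (inj₁ lt)      eq = contradiction lt (<ᴬ.irrefl eq)
      equality (inj₂ (_ , p)) _  = p

      weaken : ∀ {x y} {P : Set} → (x <ᴬ y) ⊎ (x ≡ y × P) → x ≤ᴬ y
      weaken (inj₁ lt)       = inj₁ lt
      weaken (inj₂ (eq , _)) = inj₂ eq

      lower = compare (distancesJ n) id pairs distance J-length J-pos distance-pos D J-≤ distance-≤ far-J-≤-pairs

      upper = compare pairs distance (distancesG3 D) id G3-length distance-pos G3-pos D distance-≤ G3-≤ far-pairs-≤-G3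

    bounds : (LowJ A h n ≤ᴬ W A h G) × (W A h G ≤ᴬ F3 A h n)
           × ((W A h G ≡ LowJ A h n) ⇔ (G ≅ Jn n))
           × ((W A h G ≡ F3 A h n) ⇔ (G ≅ G3n n))
    bounds = subst (_≤ᴬ W A h G) (sym LowJ≡) (weaken lower)
      , subst (W A h G ≤ᴬ_) (sym F3≡) (weaken upper)
      , mk⇔ (λ eq → far-≡⇒Jn (equality lower (sym (trans eq LowJ≡)) 2 (s≤s z≤n) 2≤D))
            (λ iso → trans (sym (sandwich lower
               (compare pairs distance (distancesJ n) id (sym J-length) distance-pos J-pos D distance-≤ J-≤ (far-pairs-≤-J iso)))) (sym LowJ≡))
      , mk⇔ (λ eq → far-≡⇒G3n (equality upper (trans eq F3≡)))
            (λ iso → trans (sandwich upper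
               (compare (distancesG3 D) id pairs distance (sym G3-length) G3-pos distance-pos D G3-≤ distance-≤ (far-G3-≤-pairs iso))) (sym F3≡))

  opposite : ∀ {c ℓ} → OrderedAbelianGroup c ℓ → OrderedAbelianGroup c ℓ
  opposite A = record
    { Carrier            = A.Carrier
    ; _+_                = A._+_
    ; 0#                 = A.0#
    ; -_                 = A.-_
    ; _<_                = λ x y → y A.< x
    ; isAbelianGroup     = A.isAbelianGroup
    ; isStrictTotalOrder = Flip.isStrictTotalOrder A.isStrictTotalOrder
    ; +-mono-<           = A.+-mono-<
    }
    where module A = OrderedAbelianGroup A

  module _ {c ℓ : Level} (A : OrderedAbelianGroup c ℓ) where

    open OrderedAbelianGroup A using (_·_) renaming (_+_ to _⊕_; _≤_ to _≤ᴬ_)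
    open OrderedAbelianGroup (opposite A) using () renaming (_·_ to _·′_; _≤_ to _≥ᴬ_)

    opposite-≤ : ∀ {x y x′ y′} → x ≥ᴬ y → x ≡ x′ → y ≡ y′ → y′ ≤ᴬ x′
    opposite-≤ (inj₁ lt)   refl refl = inj₁ lt
    opposite-≤ (inj₂ refl) refl refl = inj₂ refl

    -- The two multiples have the same clauses but take different records as parameter, so for a
    -- variable `k` they agree only by induction.
    opposite-· : ∀ k x → k ·′ x ≡ k · x
    opposite-· zero    x = refl
    opposite-· (suc k) x = cong (x ⊕_) (opposite-· k x)

    opposite-LowJ : ∀ h n → LowJ (opposite A) h n ≡ LowJ A h n
    opposite-LowJ h n = cong₂ _⊕_ (opposite-· n (h 1)) (opposite-· (n * (n ∸ 3) ℕ./ 2) (h 2))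

    opposite-F3 : ∀ h n → F3 (opposite A) h n ≡ F3 A h n
    opposite-F3 h n = cong₂ _⊕_ (opposite-· n (h 1))
      (GroupSums.∑ᴬ-cong A (map (2 +_) (upTo (suc (n ∸ 2) ∸ 2))) (λ j _ → opposite-· (n ∸ j) (h j)))

    ⇔-substʳ : ∀ {p} {P : Set p} {x y y′ : OrderedAbelianGroup.Carrier A} → y ≡ y′ → (x ≡ y) ⇔ P → (x ≡ y′) ⇔ P
    ⇔-substʳ refl e = e

theorem2p7 : ∀ {c ℓ} (A : OrderedAbelianGroup c ℓ) (n : ℕ) → 6 ℕ.≤ n →
    (G : Graph n) → Unicyclic G → (h : ℕ → OrderedAbelianGroup.Carrier A) →
    let open OrderedAbelianGroup A using (_≤_) in (StrictlyIncreasing A h →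
    (LowJ A h n ≤ W A h G) × (W A h G ≤ F3 A h n)
    × ((W A h G ≡ LowJ A h n) ⇔ (G ≅ Jn n))
    × ((W A h G ≡ F3 A h n) ⇔ (G ≅ G3n n)))
    × (StrictlyDecreasing A h →
    (F3 A h n ≤ W A h G) × (W A h G ≤ LowJ A h n)
    × ((W A h G ≡ F3 A h n) ⇔ (G ≅ G3n n))
    × ((W A h G ≡ LowJ A h n) ⇔ (G ≅ Jn n)))
theorem2p7 A n 6≤n G unicyclic h = Bounds.bounds A n 6≤n G unicyclic h
  -- `StrictlyDecreasing A h` unfolds to `StrictlyIncreasing (opposite A) h`, and `W` does not
  -- depend on the order; only the multiples inside `LowJ` and `F3` have to be translated back.
  , λ dec → let (low , up , onJ , onG3) = Bounds.bounds (opposite A) n 6≤n G unicyclic h dec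
                j = opposite-LowJ A h n
                g = opposite-F3 A h n
            in opposite-≤ A up refl g , opposite-≤ A low j refl , ⇔-substʳ A g onG3 , ⇔-substʳ A j onJ
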